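{- Let $R\cong R_1\times R_2\times\cdots\times R_n$ with $n\ge 2$ be a finite non-local commutative ring with unity, where each $R_i$ is a local ring, and suppose $U''(R)\neq\emptyset$. Then: (i) If $n\ge 3$, then $\mathrm{sdim}(\mathrm{Cl}_2(R))=(2^n-1)|U(R)|-2^n$. (ii) If $n=2$ and $R$ is isomorphic to one of the rings $\mathbb{F}_4\times\mathbb{Z}_2$, $\mathbb{Z}_5\times\mathbb{Z}_2$, $\mathbb{Z}_2[x]/\langle x^3\rangle\times\mathbb{Z}_2$, $\mathbb{Z}_4[x]/\langle 2x,x^2-2\rangle\times\mathbb{Z}_2$, then $\mathrm{sdim}(\mathrm{Cl}_2(R))=3|U(R)|-5$. (iii) If $n=2$ and $R$ is not isomorphic to any of the rings listed in (ii), then $\mathrm{sdim}(\mathrm{Cl}_2(R))=3|U(R)|-6$.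
   Context: $U(R)$ is the set of units, $U'(R)=\{u\in U(R):u^2=1\}$, $U''(R)=U(R)\setminus U'(R)$, $\mathrm{Id}(R)$ the set of idempotents. $\mathbb{F}_4$ is the field with four elements. The clean graph $\mathrm{Cl}(R)$ has vertex set $\{(e,u): e\in\mathrm{Id}(R), u\in U(R)\}$, two distinct vertices $(e,u),(f,v)$ being adjacent iff $ef=0$ or $uv=1$; $\mathrm{Cl}_2(R)$ is its subgraph induced by the vertices with $e\neq 0$. In a graph, a vertex $w$ strongly resolves vertices $x,y$ if some shortest $x$–$w$ path contains $y$ or some shortest $y$–$w$ path contains $x$; a strong resolving set is a set $S$ of vertices such that every two distinct vertices are strongly resolved by some vertex of $S$; $\mathrm{sdim}$ is the smallest cardinality of a strong resolving set. -}

module Defs where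

open import Data.Nat as N using (ℕ; zero; suc; _≤_; NonZero)
open import Data.Nat.DivMod using (_mod_)
open import Data.Fin as F using (Fin; toℕ)
open import Data.Fin.Properties using (all?; any?)
open import Data.Fin.Subset using (Subset; _∈_; _⊆_)
open import Data.Product using (Σ; ∃; _×_; _,_; proj₁; proj₂)
open import Data.Sum using (_⊎_)
open import Data.List using (List; length; filter; allFin)
open import Data.List.Relation.Unary.All using (All)
open import Data.List.Relation.Unary.Any using (Any)
open import Data.List.Relation.Unary.Unique.Propositional using (Unique)
open import Relation.Nullary using (¬_; Dec)
open import Relation.Nullary.Decidable using (True; toWitness; _×-dec_)
open import Relation.Binary.PropositionalEquality
  using (_≡_; _≢_; refl; cong; cong₂; isEquivalence)
open import Algebra.Core using (Op₁; Op₂)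
import Algebra.Structures as AS

-- Finite commutative rings with unity.
-- Every finite ring is isomorphic to one whose carrier is Fin size;
-- equality is propositional equality.

record FiniteCommRing : Set where
  field
    size : ℕ
    _+_ _*_ : Op₂ (Fin size)
    -_ : Op₁ (Fin size)
    0# 1# : Fin size
    isCommutativeRing : AS.IsCommutativeRing {A = Fin size} _≡_ _+_ _*_ -_ 0# 1#

  Carrier : Set
  Carrier = Fin size

module _ (R : FiniteCommRing) where
  open FiniteCommRing R

  IsUnit : Carrier → Set
  IsUnit u = ∃ λ v → (u * v) ≡ 1#

  isUnit? : (u : Carrier) → Dec (IsUnit u)
  isUnit? u = any? (λ v → (u * v) F.≟ 1#)

  numUnits : ℕ
  numUnits = length (filter isUnit? (allFin size))

  U''NonEmpty : Set
  U''NonEmpty = ∃ λ u → IsUnit u × (u * u) ≢ 1#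

  IsIdempotent : Carrier → Set
  IsIdempotent e = (e * e) ≡ e

  IsIdeal : Subset size → Set
  IsIdeal I = (0# ∈ I)
            × (∀ x y → x ∈ I → y ∈ I → (x + y) ∈ I)
            × (∀ x → x ∈ I → (- x) ∈ I)
            × (∀ r x → x ∈ I → (r * x) ∈ I)

  IsMaximalIdeal : Subset size → Set
  IsMaximalIdeal M = IsIdeal M × ¬ (1# ∈ M)
                   × (∀ J → IsIdeal J → M ⊆ J → J ≡ M ⊎ 1# ∈ J)

  IsLocal : Set
  IsLocal = Σ (Subset size) λ M → IsMaximalIdeal M × (∀ J → IsMaximalIdeal J → J ≡ M)

  Pair : Set
  Pair = Carrier × Carrier

  IsVertex₂ : Pair → Set
  IsVertex₂ (e , u) = IsIdempotent e × e ≢ 0# × IsUnit u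

  -- adjacency in Cl(R) (hence in the induced subgraph Cl₂(R))
  Adj : Pair → Pair → Set
  Adj (e , u) (f , v) = (e , u) ≢ (f , v) × ((e * f) ≡ 0# ⊎ (u * v) ≡ 1#)

  IsWalk : Pair → Pair → (k : ℕ) → (Fin (suc k) → Pair) → Set
  IsWalk x y k p = p F.zero ≡ x × p (F.fromℕ k) ≡ y
                 × (∀ i → IsVertex₂ (p i))
                 × (∀ (i : Fin k) → Adj (p (F.inject₁ i)) (p (F.suc i)))

  IsShortestPath : Pair → Pair → (k : ℕ) → (Fin (suc k) → Pair) → Set
  IsShortestPath x y k p = IsWalk x y k p
                         × (∀ k′ q → IsWalk x y k′ q → k ≤ k′)

  OnPath : ∀ {k} → Pair → (Fin (suc k) → Pair) → Set
  OnPath z p = ∃ λ i → p i ≡ z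

  StronglyResolves : Pair → Pair → Pair → Set
  StronglyResolves w x y =
      (∃ λ k → ∃ λ p → IsShortestPath x w k p × OnPath y p)
    ⊎ (∃ λ k → ∃ λ p → IsShortestPath y w k p × OnPath x p)

  -- strong resolving sets of Cl₂(R) (finite sets as duplicate-free lists)
  IsStrongResolvingSet : List Pair → Set
  IsStrongResolvingSet S =
      All IsVertex₂ S
    × (∀ x y → IsVertex₂ x → IsVertex₂ y → x ≢ y →
         Any (λ w → StronglyResolves w x y) S)

  SdimCl₂ : ℕ → Set
  SdimCl₂ d =
      (∃ λ S → Unique S × IsStrongResolvingSet S × length S ≡ d)
    × (∀ S → Unique S → IsStrongResolvingSet S → d ≤ length S)

record IsoToProduct (R : FiniteCommRing) (n : ℕ) (Rs : Fin n → FiniteCommRing) : Set where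
  private module R = FiniteCommRing R
  open FiniteCommRing
  field
    φ : R.Carrier → (i : Fin n) → Carrier (Rs i)
    φ-+ : ∀ x y i → φ (x R.+ y) i ≡ _+_ (Rs i) (φ x i) (φ y i)
    φ-* : ∀ x y i → φ (x R.* y) i ≡ _*_ (Rs i) (φ x i) (φ y i)
    φ-1 : ∀ i → φ R.1# i ≡ 1# (Rs i)
    injective : ∀ x y → (∀ i → φ x i ≡ φ y i) → x ≡ y
    surjective : ∀ (g : (i : Fin n) → Carrier (Rs i)) → ∃ λ x → ∀ i → φ x i ≡ g i

pair : FiniteCommRing → FiniteCommRing → Fin 2 → FiniteCommRing
pair A B F.zero = A
pair A B (F.suc _) = B

module Build (k : ℕ) (_+_ _*_ : Op₂ (Fin k)) (-_ : Op₁ (Fin k)) (0# 1# : Fin k) where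
  open import Algebra.Definitions {A = Fin k} _≡_

  Laws : Set
  Laws = Associative _+_ × Associative _*_ × Commutative _+_ × Commutative _*_
       × LeftIdentity 0# _+_ × RightIdentity 0# _+_
       × LeftIdentity 1# _*_ × RightIdentity 1# _*_
       × LeftInverse 0# -_ _+_ × RightInverse 0# -_ _+_
       × _*_ DistributesOverˡ _+_ × _*_ DistributesOverʳ _+_

  laws? : Dec Laws
  laws? =
    (all? λ x → all? λ y → all? λ z → ((x + y) + z) F.≟ (x + (y + z))) ×-dec
    (all? λ x → all? λ y → all? λ z → ((x * y) * z) F.≟ (x * (y * z))) ×-dec
    (all? λ x → all? λ y → (x + y) F.≟ (y + x)) ×-dec
    (all? λ x → all? λ y → (x * y) F.≟ (y * x)) ×-dec
    (all? λ x → (0# + x) F.≟ x) ×-dec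
    (all? λ x → (x + 0#) F.≟ x) ×-dec
    (all? λ x → (1# * x) F.≟ x) ×-dec
    (all? λ x → (x * 1#) F.≟ x) ×-dec
    (all? λ x → ((- x) + x) F.≟ 0#) ×-dec
    (all? λ x → (x + (- x)) F.≟ 0#) ×-dec
    (all? λ x → all? λ y → all? λ z → (x * (y + z)) F.≟ ((x * y) + (x * z))) ×-dec
    (all? λ x → all? λ y → all? λ z → ((y + z) * x) F.≟ ((y * x) + (z * x)))

  ring : {ok : True laws?} → FiniteCommRing
  ring {ok} = record
    { size = k ; _+_ = _+_ ; _*_ = _*_ ; -_ = -_ ; 0# = 0# ; 1# = 1#
    ; isCommutativeRing = record
      { isRing = record
        { +-isAbelianGroup = record
          { isGroup = record
            { isMonoid = record
              { isSemigroup = record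
                { isMagma = record { isEquivalence = isEquivalence ; ∙-cong = cong₂ _+_ }
                ; assoc = +-assoc }
              ; identity = +-idˡ , +-idʳ }
            ; inverse = invˡ , invʳ
            ; ⁻¹-cong = cong -_ }
          ; comm = +-comm }
        ; *-cong = cong₂ _*_
        ; *-assoc = *-assoc
        ; *-identity = *-idˡ , *-idʳ
        ; distrib = distˡ , distʳ }
      ; *-comm = *-comm } }
    where
    L : Laws
    L = toWitness ok
    +-assoc = proj₁ L
    *-assoc = proj₁ (proj₂ L)
    +-comm = proj₁ (proj₂ (proj₂ L))
    *-comm = proj₁ (proj₂ (proj₂ (proj₂ L)))
    +-idˡ = proj₁ (proj₂ (proj₂ (proj₂ (proj₂ L))))
    +-idʳ = proj₁ (proj₂ (proj₂ (proj₂ (proj₂ (proj₂ L)))))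
    *-idˡ = proj₁ (proj₂ (proj₂ (proj₂ (proj₂ (proj₂ (proj₂ L))))))
    *-idʳ = proj₁ (proj₂ (proj₂ (proj₂ (proj₂ (proj₂ (proj₂ (proj₂ L)))))))
    invˡ = proj₁ (proj₂ (proj₂ (proj₂ (proj₂ (proj₂ (proj₂ (proj₂ (proj₂ L))))))))
    invʳ = proj₁ (proj₂ (proj₂ (proj₂ (proj₂ (proj₂ (proj₂ (proj₂ (proj₂ (proj₂ L)))))))))
    distˡ = proj₁ (proj₂ (proj₂ (proj₂ (proj₂ (proj₂ (proj₂ (proj₂ (proj₂ (proj₂ (proj₂ L))))))))))
    distʳ = proj₂ (proj₂ (proj₂ (proj₂ (proj₂ (proj₂ (proj₂ (proj₂ (proj₂ (proj₂ (proj₂ L))))))))))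

open N using (_/_; _%_)

module ℤMod (m : ℕ) .{{_ : NonZero m}} where
  add mul : Op₂ (Fin m)
  add x y = (toℕ x N.+ toℕ y) mod m
  mul x y = (toℕ x N.* toℕ y) mod m
  neg : Op₁ (Fin m)
  neg x = (m N.∸ toℕ x) mod m

ℤ₂ ℤ₅ : FiniteCommRing
ℤ₂ = Build.ring 2 (ℤMod.add 2) (ℤMod.mul 2) (ℤMod.neg 2) (0 mod 2) (1 mod 2)
ℤ₅ = Build.ring 5 (ℤMod.add 5) (ℤMod.mul 5) (ℤMod.neg 5) (0 mod 5) (1 mod 5)

-- 𝔽₄ = {a + b ω : a , b ∈ ℤ₂}, ω² = ω + 1 ; a + bω encoded as a + 2b
𝔽₄ : FiniteCommRing
𝔽₄ = Build.ring 4 add mul (λ x → x) (0 mod 4) (1 mod 4)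
  where
  a b : Fin 4 → ℕ
  a x = toℕ x % 2
  b x = toℕ x / 2
  enc : ℕ → ℕ → Fin 4
  enc p q = ((p % 2) N.+ 2 N.* (q % 2)) mod 4
  add mul : Op₂ (Fin 4)
  add x y = enc (a x N.+ a y) (b x N.+ b y)
  -- (a + bω)(c + dω) = (ac + bd) + (ad + bc + bd) ω
  mul x y = enc (a x N.* a y N.+ b x N.* b y)
                (a x N.* b y N.+ b x N.* a y N.+ b x N.* b y)

-- ℤ₂[x]/⟨x³⟩ = {a + b x + c x²}, encoded as a + 2b + 4c
ℤ₂[x]/x³ : FiniteCommRing
ℤ₂[x]/x³ = Build.ring 8 add mul (λ x → x) (0 mod 8) (1 mod 8)
  where
  a b c : Fin 8 → ℕ
  a x = toℕ x % 2
  b x = (toℕ x / 2) % 2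
  c x = toℕ x / 4
  enc : ℕ → ℕ → ℕ → Fin 8
  enc p q r = ((p % 2) N.+ 2 N.* (q % 2) N.+ 4 N.* (r % 2)) mod 8
  add mul : Op₂ (Fin 8)
  add x y = enc (a x N.+ a y) (b x N.+ b y) (c x N.+ c y)
  mul x y = enc (a x N.* a y)
                (a x N.* b y N.+ b x N.* a y)
                (a x N.* c y N.+ b x N.* b y N.+ c x N.* a y)

-- ℤ₄[x]/⟨2x , x² − 2⟩ = {a + b x : a ∈ ℤ₄ , b ∈ ℤ₂}, x² = 2, 2x = 0;
-- encoded as a + 4b
ℤ₄[x]/⟨2x,x²-2⟩ : FiniteCommRing
ℤ₄[x]/⟨2x,x²-2⟩ = Build.ring 8 add mul neg (0 mod 8) (1 mod 8)
  where
  a b : Fin 8 → ℕ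
  a x = toℕ x % 4
  b x = toℕ x / 4
  enc : ℕ → ℕ → Fin 8
  enc p q = ((p % 4) N.+ 4 N.* (q % 2)) mod 8
  add mul : Op₂ (Fin 8)
  add x y = enc (a x N.+ a y) (b x N.+ b y)
  -- (a + bx)(c + dx) = (ac + 2bd) + (ad + bc) x
  mul x y = enc (a x N.* a y N.+ 2 N.* b x N.* b y)
                (a x N.* b y N.+ b x N.* a y)
  neg : Op₁ (Fin 8)
  neg x = enc (4 N.∸ a x) (b x)

IsListedRing : FiniteCommRing → Set
IsListedRing R = IsoToProduct R 2 (pair 𝔽₄ ℤ₂)
               ⊎ IsoToProduct R 2 (pair ℤ₅ ℤ₂)
               ⊎ IsoToProduct R 2 (pair ℤ₂[x]/x³ ℤ₂)
               ⊎ IsoToProduct R 2 (pair ℤ₄[x]/⟨2x,x²-2⟩ ℤ₂)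

{-# OPTIONS --safe #-}

-- The strong resolving sets of Cl₂(R) are the vertex covers of its strong resolving graph, so
-- sdim = |V| - α with α the independence number of that graph. Since Cl₂(R) has diameter 3, the
-- edges (pairs of mutually maximally distant vertices) are explicit:
--   (1 , u) - (1 , v) with u ≠ v, uv ≠ 1;  (1 , u) - (f , u) with f ≠ 1, u² ≠ 1;
--   (e , u) - (f , v) with e, f ≠ 1, ef ≠ 0, uv ≠ 1.
-- An independent set I has at most two vertices over each idempotent, and two over e ≠ 1 exclude
-- every other idempotent f ≠ 1 with ef ≠ 0. For n ≥ 3 sending the second vertex over e to a suitable
-- excluded f, and the second one over 1 to 0, injects I into the 2ⁿ idempotents, and this is attained.
-- For n = 2 the two proper idempotents are orthogonal, so α = 6 if U″ contains two different pairs
-- {u , u⁻¹}, and α = 5 if it is a single pair. The latter forces one factor to be ℤ₂ and the units of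
-- the other one to be {1 , a , a²} with a³ = 1 or {1 , a , a² , a³} with a⁴ = 1, which leaves the listed rings.
module Submission where

open import Defs
open import Algebra.Bundles using (CommutativeRing)
import Algebra.Properties.Group as GroupProps
import Algebra.Properties.Ring as RingProps
import Algebra.Properties.Semiring.Exp as SemiringExp
import Algebra.Properties.Semiring.Mult.TCOptimised as SemiringMult
import Algebra.Solver.Ring as RingSolver
open import Algebra.Solver.Ring.AlmostCommutativeRing using (fromCommutativeRing; _-Raw-AlmostCommutative⟶_)
open import Data.Bool using (Bool; true; false)
open import Data.Empty using (⊥; ⊥-elim)
open import Data.Fin as F using (Fin; toℕ; funToFin; finToFun)
open import Data.Fin.Properties
  using (all?; any?; <-cmp; <⇒≢; suc-injective; fromℕ≢inject₁; inject₁-injective; funToFin-finToFin; finToFun-funToFin)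
open import Data.Fin.Subset using (Subset; _⊆_; ∣_∣) renaming (_∈_ to _∈ₛ_; _∉_ to _∉ₛ_)
open import Data.Fin.Subset.Properties
  using (_⊆?_; ⊆-antisym; ⊆-refl; ⊆-trans; anySubset?; p⊂q⇒∣p∣<∣q∣; ∣p∣≤n) renaming (_∈?_ to _∈ₛ?_)
open import Data.Integer as ℤ using (ℤ)
import Data.Integer.Properties as ℤₚ
open import Data.List using (List; []; _∷_; _++_; length; map; filter; allFin; cartesianProduct)
open import Data.List.Properties using (length-++; length-map; length-tabulate)
import Data.List.Membership.DecPropositional as DecMembership
open import Data.List.Membership.Propositional using (_∈_; _∉_; lose; find)
open import Data.List.Membership.Propositional.Properties
  using (∈-∃++; ∈-++⁻; ∈-++⁺ˡ; ∈-++⁺ʳ; ∈-map⁺; ∈-map⁻; ∈-allFin; ∈-filter⁺; ∈-filter⁻; ∈-cartesianProduct⁺; ∈-cartesianProduct⁻)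
open import Data.List.Relation.Unary.All as All using (All; []; _∷_)
open import Data.List.Relation.Unary.AllPairs using ([]; _∷_)
open import Data.List.Relation.Unary.Any using (Any; here; there)
open import Data.List.Relation.Unary.Unique.Propositional using (Unique)
import Data.List.Relation.Unary.Unique.Propositional.Properties as Uniq
open import Data.Maybe as Maybe using (Maybe)
open import Data.Nat as ℕ using (ℕ; zero; suc; _≤_; z≤n; s≤s; _∸_; _^_; NonZero)
open import Data.Nat.DivMod using (_%_; _/_; m≡m%n+[m/n]*n)
import Data.Nat.Properties as ℕₚ
open import Data.Product using (∃; _×_; _,_; proj₁; proj₂; map₂)
open import Data.Product.Properties using (≡-dec; ,-injectiveʳ)
open import Data.Sum using (_⊎_; inj₁; inj₂; [_,_])
import Data.Vec as Vec
open import Data.Vec.Properties using (lookup∘tabulate; lookup⇒[]=; []=⇒lookup)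
open import Function using (id; _∘_)
open import Relation.Binary.Consequences using (dec⇒weaklyDec)
open import Relation.Binary.Definitions using (DecidableEquality; tri<; tri≈; tri>)
open import Relation.Binary.PropositionalEquality
  using (_≡_; _≢_; refl; sym; trans; cong; cong₂; subst; _≗_; ≢-sym; module ≡-Reasoning)
open import Relation.Nullary using (¬_; Dec; yes; no; contradiction; does)
open import Relation.Nullary.Decidable
  using (_×-dec_; _⊎-dec_; _→-dec_; ¬?; decidable-stable; dec-true; from-yes)
open import Relation.Unary using (Decidable)

-- No distance is ever computed. Two facts tie `Edge` to strong resolution. A geodesic from one end
-- of an edge that reaches the other end cannot continue past it, so only the ends resolve that
-- pair. And any two distinct vertices lie on a geodesic whose ends form an edge, so every cover
-- resolves them. Such a prolongation may require a unit outside {u , u⁻¹} even when u² = 1; this is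
-- where U″ ≠ ∅ enters. For n ≥ 3 the obstacle is to charge the second vertices to different
-- idempotents. If ef ≠ 0, then e and f cannot both carry one; if ef = 0 they can, so the charges of
-- orthogonal idempotents must differ. A singleton has no nonempty proper part to be charged to,
-- hence the cyclic shift of the atoms. For n = 2 no other proper idempotent meets e, so nothing can
-- be charged. The classification rests on one device: the unit group is a short list of powers of
-- a, and well-chosen units such as -1, 1 + a + a² or 1 + x³ must occur in that list.

-- Ring arithmetic and a ring solver with integer coefficients

module Arithmetic (R : FiniteCommRing) where
  open FiniteCommRing R public using (size; isCommutativeRing; Carrier)

  commutativeRing : CommutativeRing _ _
  commutativeRing = record { isCommutativeRing = isCommutativeRing }

  open CommutativeRing commutativeRing public
    using (_+_; _*_; -_; 0#; 1#; +-assoc; +-comm; +-identityˡ; +-identityʳ; -‿inverseʳ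
          ; *-assoc; *-comm; *-identityˡ; *-identityʳ; distribʳ; zeroˡ; zeroʳ; _-_)
  open GroupProps (CommutativeRing.+-group commutativeRing) public
    using () renaming (∙-cancelˡ to +-cancelˡ; x∙y⁻¹≈ε⇒x≈y to x-y≡0⇒x≡y)
  open SemiringMult (CommutativeRing.semiring commutativeRing) public
    using (1+×; ×-homo-+; ×1-homo-*) renaming (_×_ to _·_)

  open SemiringExp (CommutativeRing.semiring commutativeRing) public using () renaming (_^_ to _↑_)

  -- The multiples of `1#`, in the variant for which `ι 1` reduces to `1#`; this lets `1-homo` hold
  -- by `refl`.
  ι : ℕ → Carrier
  ι n = n · 1#

  ι-+ : ∀ m n → ι (m ℕ.+ n) ≡ ι m + ι n
  ι-+ = ×-homo-+ 1#

  ι-* : ∀ m n → ι (m ℕ.* n) ≡ ι m * ι n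
  ι-* = ×1-homo-*

  private
    open RingProps (CommutativeRing.ring commutativeRing)

    ιℤ : ℤ → Carrier
    ιℤ (ℤ.+ n) = ι n
    ιℤ ℤ.-[1+ n ] = - ι (suc n)

    ιℤ-neg : ∀ i → ιℤ (ℤ.- i) ≡ - ιℤ i
    ιℤ-neg (ℤ.+ zero) = sym -0#≈0#
    ιℤ-neg (ℤ.+ suc n) = refl
    ιℤ-neg ℤ.-[1+ n ] = sym (-‿involutive _)

    ιℤ-⊖ : ∀ m n → ιℤ (m ℤ.⊖ n) ≡ ι m - ι n
    ιℤ-⊖ m zero = sym (trans (cong (ι m +_) -0#≈0#) (+-identityʳ _))
    ιℤ-⊖ zero (suc n) = sym (+-identityˡ _)
    ιℤ-⊖ (suc m) (suc n) = begin
      ιℤ (suc m ℤ.⊖ suc n)          ≡⟨ cong ιℤ (ℤₚ.[1+m]⊖[1+n]≡m⊖n m n) ⟩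
      ιℤ (m ℤ.⊖ n)                  ≡⟨ ιℤ-⊖ m n ⟩
      ι m - ι n                     ≡⟨ cong (_- ι n) (sym (x∙y-x≡y 1# (ι m))) ⟩
      ((1# + ι m) - 1#) - ι n       ≡⟨ +-assoc _ _ _ ⟩
      (1# + ι m) + (- 1# + - ι n)   ≡⟨ cong ((1# + ι m) +_) (-‿+-comm 1# (ι n)) ⟩
      (1# + ι m) - (1# + ι n)       ≡⟨ cong₂ _-_ (sym (1+× m 1#)) (sym (1+× n 1#)) ⟩
      ι (suc m) - ι (suc n)         ∎
      where
      open ≡-Reasoning
      x∙y-x≡y : ∀ x y → (x + y) - x ≡ y
      x∙y-x≡y x y = trans (cong (_- x) (+-comm x y)) (trans (+-assoc y x (- x))
        (trans (cong (y +_) (-‿inverseʳ x)) (+-identityʳ y)))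

    ιℤ-+ : ∀ i j → ιℤ (i ℤ.+ j) ≡ ιℤ i + ιℤ j
    ιℤ-+ (ℤ.+ m) (ℤ.+ n) = ι-+ m n
    ιℤ-+ (ℤ.+ m) ℤ.-[1+ n ] = ιℤ-⊖ m (suc n)
    ιℤ-+ ℤ.-[1+ m ] (ℤ.+ n) = trans (ιℤ-⊖ n (suc m)) (+-comm _ _)
    ιℤ-+ ℤ.-[1+ m ] ℤ.-[1+ n ] = trans
      (cong -_ (trans (cong ι (sym (ℕₚ.+-suc (suc m) n))) (ι-+ (suc m) (suc n))))
      (sym (-‿+-comm _ _))

    ιℤ-*ˡ : ∀ m j → ιℤ ((ℤ.+ m) ℤ.* j) ≡ ι m * ιℤ j
    ιℤ-*ˡ m (ℤ.+ n) = trans (cong ιℤ (sym (ℤₚ.pos-* m n))) (ι-* m n)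
    ιℤ-*ˡ m ℤ.-[1+ n ] = begin
      ιℤ ((ℤ.+ m) ℤ.* ℤ.-[1+ n ])     ≡⟨ cong ιℤ (sym (ℤₚ.neg-distribʳ-* (ℤ.+ m) (ℤ.+ suc n))) ⟩
      ιℤ (ℤ.- ((ℤ.+ m) ℤ.* (ℤ.+ suc n))) ≡⟨ ιℤ-neg ((ℤ.+ m) ℤ.* (ℤ.+ suc n)) ⟩
      - ιℤ ((ℤ.+ m) ℤ.* (ℤ.+ suc n))  ≡⟨ cong -_ (ιℤ-*ˡ m (ℤ.+ suc n)) ⟩
      - (ι m * ι (suc n))             ≡⟨ -‿distribʳ-* _ _ ⟩
      ι m * - ι (suc n)               ∎
      where open ≡-Reasoning

    ιℤ-* : ∀ i j → ιℤ (i ℤ.* j) ≡ ιℤ i * ιℤ j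
    ιℤ-* (ℤ.+ m) j = ιℤ-*ˡ m j
    ιℤ-* ℤ.-[1+ m ] j = begin
      ιℤ (ℤ.-[1+ m ] ℤ.* j)           ≡⟨ cong ιℤ (sym (ℤₚ.neg-distribˡ-* (ℤ.+ suc m) j)) ⟩
      ιℤ (ℤ.- ((ℤ.+ suc m) ℤ.* j))    ≡⟨ ιℤ-neg ((ℤ.+ suc m) ℤ.* j) ⟩
      - ιℤ ((ℤ.+ suc m) ℤ.* j)        ≡⟨ cong -_ (ιℤ-*ˡ (suc m) j) ⟩
      - (ι (suc m) * ιℤ j)            ≡⟨ -‿distribˡ-* _ _ ⟩
      - ι (suc m) * ιℤ j              ∎
      where open ≡-Reasoning

    -- Integers serve as coefficients because `R` is abstract: equality of two constants of `R` does
    -- not compute, whereas the solver can cancel integers.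
    integerCoefficients : ℤ.+-*-rawRing -Raw-AlmostCommutative⟶ fromCommutativeRing commutativeRing
    integerCoefficients = record
      { ⟦_⟧ = ιℤ ; +-homo = ιℤ-+ ; *-homo = ιℤ-* ; -‿homo = ιℤ-neg
      ; 0-homo = refl ; 1-homo = refl }

    ιℤ-≟ : ∀ i j → Maybe (ιℤ i ≡ ιℤ j)
    ιℤ-≟ i j = Maybe.map (cong ιℤ) (dec⇒weaklyDec ℤ._≟_ i j)

  open RingSolver ℤ.+-*-rawRing (fromCommutativeRing commutativeRing)
    integerCoefficients ιℤ-≟ public
    using (solve; _:=_; _:+_; _:*_; _:-_; :-_; con; Polynomial)

  κ : ∀ {n} → ℕ → Polynomial n
  κ m = con (ℤ.+ m)

  e[1-f]≡0⇒e≡ef : ∀ e f → e * (1# - f) ≡ 0# → e ≡ e * f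
  e[1-f]≡0⇒e≡ef e f eq = x-y≡0⇒x≡y e (e * f)
    (trans (solve 2 (λ e f → e :- e :* f := e :* (κ 1 :- f)) refl e f) eq)

-- Local rings

module _ {n} {P : Fin n → Set} (P? : Decidable P) where

  comprehension : Subset n
  comprehension = Vec.tabulate (λ x → does (P? x))

  ∈-comprehension⁺ : ∀ {x} → P x → x ∈ₛ comprehension
  ∈-comprehension⁺ {x} px = lookup⇒[]= x comprehension
    (trans (lookup∘tabulate _ x) (dec-true (P? x) px))

  ∈-comprehension⁻ : ∀ {x} → x ∈ₛ comprehension → P x
  ∈-comprehension⁻ {x} x∈ with P? x | trans (sym (lookup∘tabulate (λ x → does (P? x)) x)) ([]=⇒lookup x∈)
  ... | yes px | _ = px
  ... | no _   | ()

module Ideals (R : FiniteCommRing) where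
  open Arithmetic R

  isIdeal? : Decidable (IsIdeal R)
  isIdeal? I =
    (0# ∈ₛ? I) ×-dec
    (all? λ x → all? λ y → (x ∈ₛ? I) →-dec ((y ∈ₛ? I) →-dec ((x + y) ∈ₛ? I))) ×-dec
    (all? λ x → (x ∈ₛ? I) →-dec ((- x) ∈ₛ? I)) ×-dec
    (all? λ r → all? λ x → (x ∈ₛ? I) →-dec ((r * x) ∈ₛ? I))

  -- Finiteness replaces Zorn's lemma: all subsets are searched for a strictly larger proper ideal.
  -- Each enlargement adds an element, so the fuel `k` can run out only after a subset has outgrown
  -- the ring.
  maximal-above : ∀ k J → size ℕ.≤ k ℕ.+ ∣ J ∣ → IsIdeal R J → 1# ∉ₛ J → ∃ λ M → IsMaximalIdeal R M × J ⊆ M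
  maximal-above k J bound ideal 1∉J
    with anySubset? (λ K → isIdeal? K ×-dec ¬? (1# ∈ₛ? K) ×-dec (J ⊆? K) ×-dec any? (λ x → (x ∈ₛ? K) ×-dec ¬? (x ∈ₛ? J)))
  ... | no none = J , (ideal , 1∉J , maximal) , ⊆-refl
    where
    maximal : ∀ K → IsIdeal R K → J ⊆ K → K ≡ J ⊎ 1# ∈ₛ K
    maximal K idealK J⊆K with 1# ∈ₛ? K
    ... | yes 1∈K = inj₂ 1∈K
    ... | no 1∉K = inj₁ (⊆-antisym
      (λ {x} x∈K → decidable-stable (x ∈ₛ? J) (λ x∉J → none (K , idealK , 1∉K , J⊆K , x , x∈K , x∉J)))
      J⊆K)
  ... | yes (K , idealK , 1∉K , J⊆K , x , x∈K , x∉J) with k | p⊂q⇒∣p∣<∣q∣ (J⊆K , x , x∈K , x∉J)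
  ...   | zero | J<K = contradiction (ℕₚ.≤-trans J<K (∣p∣≤n K)) (ℕₚ.≤⇒≯ bound)
  ...   | suc k | J<K with maximal-above k K bound′ idealK 1∉K
    where
    bound′ : size ℕ.≤ k ℕ.+ ∣ K ∣
    bound′ = ℕₚ.≤-trans bound (ℕₚ.≤-trans (ℕₚ.≤-reflexive (sym (ℕₚ.+-suc k ∣ J ∣))) (ℕₚ.+-monoʳ-≤ k J<K))
  ...     | M , maxM , K⊆M = M , maxM , ⊆-trans J⊆K K⊆M

  multiple? : ∀ x y → Dec (∃ λ r → r * x ≡ y)
  multiple? x y = any? (λ r → r * x F.≟ y)

  principal : Carrier → Subset size
  principal x = comprehension (multiple? x)

  principal-isIdeal : ∀ x → IsIdeal R (principal x)
  principal-isIdeal x =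
      to (0# , zeroˡ x)
    , (λ y z y∈ z∈ → let (r , rx≡y) = from y∈ ; (s , sx≡z) = from z∈ in
         to (r + s , trans (distribʳ x r s) (cong₂ _+_ rx≡y sx≡z)))
    , (λ y y∈ → let (r , rx≡y) = from y∈ in
         to (- r , trans (solve 2 (λ r x → :- r :* x := :- (r :* x)) refl r x) (cong -_ rx≡y)))
    , (λ s y y∈ → let (r , rx≡y) = from y∈ in
         to (s * r , trans (*-assoc s r x) (cong (s *_) rx≡y)))
    where
    to : ∀ {y} → (∃ λ r → r * x ≡ y) → y ∈ₛ principal x
    to = ∈-comprehension⁺ (multiple? x)
    from : ∀ {y} → y ∈ₛ principal x → ∃ λ r → r * x ≡ y
    from = ∈-comprehension⁻ (multiple? x)

module LocalRing (R : FiniteCommRing) (local : IsLocal R) where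
  open Arithmetic R
  open Ideals R

  private
    M = proj₁ local
    M-ideal = proj₁ (proj₁ (proj₂ local))
    1∉M = proj₁ (proj₂ (proj₁ (proj₂ local)))
    M-unique = proj₂ (proj₂ local)

    unit⇒∉M : ∀ {x} → IsUnit R x → x ∉ₛ M
    unit⇒∉M {x} (y , xy≡1) x∈M = 1∉M (subst (_∈ₛ M) (trans (*-comm y x) xy≡1)
      (proj₂ (proj₂ (proj₂ M-ideal)) y x x∈M))

    -- The multiples of a non-unit form a proper ideal, which lies in some maximal ideal, and `M` is
    -- the only one.
    nonunit⇒∈M : ∀ {x} → ¬ IsUnit R x → x ∈ₛ M
    nonunit⇒∈M {x} ¬unit
      with maximal-above size (principal x) (ℕₚ.m≤m+n size _) (principal-isIdeal x)
             (λ 1∈ → let (r , rx≡1) = ∈-comprehension⁻ (multiple? x) 1∈ in ¬unit (r , trans (*-comm x r) rx≡1))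
    ... | N , maxN , x⊆N = subst (x ∈ₛ_) (M-unique N maxN)
      (x⊆N (∈-comprehension⁺ (multiple? x) (1# , *-identityˡ x)))

  NonUnit : Carrier → Set
  NonUnit x = ¬ IsUnit R x

  1-unit : IsUnit R 1#
  1-unit = 1# , *-identityˡ 1#

  abstract
    nonunit-+ : ∀ {x y} → NonUnit x → NonUnit y → NonUnit (x + y)
    nonunit-+ ¬x ¬y unit = unit⇒∉M unit (proj₁ (proj₂ M-ideal) _ _ (nonunit⇒∈M ¬x) (nonunit⇒∈M ¬y))

    nonunit-neg : ∀ {x} → NonUnit x → NonUnit (- x)
    nonunit-neg ¬x unit = unit⇒∉M unit (proj₁ (proj₂ (proj₂ M-ideal)) _ (nonunit⇒∈M ¬x))

    nonunit-* : ∀ r {x} → NonUnit x → NonUnit (r * x)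
    nonunit-* r ¬x unit = unit⇒∉M unit (proj₂ (proj₂ (proj₂ M-ideal)) r _ (nonunit⇒∈M ¬x))

  0-nonunit : NonUnit 0#
  0-nonunit unit = unit⇒∉M unit (proj₁ M-ideal)

  1≢0 : 1# ≢ 0#
  1≢0 1≡0 = 0-nonunit (subst (IsUnit R) 1≡0 1-unit)

  -- Since `e` and `1# - e` add up to `1#`, one of them is a unit. Cancelling it in `e * e ≡ e`,
  -- that is in `e * (1# - e) ≡ 0#`, leaves the two values.
  idempotent-trivial : ∀ e → e * e ≡ e → e ≡ 0# ⊎ e ≡ 1#
  idempotent-trivial e ee≡e with isUnit? R e | isUnit? R (1# - e)
  ... | yes (f , ef≡1) | _ = inj₂ (begin
    e             ≡⟨ sym (*-identityʳ e) ⟩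
    e * 1#        ≡⟨ cong (e *_) (sym ef≡1) ⟩
    e * (e * f)   ≡⟨ sym (*-assoc e e f) ⟩
    (e * e) * f   ≡⟨ cong (_* f) ee≡e ⟩
    e * f         ≡⟨ ef≡1 ⟩
    1#            ∎)
    where open ≡-Reasoning
  ... | no _ | yes (f , [1-e]f≡1) = inj₁ (begin
    e                     ≡⟨ sym (*-identityʳ e) ⟩
    e * 1#                ≡⟨ cong (e *_) (sym [1-e]f≡1) ⟩
    e * ((1# - e) * f)    ≡⟨ solve 2 (λ e f → e :* ((κ 1 :- e) :* f) := (e :- e :* e) :* f) refl e f ⟩
    (e - e * e) * f       ≡⟨ cong (λ x → (e - x) * f) ee≡e ⟩
    (e - e) * f           ≡⟨ solve 2 (λ e f → (e :- e) :* f := κ 0) refl e f ⟩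
    0#                    ∎)
    where open ≡-Reasoning
  ... | no ¬e | no ¬1-e = contradiction 1-unit
    (subst NonUnit (solve 1 (λ e → e :+ (κ 1 :- e) := κ 1) refl e) (nonunit-+ ¬e ¬1-e))

-- Idempotents of a product of local rings

-- The Boolean algebra of idempotents with its atoms `ε i`. The count of independent sets sees the
-- decomposition of `R` only through this interface.
record BooleanIdempotents (R : FiniteCommRing) (n : ℕ) : Set where
  open Arithmetic R
  field
    idempotents : List Carrier
    idempotents-unique : Unique idempotents
    idempotents-sound : ∀ {e} → e ∈ idempotents → e * e ≡ e
    idempotents-complete : ∀ {e} → e * e ≡ e → e ∈ idempotents
    idempotents-length : length idempotents ≡ 2 ^ n
    ε : Fin n → Carrier
    ε-idempotent : ∀ i → ε i * ε i ≡ ε i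
    ε-orthogonal : ∀ {i j} → i ≢ j → ε i * ε j ≡ 0#
    ε≢0 : ∀ i → ε i ≢ 0#
    ε-below : ∀ {e} → e * e ≡ e → e ≢ 0# → ∃ λ i → e * ε i ≡ ε i
    ε-primitive : ∀ {e} → e * e ≡ e → ∀ i → e * ε i ≡ 0# ⊎ e * ε i ≡ ε i

funToFin-cong : ∀ {m n} {f g : Fin m → Fin n} → f ≗ g → funToFin f ≡ funToFin g
funToFin-cong {zero} f≗g = refl
funToFin-cong {suc m} f≗g = cong₂ F.combine (f≗g F.zero) (funToFin-cong (f≗g ∘ F.suc))

finToFun-injective : ∀ {m n} {k l : Fin (m ^ n)} → finToFun {m} {n} k ≗ finToFun l → k ≡ l
finToFun-injective {m} {n} {k} {l} k≗l =
  trans (sym (funToFin-finToFin {n} {m} k)) (trans (funToFin-cong k≗l) (funToFin-finToFin {n} {m} l))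

module Decomposition {R : FiniteCommRing} {n : ℕ} {Rs : Fin n → FiniteCommRing}
  (locals : ∀ i → IsLocal (Rs i)) (iso : IsoToProduct R n Rs) where
  open Arithmetic R
  open IsoToProduct iso
  private
    module A (i : Fin n) = Arithmetic (Rs i)
    module L (i : Fin n) = LocalRing (Rs i) (locals i)

  φ-0 : ∀ i → φ 0# i ≡ A.0# i
  φ-0 i = A.+-cancelˡ i (φ 0# i) _ _ (begin
    A._+_ i (φ 0# i) (φ 0# i)   ≡⟨ sym (φ-+ 0# 0# i) ⟩
    φ (0# + 0#) i               ≡⟨ cong (λ x → φ x i) (+-identityˡ 0#) ⟩
    φ 0# i                      ≡⟨ sym (A.+-identityʳ i _) ⟩
    A._+_ i (φ 0# i) (A.0# i)   ∎)
    where open ≡-Reasoning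

  lift : (∀ i → FiniteCommRing.Carrier (Rs i)) → Carrier
  lift g = proj₁ (surjective g)

  φ-lift : ∀ g i → φ (lift g) i ≡ g i
  φ-lift g = proj₂ (surjective g)

  bit : ∀ i → Fin 2 → FiniteCommRing.Carrier (Rs i)
  bit i F.zero = A.0# i
  bit i (F.suc _) = A.1# i

  bit-* : ∀ i b → A._*_ i (bit i b) (bit i b) ≡ bit i b
  bit-* i F.zero = A.zeroˡ i _
  bit-* i (F.suc _) = A.*-identityˡ i _

  bit-injective : ∀ i {b c} → bit i b ≡ bit i c → b ≡ c
  bit-injective i {F.zero} {F.zero} _ = refl
  bit-injective i {F.zero} {F.suc F.zero} eq = contradiction (sym eq) (L.1≢0 i)
  bit-injective i {F.suc F.zero} {F.zero} eq = contradiction eq (L.1≢0 i)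
  bit-injective i {F.suc F.zero} {F.suc F.zero} _ = refl

  indicator : (Fin n → Fin 2) → Carrier
  indicator f = lift (λ i → bit i (f i))

  φ-indicator : ∀ f i → φ (indicator f) i ≡ bit i (f i)
  φ-indicator f = φ-lift (λ i → bit i (f i))

  indicator-idempotent : ∀ f → indicator f * indicator f ≡ indicator f
  indicator-idempotent f = injective _ _ λ i → begin
    φ (indicator f * indicator f) i                   ≡⟨ φ-* _ _ i ⟩
    A._*_ i (φ (indicator f) i) (φ (indicator f) i)   ≡⟨ cong₂ (A._*_ i) (φ-indicator f i) (φ-indicator f i) ⟩
    A._*_ i (bit i (f i)) (bit i (f i))               ≡⟨ bit-* i (f i) ⟩
    bit i (f i)                                       ≡⟨ sym (φ-indicator f i) ⟩
    φ (indicator f) i                                 ∎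
    where open ≡-Reasoning

  indicator-injective : ∀ {f g} → indicator f ≡ indicator g → f ≗ g
  indicator-injective {f} {g} eq i = bit-injective i
    (trans (sym (φ-indicator f i)) (trans (cong (λ x → φ x i) eq) (φ-indicator g i)))

  coordinate : ∀ {e} → e * e ≡ e → ∀ i → ∃ λ b → φ e i ≡ bit i b
  coordinate {e} ee≡e i
    with L.idempotent-trivial i (φ e i) (trans (sym (φ-* e e i)) (cong (λ x → φ x i) ee≡e))
  ... | inj₁ ≡0 = F.zero , ≡0
  ... | inj₂ ≡1 = F.suc F.zero , ≡1

  -- Subsets of the factors are enumerated by their codes in `Fin (2 ^ n)`, which gives the length
  -- at once and reduces duplicate-freeness to injectivity.
  idempotents : List Carrier
  idempotents = map (λ k → indicator (finToFun k)) (allFin (2 ^ n))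

  idempotents-complete : ∀ {e} → e * e ≡ e → e ∈ idempotents
  idempotents-complete {e} ee≡e =
    subst (_∈ idempotents) (injective _ _ eq) (∈-map⁺ _ (∈-allFin (funToFin f)))
    where
    f : Fin n → Fin 2
    f i = proj₁ (coordinate ee≡e i)
    eq : ∀ i → φ (indicator (finToFun (funToFin f))) i ≡ φ e i
    eq i = trans (φ-indicator (finToFun (funToFin f)) i) (trans (cong (bit i) (finToFun-funToFin f i))
      (sym (proj₂ (coordinate ee≡e i))))

  idempotents-sound : ∀ {e} → e ∈ idempotents → e * e ≡ e
  idempotents-sound e∈ with ∈-map⁻ _ e∈
  ... | k , _ , refl = indicator-idempotent (finToFun k)

  δ : Fin n → Fin n → Fin 2
  δ i j with i F.≟ j
  ... | yes _ = F.suc F.zero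
  ... | no _  = F.zero

  δ-refl : ∀ i → δ i i ≡ F.suc F.zero
  δ-refl i with i F.≟ i
  ... | yes _  = refl
  ... | no i≢i = contradiction refl i≢i

  ε : Fin n → Carrier
  ε i = indicator (δ i)

  φ-ε : ∀ i → φ (ε i) i ≡ A.1# i
  φ-ε i = trans (φ-indicator (δ i) i) (cong (bit i) (δ-refl i))

  ε≢0 : ∀ i → ε i ≢ 0#
  ε≢0 i ε≡0 = L.1≢0 i (trans (sym (φ-ε i)) (trans (cong (λ x → φ x i) ε≡0) (φ-0 i)))

  ε-orthogonal : ∀ {i j} → i ≢ j → ε i * ε j ≡ 0#
  ε-orthogonal {i} {j} i≢j = injective _ _ λ k → begin
    φ (ε i * ε j) k                         ≡⟨ φ-* _ _ k ⟩
    A._*_ k (φ (ε i) k) (φ (ε j) k)         ≡⟨ cong₂ (A._*_ k) (φ-indicator (δ i) k) (φ-indicator (δ j) k) ⟩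
    A._*_ k (bit k (δ i k)) (bit k (δ j k)) ≡⟨ disjoint k ⟩
    A.0# k                                  ≡⟨ sym (φ-0 k) ⟩
    φ 0# k                                  ∎
    where
    open ≡-Reasoning
    disjoint : ∀ k → A._*_ k (bit k (δ i k)) (bit k (δ j k)) ≡ A.0# k
    disjoint k with i F.≟ k | j F.≟ k
    ... | yes refl | yes refl = contradiction refl i≢j
    ... | no _     | _        = A.zeroˡ k _
    ... | yes _    | no _     = A.zeroʳ k _

  -- Multiplication by `ε i` erases every coordinate except the one at `i`.
  *-ε : ∀ {x y} i → φ x i ≡ φ y i → x * ε i ≡ y * ε i
  *-ε {x} {y} i eq = injective _ _ λ k → begin
    φ (x * ε i) k               ≡⟨ φ-* _ _ k ⟩
    A._*_ k (φ x k) (φ (ε i) k) ≡⟨ agree k ⟩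
    A._*_ k (φ y k) (φ (ε i) k) ≡⟨ sym (φ-* _ _ k) ⟩
    φ (y * ε i) k               ∎
    where
    open ≡-Reasoning
    agree : ∀ k → A._*_ k (φ x k) (φ (ε i) k) ≡ A._*_ k (φ y k) (φ (ε i) k)
    agree k rewrite φ-indicator (δ i) k with i F.≟ k
    ... | yes refl = cong (λ z → A._*_ k z (A.1# k)) eq
    ... | no _     = trans (A.zeroʳ k _) (sym (A.zeroʳ k _))

  ε-primitive : ∀ {e} → e * e ≡ e → ∀ i → e * ε i ≡ 0# ⊎ e * ε i ≡ ε i
  ε-primitive ee≡e i with coordinate ee≡e i
  ... | F.zero , eq  = inj₁ (trans (*-ε i (trans eq (sym (φ-0 i)))) (zeroˡ _))
  ... | F.suc _ , eq = inj₂ (trans (*-ε i (trans eq (sym (φ-1 i)))) (*-identityˡ _))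

  ε-below : ∀ {e} → e * e ≡ e → e ≢ 0# → ∃ λ i → e * ε i ≡ ε i
  ε-below {e} ee≡e e≢0 with any? (λ i → (e * ε i) F.≟ ε i)
  ... | yes found = found
  ... | no none = contradiction (injective _ _ λ i → trans (vanish i) (sym (φ-0 i))) e≢0
    where
    vanish : ∀ i → φ e i ≡ A.0# i
    vanish i with coordinate ee≡e i
    ... | F.zero , eq  = eq
    ... | F.suc _ , eq = contradiction
      (i , trans (*-ε i (trans eq (sym (φ-1 i)))) (*-identityˡ _)) none

  booleanIdempotents : BooleanIdempotents R n
  booleanIdempotents = record
    { idempotents = idempotents
    ; idempotents-unique = Uniq.map⁺ (λ eq → finToFun-injective {2} {n} (indicator-injective eq)) (Uniq.allFin⁺ (2 ^ n))
    ; idempotents-sound = idempotents-sound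
    ; idempotents-complete = idempotents-complete
    ; idempotents-length = trans (length-map _ (allFin (2 ^ n))) (length-tabulate {n = 2 ^ n} id)
    ; ε = ε
    ; ε-idempotent = λ i → indicator-idempotent (δ i)
    ; ε-orthogonal = ε-orthogonal
    ; ε≢0 = ε≢0
    ; ε-below = ε-below
    ; ε-primitive = ε-primitive
    }

-- Counting with duplicate-free lists

module _ {A B : Set} (f : A → B) where

  -- Pigeonhole by removal: `f x` is cut out of `ys`, and injectivity keeps the other images in what
  -- remains. Injectivity is asked on members of `xs` only, because the codes used later are
  -- injective only on an independent set.
  length-≤ : ∀ {xs ys} → Unique xs → (∀ {x} → x ∈ xs → f x ∈ ys) →
             (∀ {x y} → x ∈ xs → y ∈ xs → f x ≡ f y → x ≡ y) → length xs ≤ length ys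
  length-≤ [] _ _ = z≤n
  length-≤ {x ∷ xs} (x≢ ∷ unique) into injective with ∈-∃++ (into (here refl))
  ... | as , bs , refl = ℕₚ.≤-trans
    (s≤s (length-≤ unique into′ (λ x∈ y∈ → injective (there x∈) (there y∈))))
    (ℕₚ.≤-reflexive (trans (cong suc (length-++ as)) (trans (sym (ℕₚ.+-suc (length as) (length bs))) (sym (length-++ as)))))
    where
    into′ : ∀ {y} → y ∈ xs → f y ∈ as ++ bs
    into′ {y} y∈ with ∈-++⁻ as (into (there y∈))
    ... | inj₁ ∈as = ∈-++⁺ˡ ∈as
    ... | inj₂ (there ∈bs) = ∈-++⁺ʳ as ∈bs
    ... | inj₂ (here fy≡fx) =
      contradiction (injective (here refl) (there y∈) (sym fy≡fx)) (All.lookup x≢ y∈)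

module _ {A : Set} where

  length-⊆ : {xs ys : List A} → Unique xs → (∀ {x} → x ∈ xs → x ∈ ys) → length xs ≤ length ys
  length-⊆ unique into = length-≤ id unique into (λ _ _ → id)

  length-≡ : {xs ys : List A} → Unique xs → Unique ys →
             (∀ {x} → x ∈ xs → x ∈ ys) → (∀ {x} → x ∈ ys → x ∈ xs) → length xs ≡ length ys
  length-≡ uxs uys to from = ℕₚ.≤-antisym (length-⊆ uxs to) (length-⊆ uys from)

module Complement {A : Set} (_≟_ : DecidableEquality A) where
  open DecMembership _≟_ using (_∈?_)

  infixl 6 _∖_
  _∖_ : List A → List A → List A
  xs ∖ ys = filter (λ x → ¬? (x ∈? ys)) xs

  ∈-∖⁺ : ∀ {x} xs ys → x ∈ xs → x ∉ ys → x ∈ xs ∖ ys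
  ∈-∖⁺ xs ys = ∈-filter⁺ (λ x → ¬? (x ∈? ys))

  ∈-∖⁻ : ∀ {x} xs ys → x ∈ xs ∖ ys → x ∈ xs × x ∉ ys
  ∈-∖⁻ xs ys = ∈-filter⁻ (λ x → ¬? (x ∈? ys)) {xs = xs}

  ∖-unique : ∀ {xs} ys → Unique xs → Unique (xs ∖ ys)
  ∖-unique ys = Uniq.filter⁺ (λ x → ¬? (x ∈? ys))

  length-∖ : ∀ {xs ys} → Unique xs → Unique ys → (∀ {x} → x ∈ ys → x ∈ xs) →
             length ys ℕ.+ length (xs ∖ ys) ≡ length xs
  length-∖ {xs} {ys} uxs uys ys⊆xs = trans (sym (length-++ ys)) (length-≡
    (Uniq.++⁺ uys (∖-unique ys uxs) (λ (∈ys , ∈∖) → proj₂ (∈-∖⁻ xs ys ∈∖) ∈ys))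
    uxs to from)
    where
    to : ∀ {x} → x ∈ ys ++ (xs ∖ ys) → x ∈ xs
    to x∈ with ∈-++⁻ ys x∈
    ... | inj₁ x∈ys = ys⊆xs x∈ys
    ... | inj₂ x∈∖  = proj₁ (∈-∖⁻ xs ys x∈∖)
    from : ∀ {x} → x ∈ xs → x ∈ ys ++ (xs ∖ ys)
    from {x} x∈xs with x ∈? ys
    ... | yes x∈ys = ∈-++⁺ˡ x∈ys
    ... | no x∉ys  = ∈-++⁺ʳ ys (∈-∖⁺ xs ys x∈xs x∉ys)

-- Walks and the strong resolving graph

module Walks (R : FiniteCommRing) where
  open Arithmetic R

  -- An inductive counterpart of `IsWalk` that supports recursion and concatenation; `path` and
  -- `fromIsWalk` translate between the two.
  data Walk : Pair R → Pair R → ℕ → Set where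
    stay : ∀ {x} → IsVertex₂ R x → Walk x x 0
    step : ∀ {x y z k} → IsVertex₂ R x → Adj R x y → Walk y z k → Walk x z (suc k)

  Adj-sym : ∀ {x y} → Adj R x y → Adj R y x
  Adj-sym (x≢y , inj₁ ef≡0) = ≢-sym x≢y , inj₁ (trans (*-comm _ _) ef≡0)
  Adj-sym (x≢y , inj₂ uv≡1) = ≢-sym x≢y , inj₂ (trans (*-comm _ _) uv≡1)

  infixr 5 _⊕_
  _⊕_ : ∀ {x y z k l} → Walk x y k → Walk y z l → Walk x z (k ℕ.+ l)
  stay _ ⊕ q = q
  step v a p ⊕ q = step v a (p ⊕ q)

  edge : ∀ {x y} → IsVertex₂ R x → IsVertex₂ R y → Adj R x y → Walk x y 1
  edge vx vy a = step vx a (stay vy)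

  source : ∀ {x y k} → Walk x y k → IsVertex₂ R x
  source (stay v) = v
  source (step v _ _) = v

  reverse : ∀ {x y k} → Walk x y k → Walk y x k
  reverse (stay v) = stay v
  reverse (step {k = k} v a p) =
    subst (Walk _ _) (ℕₚ.+-comm k 1) (reverse p ⊕ edge (source p) v (Adj-sym a))

  path : ∀ {x y k} → Walk x y k → Fin (suc k) → Pair R
  path {x} (stay _) _ = x
  path {x} (step _ _ _) F.zero = x
  path (step _ _ p) (F.suc i) = path p i

  path-source : ∀ {x y k} (p : Walk x y k) → path p F.zero ≡ x
  path-source (stay _) = refl
  path-source (step _ _ _) = refl

  path-isWalk : ∀ {x y k} (p : Walk x y k) → IsWalk R x y k (path p)
  path-isWalk (stay v) = refl , refl , (λ _ → v) , λ ()
  path-isWalk (step v a p) with path-isWalk p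
  ... | start , end , vertices , adjacent = refl , end
    , (λ { F.zero → v ; (F.suc i) → vertices i })
    , (λ { F.zero → subst (Adj R _) (sym start) a ; (F.suc i) → adjacent i })

  path-⊕ : ∀ {x y z k l} (p : Walk x y k) (q : Walk y z l) → OnPath R y (path (p ⊕ q))
  path-⊕ (stay _) q = F.zero , path-source q
  path-⊕ (step _ _ p) q with path-⊕ p q
  ... | i , eq = F.suc i , eq

  fromIsWalk : ∀ {x y} k {p} → IsWalk R x y k p → Walk x y k
  fromIsWalk zero (refl , refl , v , _) = stay (v F.zero)
  fromIsWalk (suc k) (refl , end , v , a) =
    step (v F.zero) (a F.zero) (fromIsWalk k (refl , end , v ∘ F.suc , a ∘ F.suc))

  splitAt : ∀ {x y} k {p} → IsWalk R x y k p → (i : Fin (suc k)) →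
            ∃ λ a → ∃ λ b → a ℕ.+ b ≡ k × Walk x (p i) a × Walk (p i) y b
  splitAt k w@(refl , _ , v , _) F.zero = 0 , k , refl , stay (v F.zero) , fromIsWalk k w
  splitAt (suc k) (refl , end , v , a) (F.suc i) with splitAt k (refl , end , v ∘ F.suc , a ∘ F.suc) i
  ... | m , n , eq , p , q = suc m , n , cong suc eq , step (v F.zero) (a F.zero) p , q

  -- The vertex `y` lies on a geodesic from `x` to `z`. Keeping the two halves as separate walks
  -- makes it easy to cut and prolong them.
  Between : Pair R → Pair R → Pair R → Set
  Between x y z = ∃ λ a → ∃ λ b → Walk x y a × Walk y z b × (∀ k → Walk x z k → a ℕ.+ b ≤ k)

  Between⇒shortest : ∀ {x y z} → Between x y z → ∃ λ k → ∃ λ p → IsShortestPath R x z k p × OnPath R y p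
  Between⇒shortest (a , b , p , q , shortest) =
    a ℕ.+ b , path (p ⊕ q) , (path-isWalk (p ⊕ q) , λ k _ w → shortest k (fromIsWalk k w)) , path-⊕ p q

  shortest⇒Between : ∀ {x y z} → (∃ λ k → ∃ λ p → IsShortestPath R x z k p × OnPath R y p) → Between x y z
  shortest⇒Between (k , p , (walk , shortest) , i , refl) with splitAt k walk i
  ... | a , b , refl , q , r = a , b , q , r , λ k′ w → shortest k′ (path w) (path-isWalk w)

  -- The number `m` separates the distances: it is at most that of `y` from `x` and at least that of
  -- any neighbour of `y` from `x`.
  MaximallyDistant : Pair R → Pair R → Set
  MaximallyDistant x y = ∃ λ m → (∀ a → Walk x y a → m ≤ a)
    × (∀ z → IsVertex₂ R z → Adj R y z → ∃ λ k → k ≤ m × Walk x z k)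

  -- If the geodesic took one more step after `y`, that neighbour could be reached from `x` in at
  -- most `m ≤ a` steps, which would shorten the whole walk by one.
  maximallyDistant-end : ∀ {x y z} → MaximallyDistant x y → Between x y z → z ≡ y
  maximallyDistant-end _ (_ , _ , _ , stay _ , _) = refl
  maximallyDistant-end (m , far , near) (a , suc b , p , step _ adj q , shortest)
    with near _ (source q) adj
  ... | k , k≤m , r = contradiction
    (ℕₚ.≤-trans (ℕₚ.≤-reflexive (sym (ℕₚ.+-suc a b))) (ℕₚ.≤-trans (shortest _ (r ⊕ q)) (ℕₚ.+-monoˡ-≤ b (ℕₚ.≤-trans k≤m (far a p)))))
    (ℕₚ.<-irrefl refl)

-- Mutually maximally distant pairs and vertex covers

module StrongResolvingGraph (R : FiniteCommRing)
  (e₀ : FiniteCommRing.Carrier R) (e₀-idempotent : IsIdempotent R e₀)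
  (e₀≢0 : e₀ ≢ FiniteCommRing.0# R) (e₀≢1 : e₀ ≢ FiniteCommRing.1# R)
  (U″ : U''NonEmpty R) where
  open Arithmetic R
  open Walks R

  1≢0 : 1# ≢ 0#
  1≢0 1≡0 = e₀≢1 (trans (trivial e₀) (sym (trivial 1#)))
    where
    trivial : ∀ x → x ≡ 0#
    trivial x = trans (sym (*-identityʳ x)) (trans (cong (x *_) 1≡0) (zeroʳ x))

  inverse-unique : ∀ {u v w} → u * v ≡ 1# → u * w ≡ 1# → v ≡ w
  inverse-unique {u} {v} {w} uv≡1 uw≡1 = begin
    v             ≡⟨ sym (*-identityʳ v) ⟩
    v * 1#        ≡⟨ cong (v *_) (sym uw≡1) ⟩
    v * (u * w)   ≡⟨ solve 3 (λ u v w → v :* (u :* w) := (u :* v) :* w) refl u v w ⟩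
    (u * v) * w   ≡⟨ cong (_* w) uv≡1 ⟩
    1# * w        ≡⟨ *-identityˡ w ⟩
    w             ∎
    where open ≡-Reasoning

  comm₁ : ∀ {u v} → u * v ≡ 1# → v * u ≡ 1#
  comm₁ uv≡1 = trans (*-comm _ _) uv≡1

  inverse-unit : ∀ {u v} → u * v ≡ 1# → IsUnit R v
  inverse-unit uv≡1 = _ , comm₁ uv≡1

  1-unit : IsUnit R 1#
  1-unit = 1# , *-identityˡ 1#

  1-idempotent : IsIdempotent R 1#
  1-idempotent = *-identityˡ 1#

  complement-idempotent : ∀ {e} → e * e ≡ e → IsIdempotent R (1# - e)
  complement-idempotent {e} ee≡e = trans
    (solve 1 (λ e → (κ 1 :- e) :* (κ 1 :- e) := κ 1 :- e :- (e :- e :* e)) refl e)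
    (trans (cong (λ x → 1# - e - (e - x)) ee≡e)
      (solve 1 (λ e → κ 1 :- e :- (e :- e) := κ 1 :- e) refl e))

  complement-orthogonal : ∀ {e} → e * e ≡ e → e * (1# - e) ≡ 0#
  complement-orthogonal {e} ee≡e = trans
    (solve 1 (λ e → e :* (κ 1 :- e) := e :- e :* e) refl e)
    (trans (cong (λ x → e - x) ee≡e) (-‿inverseʳ e))

  complement≢0 : ∀ {e} → e ≢ 1# → 1# - e ≢ 0#
  complement≢0 {e} e≢1 1-e≡0 = e≢1 (sym (x-y≡0⇒x≡y 1# e 1-e≡0))

  complement≢1 : ∀ {e} → e ≢ 0# → 1# - e ≢ 1#
  complement≢1 {e} e≢0 1-e≡1 = e≢0 (begin
    e              ≡⟨ solve 1 (λ e → e := κ 1 :- (κ 1 :- e)) refl e ⟩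
    1# - (1# - e)  ≡⟨ cong (λ x → 1# - x) 1-e≡1 ⟩
    1# - 1#        ≡⟨ -‿inverseʳ 1# ⟩
    0#             ∎)
    where open ≡-Reasoning

  orthogonal-idempotent≢ : ∀ {e f} → e * e ≡ e → e ≢ 0# → e * f ≡ 0# → e ≢ f
  orthogonal-idempotent≢ ee≡e e≢0 ef≡0 refl = e≢0 (trans (sym ee≡e) ef≡0)

  V : Pair R → Set
  V = IsVertex₂ R

  1-vertex : ∀ {u} → IsUnit R u → V (1# , u)
  1-vertex unit = 1-idempotent , 1≢0 , unit

  complement-vertex : ∀ {e u} → e * e ≡ e → e ≢ 1# → IsUnit R u → V (1# - e , u)
  complement-vertex ee≡e e≢1 unit = complement-idempotent ee≡e , complement≢0 e≢1 , unit

  complement-adjacent : ∀ {e u v} → e * e ≡ e → e ≢ 0# → Adj R (e , u) (1# - e , v)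
  complement-adjacent ee≡e e≢0 =
      (λ eq → orthogonal-idempotent≢ ee≡e e≢0 (complement-orthogonal ee≡e) (cong proj₁ eq))
    , inj₁ (complement-orthogonal ee≡e)

  inverse-adjacent : ∀ {e f u v} → e ≢ f → u * v ≡ 1# → Adj R (e , u) (f , v)
  inverse-adjacent e≢f uv≡1 = (λ eq → e≢f (cong proj₁ eq)) , inj₂ uv≡1

  ≢-left : ∀ {e f u v : Carrier} → e ≢ f → _≢_ {A = Pair R} (e , u) (f , v)
  ≢-left e≢f eq = e≢f (cong proj₁ eq)

  ≢-right : ∀ {e f u v : Carrier} → u ≢ v → _≢_ {A = Pair R} (e , u) (f , v)
  ≢-right u≢v eq = u≢v (cong proj₂ eq)

  Within : ℕ → Pair R → Pair R → Set
  Within m x y = ∃ λ k → k ≤ m × Walk x y k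

  within-sym : ∀ {m x y} → Within m x y → Within m y x
  within-sym (k , k≤m , p) = k , k≤m , reverse p

  -- The intermediate vertex is `(1# - e , v⁻¹)`: its idempotent is orthogonal to `e` and its unit
  -- is inverse to `v`. It differs from `(f , v)` because `1# - e ≡ f` would give `e * f ≡ 0#`. For
  -- `e ≡ f` orthogonality serves on both sides.
  within-2 : ∀ {x y} → V x → V y → proj₁ x ≢ 1# → Within 2 x y
  within-2 {e , u} {f , v} vx@(ee≡e , e≢0 , _) vy@(_ , _ , v′ , vv′≡1) e≢1
    with e F.≟ f | u F.≟ v | (e * f) F.≟ 0#
  ... | yes refl | yes refl | _ = 0 , z≤n , stay vx
  ... | no e≢f   | _        | yes ef≡0 = 1 , s≤s z≤n , edge vx vy (≢-left e≢f , inj₁ ef≡0)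
  ... | yes _    | no u≢v   | yes ef≡0 = 1 , s≤s z≤n , edge vx vy (≢-right u≢v , inj₁ ef≡0)
  ... | yes refl | no _     | no ef≢0 = 2 , s≤s (s≤s z≤n) , step vx (complement-adjacent ee≡e e≢0)
      (edge (complement-vertex ee≡e e≢1 (inverse-unit vv′≡1)) vy (Adj-sym (complement-adjacent ee≡e e≢0)))
  ... | no e≢f   | _        | no ef≢0 = 2 , s≤s (s≤s z≤n) , step vx (complement-adjacent ee≡e e≢0)
      (edge (complement-vertex ee≡e e≢1 (inverse-unit vv′≡1)) vy (inverse-adjacent 1-e≢f (comm₁ vv′≡1)))
    where
    1-e≢f : 1# - e ≢ f
    1-e≢f refl = ef≢0 (complement-orthogonal ee≡e)

  -- A vertex over `1#` first steps down to `(e₀ , u⁻¹)`, from which two steps suffice.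
  within-3 : ∀ {x y} → V x → V y → Within 3 x y
  within-3 {e , u} {y} vx@(_ , _ , u′ , uu′≡1) vy with e F.≟ 1#
  ... | no e≢1 = map₂ (λ (k≤2 , p) → ℕₚ.m≤n⇒m≤1+n k≤2 , p) (within-2 vx vy e≢1)
  ... | yes refl with within-2 {e₀ , u′} (e₀-idempotent , e₀≢0 , inverse-unit uu′≡1) vy e₀≢1
  ...   | k , k≤2 , p = suc k , s≤s k≤2 , step vx (inverse-adjacent (≢-sym e₀≢1) uu′≡1) p

  far-2 : ∀ {e f u v} → (e , u) ≢ (f , v) → e * f ≢ 0# → u * v ≢ 1# →
          ∀ k → Walk (e , u) (f , v) k → 2 ≤ k
  far-2 x≢y _ _ .0 (stay _) = contradiction refl x≢y
  far-2 _ ef≢0 _ .1 (step _ (_ , inj₁ ef≡0) (stay _)) = contradiction ef≡0 ef≢0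
  far-2 _ _ uv≢1 .1 (step _ (_ , inj₂ uv≡1) (stay _)) = contradiction uv≡1 uv≢1
  far-2 _ _ _ _ (step _ _ (step _ _ _)) = s≤s (s≤s z≤n)

  1*≢0 : ∀ {f} → f ≢ 0# → 1# * f ≢ 0#
  1*≢0 f≢0 1f≡0 = f≢0 (trans (sym (*-identityˡ _)) 1f≡0)

  1-neighbour : ∀ {u f v} → f ≢ 0# → Adj R (1# , u) (f , v) → u * v ≡ 1#
  1-neighbour f≢0 (_ , inj₁ 1f≡0) = contradiction 1f≡0 (1*≢0 f≢0)
  1-neighbour _ (_ , inj₂ uv≡1) = uv≡1

  -- No nonzero idempotent is orthogonal to `1#`, so all neighbours of `(1# , u)` carry the unit
  -- u⁻¹. A common neighbour of both ends would force `u ≡ v`.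
  far-3 : ∀ {u v} → u ≢ v → u * v ≢ 1# → ∀ k → Walk (1# , u) (1# , v) k → 3 ≤ k
  far-3 u≢v uv≢1 .0 (stay _) = contradiction refl u≢v
  far-3 u≢v uv≢1 .1 (step _ a (stay _)) = contradiction (1-neighbour 1≢0 a) uv≢1
  far-3 u≢v uv≢1 .2 (step _ a (step (_ , g≢0 , _) b (stay _))) =
    contradiction (inverse-unique (comm₁ (1-neighbour g≢0 a)) (comm₁ (1-neighbour g≢0 (Adj-sym b)))) u≢v
  far-3 u≢v uv≢1 _ (step _ _ (step _ _ (step _ _ _))) = s≤s (s≤s (s≤s z≤n))

  data Edge : Pair R → Pair R → Set where
    top-top : ∀ {u v} → u ≢ v → u * v ≢ 1# → Edge (1# , u) (1# , v)
    top-low : ∀ {f u} → f ≢ 1# → u * u ≢ 1# → Edge (1# , u) (f , u)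
    low-low : ∀ {e f u v} → e ≢ 1# → f ≢ 1# → (e , u) ≢ (f , v) →
              e * f ≢ 0# → u * v ≢ 1# → Edge (e , u) (f , v)
    flip    : ∀ {x y} → Edge x y → Edge y x

  -- The values of `m` are 3, 2, 2. Only `top-low` seen from `(1# , u)` is delicate, since vertices
  -- over `1#` can be 3 apart: a neighbour `(1# , w)` of `(f , u)` must have `u * w ≡ 1#`, and is
  -- therefore adjacent to `(1# , u)`. Here it matters that both ends carry the same unit, with u² ≠
  -- 1.
  edge-maximallyDistant : ∀ {x y} → V x → V y → Edge x y → MaximallyDistant x y × MaximallyDistant y x
  edge-maximallyDistant vx vy (top-top u≢v uv≢1) =
      (3 , far-3 u≢v uv≢1 , λ z vz _ → within-3 vx vz)
    , (3 , far-3 (≢-sym u≢v) (λ vu≡1 → uv≢1 (comm₁ vu≡1)) , λ z vz _ → within-3 vy vz)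
  edge-maximallyDistant {_ , u} vx vy@(_ , f≢0 , _) (top-low {f} f≢1 uu≢1) =
      (2 , far-2 (≢-left (≢-sym f≢1)) (1*≢0 f≢0) uu≢1 , near)
    , (2 , far-2 (≢-left f≢1) (λ f1≡0 → f≢0 (trans (sym (*-identityʳ _)) f1≡0)) uu≢1 , λ z vz _ → within-2 vy vz f≢1)
    where
    near : ∀ z → V z → Adj R (f , u) z → Within 2 (1# , u) z
    near (g , w) vz adj with g F.≟ 1#
    ... | no g≢1 = within-sym (within-2 vz vx g≢1)
    ... | yes refl = 1 , s≤s z≤n , edge vx vz (≢-right u≢w , inj₂ uw≡1)
      where
      uw≡1 : u * w ≡ 1#
      uw≡1 = comm₁ (1-neighbour f≢0 (Adj-sym adj))
      u≢w : u ≢ w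
      u≢w refl = uu≢1 uw≡1
  edge-maximallyDistant vx vy (low-low e≢1 f≢1 x≢y ef≢0 uv≢1) =
      (2 , far-2 x≢y ef≢0 uv≢1 , λ z vz _ → within-2 vx vz e≢1)
    , (2 , far-2 (≢-sym x≢y) (λ fe≡0 → ef≢0 (trans (*-comm _ _) fe≡0)) (λ vu≡1 → uv≢1 (comm₁ vu≡1)) , λ z vz _ → within-2 vy vz f≢1)
  edge-maximallyDistant vx vy (flip e) with edge-maximallyDistant vy vx e
  ... | p , q = q , p

  edge-resolved-by-end : ∀ {w x y} → V x → V y → Edge x y → StronglyResolves R w x y → w ≡ x ⊎ w ≡ y
  edge-resolved-by-end vx vy e (inj₁ r) =
    inj₂ (maximallyDistant-end (proj₁ (edge-maximallyDistant vx vy e)) (shortest⇒Between r))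
  edge-resolved-by-end vx vy e (inj₂ r) =
    inj₁ (maximallyDistant-end (proj₂ (edge-maximallyDistant vx vy e)) (shortest⇒Between r))

  Covers : List (Pair R) → Set
  Covers S = ∀ {x y} → V x → V y → Edge x y → x ∈ S ⊎ y ∈ S

  Edge-irreflexive : ∀ {x y} → Edge x y → x ≢ y
  Edge-irreflexive (top-top u≢v _) = ≢-right u≢v
  Edge-irreflexive (top-low f≢1 _) = ≢-left (≢-sym f≢1)
  Edge-irreflexive (low-low _ _ x≢y _ _) = x≢y
  Edge-irreflexive (flip e) = ≢-sym (Edge-irreflexive e)

  resolving⇒covers : ∀ {S} → IsStrongResolvingSet R S → Covers S
  resolving⇒covers (_ , resolves) {x} {y} vx vy e with find (resolves x y vx vy (Edge-irreflexive e))
  ... | w , w∈S , r with edge-resolved-by-end vx vy e r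
  ...   | inj₁ refl = inj₁ w∈S
  ...   | inj₂ refl = inj₂ w∈S

  -- A geodesic through `x` and `y` whose ends form an edge, its minimality witnessed by `m`. A
  -- cover contains one of the ends, and each end resolves `x` and `y`, since one of them lies on a
  -- geodesic from that end to the other.
  record Extension (x y : Pair R) : Set where
    constructor extension
    field
      {x′ y′} : Pair R
      {a b c m} : ℕ
      toSource : Walk x′ x a
      middle : Walk x y b
      toTarget : Walk y y′ c
      ends : Edge x′ y′
      short : a ℕ.+ (b ℕ.+ c) ≤ m
      far : ∀ k → Walk x′ y′ k → m ≤ k

  Extension-sym : ∀ {x y} → Extension x y → Extension y x
  Extension-sym (extension {a = a} {b} {c} p q r e short far) = extension (reverse r) (reverse q) (reverse p) (flip e)
    (ℕₚ.≤-trans (ℕₚ.≤-reflexive c+[b+a]≡a+[b+c]) short) (λ k w → far k (reverse w))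
    where
    c+[b+a]≡a+[b+c] : c ℕ.+ (b ℕ.+ a) ≡ a ℕ.+ (b ℕ.+ c)
    c+[b+a]≡a+[b+c] = trans (ℕₚ.+-comm c (b ℕ.+ a)) (trans (cong (ℕ._+ c) (ℕₚ.+-comm b a)) (ℕₚ.+-assoc a b c))

  extension-resolved : ∀ {S x y} → Covers S → Extension x y → Any (λ w → StronglyResolves R w x y) S
  extension-resolved cover (extension {a = a} {b} {c} p q r e short far)
    with cover (source p) (source (reverse r)) e
  ... | inj₁ x′∈S = lose x′∈S (inj₂ (Between⇒shortest (b , a , reverse q , reverse p , λ k w →
        ℕₚ.+-cancelʳ-≤ c (b ℕ.+ a) k (ℕₚ.≤-trans (ℕₚ.≤-reflexive (trans (cong (ℕ._+ c) (ℕₚ.+-comm b a)) (ℕₚ.+-assoc a b c)))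
          (ℕₚ.≤-trans short (far _ (reverse w ⊕ r)))))))
  ... | inj₂ y′∈S = lose y′∈S (inj₁ (Between⇒shortest (b , c , q , r , λ k w →
        ℕₚ.+-cancelˡ-≤ a (b ℕ.+ c) k (ℕₚ.≤-trans short (far _ (p ⊕ w))))))

  -- A unit outside {u , u⁻¹}: if u² ≠ 1 then `1#` serves, otherwise u⁻¹ = u and any element of U″
  -- serves.
  other-unit : ∀ {u v} → u * v ≡ 1# → ∃ λ w → IsUnit R w × u ≢ w × u * w ≢ 1#
  other-unit {u} {v} uv≡1 with (u * u) F.≟ 1#
  ... | no uu≢1 = 1# , 1-unit , (λ { refl → uu≢1 (*-identityˡ 1#) })
      , λ u1≡1 → uu≢1 (trans (cong₂ _*_ (u≡1 u1≡1) (u≡1 u1≡1)) (*-identityˡ 1#))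
    where
    u≡1 : u * 1# ≡ 1# → u ≡ 1#
    u≡1 u1≡1 = trans (sym (*-identityʳ u)) u1≡1
  ... | yes uu≡1 = let (w , w-unit , ww≢1) = U″ in w , w-unit , (λ { refl → ww≢1 uu≡1 })
      , λ uw≡1 → ww≢1 (subst (λ z → z * z ≡ 1#) (inverse-unique uu≡1 uw≡1) uu≡1)

  extend-top-top : ∀ {u v} → V (1# , u) → V (1# , v) → u ≢ v → Extension (1# , u) (1# , v)
  extend-top-top {u} {v} vx@(_ , _ , u-unit) vy u≢v with (u * v) F.≟ 1#
  ... | yes uv≡1 = extension (stay vx) (edge vx vy (≢-right u≢v , inj₂ uv≡1))
      (edge vy (e₀-idempotent , e₀≢0 , u-unit) (inverse-adjacent (≢-sym e₀≢1) (comm₁ uv≡1)))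
      (top-low e₀≢1 uu≢1) ℕₚ.≤-refl (far-2 (≢-left (≢-sym e₀≢1)) (1*≢0 e₀≢0) uu≢1)
    where
    uu≢1 : u * u ≢ 1#
    uu≢1 uu≡1 = u≢v (inverse-unique uu≡1 uv≡1)
  ... | no uv≢1 with within-3 vx vy
  ...   | b , b≤3 , p = extension (stay vx) p (stay vy) (top-top u≢v uv≢1)
      (ℕₚ.≤-trans (ℕₚ.≤-reflexive (ℕₚ.+-identityʳ b)) b≤3) (far-3 u≢v uv≢1)

  -- Unless the pair is itself an edge, the geodesic goes on past `(f , v)`: to `(1# , v⁻¹)` if uv ≠
  -- 1; to `(1# - f , u)` if uv = 1 and u² ≠ 1; and to `(1# - f , w)` and `(1# , w⁻¹)` with `w` from
  -- `other-unit` if uv = u² = 1.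
  extend-top-low : ∀ {u f v} → V (1# , u) → V (f , v) → f ≢ 1# → Extension (1# , u) (f , v)
  extend-top-low {u} {f} {v} vx@(_ , _ , u′ , uu′≡1) vy@(ff≡f , f≢0 , v′ , vv′≡1) f≢1
    with (u * v) F.≟ 1# | u F.≟ v | (u * u) F.≟ 1#
  ... | no uv≢1 | yes refl | _ with within-sym (within-2 vy vx f≢1)
  ...   | b , b≤2 , p = extension (stay vx) p (stay vy) (top-low f≢1 uv≢1)
      (ℕₚ.≤-trans (ℕₚ.≤-reflexive (ℕₚ.+-identityʳ b)) b≤2) (far-2 (≢-left (≢-sym f≢1)) (1*≢0 f≢0) uv≢1)
  extend-top-low {u} {f} {v} vx@(_ , _ , u′ , uu′≡1) vy@(ff≡f , f≢0 , v′ , vv′≡1) f≢1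
      | no uv≢1 | no u≢v | _ with within-sym (within-2 vy vx f≢1)
  ...   | b , b≤2 , p = extension (stay vx) p (edge vy (1-vertex (inverse-unit vv′≡1)) (inverse-adjacent f≢1 vv′≡1))
      (top-top u≢v′ uv′≢1) (ℕₚ.+-monoˡ-≤ 1 b≤2) (far-3 u≢v′ uv′≢1)
    where
    u≢v′ : u ≢ v′
    u≢v′ refl = uv≢1 (comm₁ vv′≡1)
    uv′≢1 : u * v′ ≢ 1#
    uv′≢1 uv′≡1 = u≢v (inverse-unique (comm₁ uv′≡1) (comm₁ vv′≡1))
  extend-top-low {u} {f} {v} vx@(_ , _ , u-unit) vy@(ff≡f , f≢0 , v′ , vv′≡1) f≢1
      | yes uv≡1 | _ | no uu≢1 = extension (stay vx) (edge vx vy (inverse-adjacent (≢-sym f≢1) uv≡1))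
      (edge vy (complement-vertex ff≡f f≢1 u-unit) (complement-adjacent ff≡f f≢0))
      (top-low (complement≢1 f≢0) uu≢1) ℕₚ.≤-refl
      (far-2 (≢-left (≢-sym (complement≢1 f≢0))) (1*≢0 (complement≢0 f≢1)) uu≢1)
  extend-top-low {u} {f} {v} vx@(_ , _ , u′ , uu′≡1) vy@(ff≡f , f≢0 , _) f≢1
      | yes uv≡1 | _ | yes uu≡1 with other-unit uu′≡1
  ...   | w , (w′ , ww′≡1) , u≢w , uw≢1 =
      extension (stay vx) (edge vx vy (inverse-adjacent (≢-sym f≢1) uv≡1))
      (step vy (complement-adjacent ff≡f f≢0)
        (edge (complement-vertex ff≡f f≢1 (w′ , ww′≡1)) (1-vertex (inverse-unit ww′≡1)) (inverse-adjacent (complement≢1 f≢0) ww′≡1)))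
      (top-top u≢w′ uw′≢1) ℕₚ.≤-refl (far-3 u≢w′ uw′≢1)
    where
    u≢w′ : u ≢ w′
    u≢w′ refl = uw≢1 (comm₁ ww′≡1)
    uw′≢1 : u * w′ ≢ 1#
    uw′≢1 uw′≡1 = u≢w (inverse-unique (comm₁ uw′≡1) (comm₁ ww′≡1))

  extend-twin : ∀ {e f u} → V (e , u) → V (f , u) → e ≢ 1# → f ≢ 1# → Adj R (e , u) (f , u) →
                e * (1# - f) ≢ 0# → Extension (e , u) (f , u)
  extend-twin vx@(_ , _ , u′ , uu′≡1) vy@(ff≡f , f≢0 , _) e≢1 f≢1 adj e[1-f]≢0 with other-unit uu′≡1
  ... | w , w-unit , u≢w , uw≢1 = extension (stay vx) (edge vx vy adj)
      (edge vy (complement-vertex ff≡f f≢1 w-unit) (complement-adjacent ff≡f f≢0))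
      (low-low e≢1 (complement≢1 f≢0) (≢-right u≢w) e[1-f]≢0 uw≢1) ℕₚ.≤-refl
      (far-2 (≢-right u≢w) e[1-f]≢0 uw≢1)

  extend-low-low-edge : ∀ {e f u v} → V (e , u) → V (f , v) → e ≢ 1# → f ≢ 1# → (e , u) ≢ (f , v) →
                        e * f ≢ 0# → u * v ≢ 1# → Extension (e , u) (f , v)
  extend-low-low-edge vx vy e≢1 f≢1 x≢y ef≢0 uv≢1 with within-2 vx vy e≢1
  ... | b , b≤2 , p = extension (stay vx) p (stay vy) (low-low e≢1 f≢1 x≢y ef≢0 uv≢1)
      (ℕₚ.≤-trans (ℕₚ.≤-reflexive (ℕₚ.+-identityʳ b)) b≤2) (far-2 x≢y ef≢0 uv≢1)

  -- One of the two idempotents is not below the other, as otherwise `e ≡ e * f ≡ f`. It therefore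
  -- meets the complement of the other, over which the geodesic can be prolonged.
  extend-adjacent-twins : ∀ {e f u} → V (e , u) → V (f , u) → e ≢ 1# → f ≢ 1# → Adj R (e , u) (f , u) →
                          Extension (e , u) (f , u)
  extend-adjacent-twins {e} {f} vx vy e≢1 f≢1 adj with (e * (1# - f)) F.≟ 0# | (f * (1# - e)) F.≟ 0#
  ... | no e[1-f]≢0 | _ = extend-twin vx vy e≢1 f≢1 adj e[1-f]≢0
  ... | yes _ | no f[1-e]≢0 = Extension-sym (extend-twin vy vx f≢1 e≢1 (Adj-sym adj) f[1-e]≢0)
  ... | yes e[1-f]≡0 | yes f[1-e]≡0 = contradiction
      (cong (_, _) (trans (e[1-f]≡0⇒e≡ef e f e[1-f]≡0) (trans (*-comm e f) (sym (e[1-f]≡0⇒e≡ef f e f[1-e]≡0)))))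
      (proj₁ adj)

  -- Two cases remain besides edges and adjacent twins. For u ≠ v and uv = 1 the geodesic goes on to
  -- `(1# , u)`. For u ≠ v, uv ≠ 1 and ef = 0 it is prolonged at both ends, to `(1# , u⁻¹)` and
  -- `(1# , v⁻¹)`, and has length 3.
  extend-low-low : ∀ {e f u v} → V (e , u) → V (f , v) → e ≢ 1# → f ≢ 1# → (e , u) ≢ (f , v) →
                   Extension (e , u) (f , v)
  extend-low-low {e} {f} {u} {v} vx vy e≢1 f≢1 x≢y
    with u F.≟ v | (u * v) F.≟ 1# | (e * f) F.≟ 0#
  ... | _        | no uv≢1  | no ef≢0  = extend-low-low-edge vx vy e≢1 f≢1 x≢y ef≢0 uv≢1
  ... | yes refl | yes uv≡1 | _        = extend-adjacent-twins vx vy e≢1 f≢1 (x≢y , inj₂ uv≡1)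
  ... | yes refl | no _     | yes ef≡0 = extend-adjacent-twins vx vy e≢1 f≢1 (x≢y , inj₁ ef≡0)
  ... | no u≢v   | yes uv≡1 | _        =
      extension (stay vx) (edge vx vy (x≢y , inj₂ uv≡1))
      (edge vy (1-vertex (_ , uv≡1)) (inverse-adjacent f≢1 (comm₁ uv≡1)))
      (flip (top-low e≢1 uu≢1)) ℕₚ.≤-refl
      (far-2 (≢-left e≢1) (λ e1≡0 → proj₁ (proj₂ vx) (trans (sym (*-identityʳ e)) e1≡0)) uu≢1)
    where
    uu≢1 : u * u ≢ 1#
    uu≢1 uu≡1 = u≢v (inverse-unique uu≡1 uv≡1)
  extend-low-low {e} {f} {u} {v} vx@(_ , _ , u′ , uu′≡1) vy@(_ , _ , v′ , vv′≡1) e≢1 f≢1 x≢y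
      | no u≢v | no uv≢1 | yes ef≡0 =
      extension (edge (1-vertex (inverse-unit uu′≡1)) vx (inverse-adjacent (≢-sym e≢1) (comm₁ uu′≡1)))
      (edge vx vy (x≢y , inj₁ ef≡0))
      (edge vy (1-vertex (inverse-unit vv′≡1)) (inverse-adjacent f≢1 vv′≡1))
      (top-top u′≢v′ u′v′≢1) ℕₚ.≤-refl (far-3 u′≢v′ u′v′≢1)
    where
    u′≢v′ : u′ ≢ v′
    u′≢v′ refl = u≢v (inverse-unique (comm₁ uu′≡1) (comm₁ vv′≡1))
    u′v′≢1 : u′ * v′ ≢ 1#
    u′v′≢1 u′v′≡1 with inverse-unique u′v′≡1 (comm₁ uu′≡1)
    ... | refl = uv≢1 (comm₁ vv′≡1)

  extend : ∀ {x y} → V x → V y → x ≢ y → Extension x y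
  extend {e , u} {f , v} vx vy x≢y with e F.≟ 1# | f F.≟ 1#
  ... | yes refl | yes refl = extend-top-top vx vy λ { refl → x≢y refl }
  ... | yes refl | no f≢1   = extend-top-low vx vy f≢1
  ... | no e≢1   | yes refl = Extension-sym (extend-top-low vy vx e≢1)
  ... | no e≢1   | no f≢1   = extend-low-low vx vy e≢1 f≢1 x≢y

  covers⇒resolving : ∀ {S} → All V S → Covers S → IsStrongResolvingSet R S
  covers⇒resolving vertices cover =
    vertices , λ x y vx vy x≢y → extension-resolved cover (extend vx vy x≢y)

-- The listed local rings

record RingIso (A B : FiniteCommRing) : Set where
  private
    module A = Arithmetic A
    module B = Arithmetic B
  field
    ψ : A.Carrier → B.Carrier
    ψ-+ : ∀ x y → ψ (x A.+ y) ≡ ψ x B.+ ψ y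
    ψ-* : ∀ x y → ψ (x A.* y) ≡ ψ x B.* ψ y
    ψ-1 : ψ A.1# ≡ B.1#
    ψ-injective : ∀ {x y} → ψ x ≡ ψ y → x ≡ y
    ψ-surjective : ∀ y → ∃ λ x → ψ x ≡ y

module _ (A B : FiniteCommRing) (localB : IsLocal B) where
  private
    module A = Arithmetic A
    module B = Arithmetic B
    module L = LocalRing B localB

  -- Injectivity: the kernel is an ideal and every nonzero ideal of A contains the socle generator s.
  -- Surjectivity: a nonunit y of the local ring B is (1 + y) - 1 with 1 + y a unit.
  ringIso : (ψ : A.Carrier → B.Carrier)
    (ψ-+ : ∀ x y → ψ (x A.+ y) ≡ ψ x B.+ ψ y)
    (ψ-* : ∀ x y → ψ (x A.* y) ≡ ψ x B.* ψ y)
    (ψ-1 : ψ A.1# ≡ B.1#)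
    (s : A.Carrier) → (∀ x → x ≡ A.0# ⊎ (∃ λ y → y A.* x ≡ s)) → ψ s ≢ B.0# →
    (g : A.Carrier) → (∀ y → IsUnit B y → ∃ λ k → y ≡ ψ g B.↑ k) → RingIso A B
  ringIso ψ ψ-+ ψ-* ψ-1 s socle ψs≢0 g powers = record
    { ψ = ψ ; ψ-+ = ψ-+ ; ψ-* = ψ-* ; ψ-1 = ψ-1 ; ψ-injective = ψ-injective ; ψ-surjective = ψ-surjective }
    where
    ψ-0 : ψ A.0# ≡ B.0#
    ψ-0 = B.+-cancelˡ (ψ A.0#) _ _
      (trans (sym (ψ-+ A.0# A.0#)) (trans (cong ψ (A.+-identityˡ A.0#)) (sym (B.+-identityʳ _))))

    ψ-neg : ∀ x → ψ (A.- x) ≡ B.- ψ x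
    ψ-neg x = B.+-cancelˡ (ψ x) _ _
      (trans (sym (ψ-+ x (A.- x))) (trans (cong ψ (A.-‿inverseʳ x)) (trans ψ-0 (sym (B.-‿inverseʳ _)))))

    ψ-injective : ∀ {x y} → ψ x ≡ ψ y → x ≡ y
    ψ-injective {x} {y} ψx≡ψy with socle (x A.- y)
    ... | inj₁ x-y≡0 = A.x-y≡0⇒x≡y x y x-y≡0
    ... | inj₂ (z , z[x-y]≡s) = contradiction ψs≡0 ψs≢0
      where
      ψs≡0 : ψ s ≡ B.0#
      ψs≡0 = begin
        ψ s                           ≡⟨ cong ψ (sym z[x-y]≡s) ⟩
        ψ (z A.* (x A.- y))           ≡⟨ ψ-* z _ ⟩
        ψ z B.* ψ (x A.- y)           ≡⟨ cong (ψ z B.*_) (trans (ψ-+ x _) (cong₂ B._+_ ψx≡ψy (ψ-neg y))) ⟩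
        ψ z B.* (ψ y B.- ψ y)         ≡⟨ cong (ψ z B.*_) (B.-‿inverseʳ (ψ y)) ⟩
        ψ z B.* B.0#                  ≡⟨ B.zeroʳ (ψ z) ⟩
        B.0#                          ∎
        where open ≡-Reasoning

    ψ-↑ : ∀ k → ψ (g A.↑ k) ≡ ψ g B.↑ k
    ψ-↑ zero = ψ-1
    ψ-↑ (suc k) = trans (ψ-* g _) (cong (ψ g B.*_) (ψ-↑ k))

    units : ∀ y → IsUnit B y → ∃ λ x → ψ x ≡ y
    units y unit = let (k , y≡gᵏ) = powers y unit in g A.↑ k , trans (ψ-↑ k) (sym y≡gᵏ)

    ψ-surjective : ∀ y → ∃ λ x → ψ x ≡ y
    ψ-surjective y with isUnit? B y | isUnit? B (B.1# B.+ y)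
    ... | yes unit | _ = units y unit
    ... | no ¬y | no ¬1+y = contradiction L.1-unit
      (subst L.NonUnit (B.solve 1 (λ y → (B.κ 1 B.:+ y) B.:+ B.:- y B.:= B.κ 1) refl y)
        (L.nonunit-+ ¬1+y (L.nonunit-neg ¬y)))
    ... | no _ | yes unit with units (B.1# B.+ y) unit
    ...   | x , ψx≡1+y = x A.- A.1# , (begin
      ψ (x A.- A.1#)            ≡⟨ ψ-+ x _ ⟩
      ψ x B.+ ψ (A.- A.1#)      ≡⟨ cong₂ B._+_ ψx≡1+y (trans (ψ-neg A.1#) (cong B.-_ ψ-1)) ⟩
      (B.1# B.+ y) B.- B.1#     ≡⟨ B.solve 1 (λ y → (B.κ 1 B.:+ y) B.:- B.κ 1 B.:= y) refl y ⟩
      y                         ∎)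
      where open ≡-Reasoning

-- The coordinate formulas of the listed rings are checked on all pairs of elements; afterwards only
-- the arithmetic of `ι` modulo 2, 4 and 5 is required.
table? : ∀ {n} (f g : Fin n → Fin n → ℕ) → Dec (∀ i j → f i j ≡ g i j)
table? f g = all? λ i → all? λ j → f i j ℕ.≟ g i j

SocleGenerator : (A : FiniteCommRing) → FiniteCommRing.Carrier A → Set
SocleGenerator A s = ∀ x → x ≡ A.0# ⊎ (∃ λ y → y A.* x ≡ s)
  where module A = FiniteCommRing A

socleGenerator? : ∀ A s → Dec (SocleGenerator A s)
socleGenerator? A s = all? λ x → (x F.≟ A.0#) ⊎-dec any? (λ y → (y A.* x) F.≟ s)
  where module A = FiniteCommRing A

module ℤ₂-coordinates where
  open FiniteCommRing ℤ₂

  add₀ : ∀ i j → toℕ (i + j) ≡ (toℕ i ℕ.+ toℕ j) % 2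
  add₀ = from-yes (table? (λ i j → toℕ (i + j)) (λ i j → (toℕ i ℕ.+ toℕ j) % 2))

  mul₀ : ∀ i j → toℕ (i * j) ≡ (toℕ i ℕ.* toℕ j) % 2
  mul₀ = from-yes (table? (λ i j → toℕ (i * j)) (λ i j → (toℕ i ℕ.* toℕ j) % 2))

  socle : SocleGenerator ℤ₂ 1#
  socle = from-yes (socleGenerator? ℤ₂ 1#)

module ℤ₅-coordinates where
  open FiniteCommRing ℤ₅

  add₀ : ∀ i j → toℕ (i + j) ≡ (toℕ i ℕ.+ toℕ j) % 5
  add₀ = from-yes (table? (λ i j → toℕ (i + j)) (λ i j → (toℕ i ℕ.+ toℕ j) % 5))

  mul₀ : ∀ i j → toℕ (i * j) ≡ (toℕ i ℕ.* toℕ j) % 5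
  mul₀ = from-yes (table? (λ i j → toℕ (i * j)) (λ i j → (toℕ i ℕ.* toℕ j) % 5))

  socle : SocleGenerator ℤ₅ 1#
  socle = from-yes (socleGenerator? ℤ₅ 1#)

module 𝔽₄-coordinates where
  open FiniteCommRing 𝔽₄

  c₀ c₁ : Carrier → ℕ
  c₀ i = toℕ i % 2
  c₁ i = toℕ i / 2

  add₀ : ∀ i j → c₀ (i + j) ≡ (c₀ i ℕ.+ c₀ j) % 2
  add₀ = from-yes (table? (λ i j → c₀ (i + j)) (λ i j → (c₀ i ℕ.+ c₀ j) % 2))

  add₁ : ∀ i j → c₁ (i + j) ≡ (c₁ i ℕ.+ c₁ j) % 2
  add₁ = from-yes (table? (λ i j → c₁ (i + j)) (λ i j → (c₁ i ℕ.+ c₁ j) % 2))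

  mul₀ : ∀ i j → c₀ (i * j) ≡ (c₀ i ℕ.* c₀ j ℕ.+ c₁ i ℕ.* c₁ j) % 2
  mul₀ = from-yes (table? (λ i j → c₀ (i * j)) (λ i j → (c₀ i ℕ.* c₀ j ℕ.+ c₁ i ℕ.* c₁ j) % 2))

  mul₁ : ∀ i j → c₁ (i * j) ≡ (c₀ i ℕ.* c₁ j ℕ.+ c₁ i ℕ.* c₀ j ℕ.+ c₁ i ℕ.* c₁ j) % 2
  mul₁ = from-yes (table? (λ i j → c₁ (i * j)) (λ i j → (c₀ i ℕ.* c₁ j ℕ.+ c₁ i ℕ.* c₀ j ℕ.+ c₁ i ℕ.* c₁ j) % 2))

  socle : SocleGenerator 𝔽₄ 1#
  socle = from-yes (socleGenerator? 𝔽₄ 1#)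

module ℤ₂[x]/x³-coordinates where
  open FiniteCommRing ℤ₂[x]/x³

  c₀ c₁ c₂ : Carrier → ℕ
  c₀ i = toℕ i % 2
  c₁ i = (toℕ i / 2) % 2
  c₂ i = toℕ i / 4

  add₀ : ∀ i j → c₀ (i + j) ≡ (c₀ i ℕ.+ c₀ j) % 2
  add₀ = from-yes (table? (λ i j → c₀ (i + j)) (λ i j → (c₀ i ℕ.+ c₀ j) % 2))

  add₁ : ∀ i j → c₁ (i + j) ≡ (c₁ i ℕ.+ c₁ j) % 2
  add₁ = from-yes (table? (λ i j → c₁ (i + j)) (λ i j → (c₁ i ℕ.+ c₁ j) % 2))

  add₂ : ∀ i j → c₂ (i + j) ≡ (c₂ i ℕ.+ c₂ j) % 2
  add₂ = from-yes (table? (λ i j → c₂ (i + j)) (λ i j → (c₂ i ℕ.+ c₂ j) % 2))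

  mul₀ : ∀ i j → c₀ (i * j) ≡ (c₀ i ℕ.* c₀ j) % 2
  mul₀ = from-yes (table? (λ i j → c₀ (i * j)) (λ i j → (c₀ i ℕ.* c₀ j) % 2))

  mul₁ : ∀ i j → c₁ (i * j) ≡ (c₀ i ℕ.* c₁ j ℕ.+ c₁ i ℕ.* c₀ j) % 2
  mul₁ = from-yes (table? (λ i j → c₁ (i * j)) (λ i j → (c₀ i ℕ.* c₁ j ℕ.+ c₁ i ℕ.* c₀ j) % 2))

  mul₂ : ∀ i j → c₂ (i * j) ≡ (c₀ i ℕ.* c₂ j ℕ.+ c₁ i ℕ.* c₁ j ℕ.+ c₂ i ℕ.* c₀ j) % 2
  mul₂ = from-yes (table? (λ i j → c₂ (i * j)) (λ i j → (c₀ i ℕ.* c₂ j ℕ.+ c₁ i ℕ.* c₁ j ℕ.+ c₂ i ℕ.* c₀ j) % 2))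

  socle : SocleGenerator ℤ₂[x]/x³ (F.# 4)
  socle = from-yes (socleGenerator? ℤ₂[x]/x³ (F.# 4))

module ℤ₄[x]/⟨2x,x²-2⟩-coordinates where
  open FiniteCommRing ℤ₄[x]/⟨2x,x²-2⟩

  c₀ c₁ : Carrier → ℕ
  c₀ i = toℕ i % 4
  c₁ i = toℕ i / 4

  add₀ : ∀ i j → c₀ (i + j) ≡ (c₀ i ℕ.+ c₀ j) % 4
  add₀ = from-yes (table? (λ i j → c₀ (i + j)) (λ i j → (c₀ i ℕ.+ c₀ j) % 4))

  add₁ : ∀ i j → c₁ (i + j) ≡ (c₁ i ℕ.+ c₁ j) % 2
  add₁ = from-yes (table? (λ i j → c₁ (i + j)) (λ i j → (c₁ i ℕ.+ c₁ j) % 2))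

  mul₀ : ∀ i j → c₀ (i * j) ≡ (c₀ i ℕ.* c₀ j ℕ.+ (2 ℕ.* c₁ i) ℕ.* c₁ j) % 4
  mul₀ = from-yes (table? (λ i j → c₀ (i * j)) (λ i j → (c₀ i ℕ.* c₀ j ℕ.+ (2 ℕ.* c₁ i) ℕ.* c₁ j) % 4))

  mul₁ : ∀ i j → c₁ (i * j) ≡ (c₀ i ℕ.* c₁ j ℕ.+ c₁ i ℕ.* c₀ j) % 2
  mul₁ = from-yes (table? (λ i j → c₁ (i * j)) (λ i j → (c₀ i ℕ.* c₁ j ℕ.+ c₁ i ℕ.* c₀ j) % 2))

  socle : SocleGenerator ℤ₄[x]/⟨2x,x²-2⟩ (F.# 2)
  socle = from-yes (socleGenerator? ℤ₄[x]/⟨2x,x²-2⟩ (F.# 2))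

-- Recognising the listed rings by generators and relations

module Models (B : FiniteCommRing) (local : IsLocal B) where
  open Arithmetic B
  open LocalRing B local

  open ≡-Reasoning

  -- The factor `x` is kept because in ℤ₄[x]/⟨2x , x² - 2⟩ the coefficient of x is taken modulo 2
  -- although 2 ≠ 0 in the ring.
  ι-%-* : ∀ m .{{_ : NonZero m}} x → ι m * x ≡ 0# → ∀ p → ι (p % m) * x ≡ ι p * x
  ι-%-* m x mx≡0 p = begin
    ι (p % m) * x                                     ≡⟨ solve 2 (λ r x → r :* x := r :* x :+ κ 0) refl (ι (p % m)) x ⟩
    ι (p % m) * x + 0#                                ≡⟨ cong (ι (p % m) * x +_) (sym (trans (cong (ι (p / m) *_) mx≡0) (zeroʳ _))) ⟩
    ι (p % m) * x + ι (p / m) * (ι m * x)             ≡⟨ solve 4 (λ r q m x → r :* x :+ q :* (m :* x) := (r :+ q :* m) :* x) refl (ι (p % m)) (ι (p / m)) (ι m) x ⟩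
    (ι (p % m) + ι (p / m) * ι m) * x                 ≡⟨ cong (λ z → (ι (p % m) + z) * x) (sym (ι-* (p / m) m)) ⟩
    (ι (p % m) + ι (p / m ℕ.* m)) * x                 ≡⟨ cong (_* x) (sym (ι-+ (p % m) (p / m ℕ.* m))) ⟩
    ι (p % m ℕ.+ p / m ℕ.* m) * x                     ≡⟨ cong (λ z → ι z * x) (sym (m≡m%n+[m/n]*n p m)) ⟩
    ι p * x                                           ∎

  ι-% : ∀ m .{{_ : NonZero m}} → ι m ≡ 0# → ∀ p → ι (p % m) ≡ ι p
  ι-% m m≡0 p = trans (sym (*-identityʳ _)) (trans (ι-%-* m 1# (trans (*-identityʳ _) m≡0) p) (*-identityʳ _))

  private
    ι-+*+* : ∀ p q r s → ι (p ℕ.* q ℕ.+ r ℕ.* s) ≡ ι p * ι q + ι r * ι s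
    ι-+*+* p q r s = trans (ι-+ (p ℕ.* q) (r ℕ.* s)) (cong₂ _+_ (ι-* p q) (ι-* r s))

    ι-+*+*+* : ∀ p q r s t u → ι (p ℕ.* q ℕ.+ r ℕ.* s ℕ.+ t ℕ.* u) ≡ ι p * ι q + ι r * ι s + ι t * ι u
    ι-+*+*+* p q r s t u = trans (ι-+ (p ℕ.* q ℕ.+ r ℕ.* s) (t ℕ.* u)) (cong₂ _+_ (ι-+*+* p q r s) (ι-* t u))

    linear : Carrier → Carrier → Carrier → Carrier
    linear x p q = p + q * x

    quadratic : Carrier → Carrier → Carrier → Carrier → Carrier
    quadratic x p q r = p + q * x + r * (x * x)

    cong₃ : ∀ {p p′ q q′ r r′} (f : Carrier → Carrier → Carrier → Carrier) → p ≡ p′ → q ≡ q′ → r ≡ r′ → f p q r ≡ f p′ q′ r′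
    cong₃ f refl refl refl = refl

    linear-1 : ∀ x → linear x (ι 1) (ι 0) ≡ 1#
    linear-1 = solve 1 (λ x → κ 1 :+ κ 0 :* x := κ 1) refl

  PowersOf : Carrier → Set
  PowersOf a = ∀ y → IsUnit B y → ∃ λ k → y ≡ a ↑ k

  ℤ₂-iso : ι 2 ≡ 0# → PowersOf 1# → RingIso ℤ₂ B
  ℤ₂-iso 2≡0 powers = ringIso ℤ₂ B local (λ i → ι (toℕ i))
    (λ i j → trans (cong ι (add₀ i j)) (trans (ι-% 2 2≡0 (toℕ i ℕ.+ toℕ j)) (ι-+ (toℕ i) (toℕ j))))
    (λ i j → trans (cong ι (mul₀ i j)) (trans (ι-% 2 2≡0 (toℕ i ℕ.* toℕ j)) (ι-* (toℕ i) (toℕ j))))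
    refl _ socle 1≢0 (F.# 1) powers
    where open ℤ₂-coordinates

  ℤ₅-iso : ι 5 ≡ 0# → ∀ g → PowersOf (ι (toℕ g)) → RingIso ℤ₅ B
  ℤ₅-iso 5≡0 g powers = ringIso ℤ₅ B local (λ i → ι (toℕ i))
    (λ i j → trans (cong ι (add₀ i j)) (trans (ι-% 5 5≡0 (toℕ i ℕ.+ toℕ j)) (ι-+ (toℕ i) (toℕ j))))
    (λ i j → trans (cong ι (mul₀ i j)) (trans (ι-% 5 5≡0 (toℕ i ℕ.* toℕ j)) (ι-* (toℕ i) (toℕ j))))
    refl _ socle 1≢0 g powers
    where open ℤ₅-coordinates

  -- The element `F.# 2` encodes ω, which is sent to `a`.
  𝔽₄-iso : ∀ a → ι 2 ≡ 0# → a * a ≡ a + 1# → PowersOf a → RingIso 𝔽₄ B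
  𝔽₄-iso a 2≡0 aa≡a+1 powers = ringIso 𝔽₄ B local ψ ψ-+ ψ-* (linear-1 a) _ socle
    (subst (_≢ 0#) (sym (linear-1 a)) 1≢0) (F.# 2)
    (subst PowersOf (solve 1 (λ a → a := κ 0 :+ κ 1 :* a) refl a) powers)
    where
    open 𝔽₄-coordinates
    ψ : Fin 4 → Carrier
    ψ i = linear a (ι (c₀ i)) (ι (c₁ i))
    mod : ∀ p → ι (p % 2) ≡ ι p
    mod = ι-% 2 2≡0
    ψ-+ : ∀ i j → ψ (FiniteCommRing._+_ 𝔽₄ i j) ≡ ψ i + ψ j
    ψ-+ i j = begin
      ψ (FiniteCommRing._+_ 𝔽₄ i j)
        ≡⟨ cong₂ (linear a)
             (trans (cong ι (add₀ i j)) (trans (mod (c₀ i ℕ.+ c₀ j)) (ι-+ (c₀ i) (c₀ j))))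
             (trans (cong ι (add₁ i j)) (trans (mod (c₁ i ℕ.+ c₁ j)) (ι-+ (c₁ i) (c₁ j)))) ⟩
      linear a (ι (c₀ i) + ι (c₀ j)) (ι (c₁ i) + ι (c₁ j))
        ≡⟨ solve 5 (λ x p q r s → (p :+ r) :+ (q :+ s) :* x := (p :+ q :* x) :+ (r :+ s :* x)) refl
             a (ι (c₀ i)) (ι (c₁ i)) (ι (c₀ j)) (ι (c₁ j)) ⟩
      ψ i + ψ j ∎
    ψ-* : ∀ i j → ψ (FiniteCommRing._*_ 𝔽₄ i j) ≡ ψ i * ψ j
    ψ-* i j = begin
      ψ (FiniteCommRing._*_ 𝔽₄ i j)
        ≡⟨ cong₂ (linear a)
             (trans (cong ι (mul₀ i j)) (trans (mod (c₀ i ℕ.* c₀ j ℕ.+ c₁ i ℕ.* c₁ j)) (ι-+*+* (c₀ i) (c₀ j) (c₁ i) (c₁ j))))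
             (trans (cong ι (mul₁ i j)) (trans (mod (c₀ i ℕ.* c₁ j ℕ.+ c₁ i ℕ.* c₀ j ℕ.+ c₁ i ℕ.* c₁ j)) (ι-+*+*+* (c₀ i) (c₁ j) (c₁ i) (c₀ j) (c₁ i) (c₁ j)))) ⟩
      linear a (p * r + q * s) (p * s + q * r + q * s)
        ≡⟨ solve 5 (λ x p q r s → (p :* r :+ q :* s) :+ (p :* s :+ q :* r :+ q :* s) :* x
             := p :* r :+ (p :* s :+ q :* r) :* x :+ q :* s :* (x :+ κ 1)) refl a p q r s ⟩
      p * r + (p * s + q * r) * a + q * s * (a + 1#)
        ≡⟨ cong (λ z → p * r + (p * s + q * r) * a + q * s * z) (sym aa≡a+1) ⟩
      p * r + (p * s + q * r) * a + q * s * (a * a)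
        ≡⟨ solve 5 (λ x p q r s → p :* r :+ (p :* s :+ q :* r) :* x :+ q :* s :* (x :* x)
             := (p :+ q :* x) :* (r :+ s :* x)) refl a p q r s ⟩
      ψ i * ψ j ∎
      where
      p = ι (c₀ i)
      q = ι (c₁ i)
      r = ι (c₀ j)
      s = ι (c₁ j)

  -- The element `F.# 3` encodes 1 + x, the generator of the unit group, and the socle generator is
  -- x², which is why `x * x ≢ 0#` is assumed.
  ℤ₂[x]/x³-iso : ∀ x → ι 2 ≡ 0# → x * (x * x) ≡ 0# → x * x ≢ 0# → PowersOf (1# + x) → RingIso ℤ₂[x]/x³ B
  ℤ₂[x]/x³-iso x 2≡0 xxx≡0 xx≢0 powers = ringIso ℤ₂[x]/x³ B local ψ ψ-+ ψ-*
    (solve 1 (λ x → κ 1 :+ κ 0 :* x :+ κ 0 :* (x :* x) := κ 1) refl x) _ socle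
    (subst (_≢ 0#) (solve 1 (λ x → x :* x := κ 0 :+ κ 0 :* x :+ κ 1 :* (x :* x)) refl x) xx≢0) (F.# 3)
    (subst PowersOf (solve 1 (λ x → κ 1 :+ x := κ 1 :+ κ 1 :* x :+ κ 0 :* (x :* x)) refl x) powers)
    where
    open ℤ₂[x]/x³-coordinates
    ψ : Fin 8 → Carrier
    ψ i = quadratic x (ι (c₀ i)) (ι (c₁ i)) (ι (c₂ i))
    mod : ∀ p → ι (p % 2) ≡ ι p
    mod = ι-% 2 2≡0
    ψ-+ : ∀ i j → ψ (FiniteCommRing._+_ ℤ₂[x]/x³ i j) ≡ ψ i + ψ j
    ψ-+ i j = begin
      ψ (FiniteCommRing._+_ ℤ₂[x]/x³ i j)
        ≡⟨ cong₃ (quadratic x)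
             (trans (cong ι (add₀ i j)) (trans (mod (c₀ i ℕ.+ c₀ j)) (ι-+ (c₀ i) (c₀ j))))
             (trans (cong ι (add₁ i j)) (trans (mod (c₁ i ℕ.+ c₁ j)) (ι-+ (c₁ i) (c₁ j))))
             (trans (cong ι (add₂ i j)) (trans (mod (c₂ i ℕ.+ c₂ j)) (ι-+ (c₂ i) (c₂ j)))) ⟩
      quadratic x (ι (c₀ i) + ι (c₀ j)) (ι (c₁ i) + ι (c₁ j)) (ι (c₂ i) + ι (c₂ j))
        ≡⟨ solve 7 (λ x p q r p′ q′ r′ → (p :+ p′) :+ (q :+ q′) :* x :+ (r :+ r′) :* (x :* x)
             := (p :+ q :* x :+ r :* (x :* x)) :+ (p′ :+ q′ :* x :+ r′ :* (x :* x))) refl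
             x (ι (c₀ i)) (ι (c₁ i)) (ι (c₂ i)) (ι (c₀ j)) (ι (c₁ j)) (ι (c₂ j)) ⟩
      ψ i + ψ j ∎
    ψ-* : ∀ i j → ψ (FiniteCommRing._*_ ℤ₂[x]/x³ i j) ≡ ψ i * ψ j
    ψ-* i j = begin
      ψ (FiniteCommRing._*_ ℤ₂[x]/x³ i j)
        ≡⟨ cong₃ (quadratic x)
             (trans (cong ι (mul₀ i j)) (trans (mod (c₀ i ℕ.* c₀ j)) (ι-* (c₀ i) (c₀ j))))
             (trans (cong ι (mul₁ i j)) (trans (mod (c₀ i ℕ.* c₁ j ℕ.+ c₁ i ℕ.* c₀ j)) (ι-+*+* (c₀ i) (c₁ j) (c₁ i) (c₀ j))))
             (trans (cong ι (mul₂ i j)) (trans (mod (c₀ i ℕ.* c₂ j ℕ.+ c₁ i ℕ.* c₁ j ℕ.+ c₂ i ℕ.* c₀ j)) (ι-+*+*+* (c₀ i) (c₂ j) (c₁ i) (c₁ j) (c₂ i) (c₀ j)))) ⟩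
      quadratic x (p * p′) (p * q′ + q * p′) (p * r′ + q * q′ + r * p′)
        ≡⟨ solve 7 (λ x p q r p′ q′ r′ → p :* p′ :+ (p :* q′ :+ q :* p′) :* x :+ (p :* r′ :+ q :* q′ :+ r :* p′) :* (x :* x)
             := (p :+ q :* x :+ r :* (x :* x)) :* (p′ :+ q′ :* x :+ r′ :* (x :* x))
                :- (q :* r′ :+ r :* q′ :+ r :* r′ :* x) :* (x :* (x :* x))) refl x p q r p′ q′ r′ ⟩
      ψ i * ψ j - (q * r′ + r * q′ + r * r′ * x) * (x * (x * x))
        ≡⟨ cong (λ z → ψ i * ψ j - (q * r′ + r * q′ + r * r′ * x) * z) xxx≡0 ⟩
      ψ i * ψ j - (q * r′ + r * q′ + r * r′ * x) * 0#
        ≡⟨ solve 2 (λ y z → y :- z :* κ 0 := y) refl (ψ i * ψ j) _ ⟩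
      ψ i * ψ j ∎
      where
      p = ι (c₀ i)
      q = ι (c₁ i)
      r = ι (c₂ i)
      p′ = ι (c₀ j)
      q′ = ι (c₁ j)
      r′ = ι (c₂ j)

  -- The element `F.# 5` encodes 1 + x, and the socle generator is 2, which is why `ι 2 ≢ 0#` is
  -- assumed.
  ℤ₄[x]/⟨2x,x²-2⟩-iso : ∀ x → ι 4 ≡ 0# → ι 2 ≢ 0# → ι 2 * x ≡ 0# → x * x ≡ ι 2 → PowersOf (1# + x) →
                       RingIso ℤ₄[x]/⟨2x,x²-2⟩ B
  ℤ₄[x]/⟨2x,x²-2⟩-iso x 4≡0 2≢0 2x≡0 xx≡2 powers = ringIso ℤ₄[x]/⟨2x,x²-2⟩ B local ψ ψ-+ ψ-* (linear-1 x) _ socle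
    (subst (_≢ 0#) (solve 1 (λ x → κ 2 := κ 2 :+ κ 0 :* x) refl x) 2≢0) (F.# 5)
    (subst PowersOf (solve 1 (λ x → κ 1 :+ x := κ 1 :+ κ 1 :* x) refl x) powers)
    where
    open ℤ₄[x]/⟨2x,x²-2⟩-coordinates
    ψ : Fin 8 → Carrier
    ψ i = linear x (ι (c₀ i)) (ι (c₁ i))
    linear-% : ∀ p q → linear x (ι (p % 4)) (ι (q % 2)) ≡ linear x (ι p) (ι q)
    linear-% p q = cong₂ _+_ (ι-% 4 4≡0 p) (ι-%-* 2 x 2x≡0 q)
    ψ-+ : ∀ i j → ψ (FiniteCommRing._+_ ℤ₄[x]/⟨2x,x²-2⟩ i j) ≡ ψ i + ψ j
    ψ-+ i j = begin
      ψ (FiniteCommRing._+_ ℤ₄[x]/⟨2x,x²-2⟩ i j)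
        ≡⟨ trans (cong₂ (λ p q → linear x (ι p) (ι q)) (add₀ i j) (add₁ i j)) (linear-% (c₀ i ℕ.+ c₀ j) (c₁ i ℕ.+ c₁ j)) ⟩
      linear x (ι (c₀ i ℕ.+ c₀ j)) (ι (c₁ i ℕ.+ c₁ j))
        ≡⟨ cong₂ (linear x) (ι-+ (c₀ i) (c₀ j)) (ι-+ (c₁ i) (c₁ j)) ⟩
      linear x (ι (c₀ i) + ι (c₀ j)) (ι (c₁ i) + ι (c₁ j))
        ≡⟨ solve 5 (λ x p q r s → (p :+ r) :+ (q :+ s) :* x := (p :+ q :* x) :+ (r :+ s :* x)) refl
             x (ι (c₀ i)) (ι (c₁ i)) (ι (c₀ j)) (ι (c₁ j)) ⟩
      ψ i + ψ j ∎
    ψ-* : ∀ i j → ψ (FiniteCommRing._*_ ℤ₄[x]/⟨2x,x²-2⟩ i j) ≡ ψ i * ψ j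
    ψ-* i j = begin
      ψ (FiniteCommRing._*_ ℤ₄[x]/⟨2x,x²-2⟩ i j)
        ≡⟨ trans (cong₂ (λ p q → linear x (ι p) (ι q)) (mul₀ i j) (mul₁ i j))
             (linear-% (c₀ i ℕ.* c₀ j ℕ.+ (2 ℕ.* c₁ i) ℕ.* c₁ j) (c₀ i ℕ.* c₁ j ℕ.+ c₁ i ℕ.* c₀ j)) ⟩
      linear x (ι (c₀ i ℕ.* c₀ j ℕ.+ (2 ℕ.* c₁ i) ℕ.* c₁ j)) (ι (c₀ i ℕ.* c₁ j ℕ.+ c₁ i ℕ.* c₀ j))
        ≡⟨ cong₂ (linear x)
             (trans (ι-+*+* (c₀ i) (c₀ j) (2 ℕ.* c₁ i) (c₁ j)) (cong (λ z → p * r + z * s) (ι-* 2 (c₁ i))))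
             (ι-+*+* (c₀ i) (c₁ j) (c₁ i) (c₀ j)) ⟩
      linear x (p * r + (ι 2 * q) * s) (p * s + q * r)
        ≡⟨ cong (λ z → linear x (p * r + (z * q) * s) (p * s + q * r)) (sym xx≡2) ⟩
      linear x (p * r + (x * x * q) * s) (p * s + q * r)
        ≡⟨ solve 5 (λ x p q r s → (p :* r :+ (x :* x :* q) :* s) :+ (p :* s :+ q :* r) :* x
             := (p :+ q :* x) :* (r :+ s :* x)) refl x p q r s ⟩
      ψ i * ψ j ∎
      where
      p = ι (c₀ i)
      q = ι (c₁ i)
      r = ι (c₀ j)
      s = ι (c₁ j)

-- Local rings with exactly two units of order greater than 2

module LinearCombination (R : FiniteCommRing) where
  open Arithmetic R

  -- Ideal-membership certificates: the coefficients `c` express `l - r` as a combination of the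
  -- hypotheses, so an equational deduction becomes one polynomial identity for `solve`.
  lin₁ : ∀ {l r p q} c → p ≡ q → l - r ≡ c * (p - q) → l ≡ r
  lin₁ {l} {r} {p} c refl eq = x-y≡0⇒x≡y l r
    (trans eq (solve 2 (λ c p → c :* (p :- p) := κ 0) refl c p))

  lin₂ : ∀ {l r p q p′ q′} c c′ → p ≡ q → p′ ≡ q′ → l - r ≡ c * (p - q) + c′ * (p′ - q′) → l ≡ r
  lin₂ {l} {r} {p} {_} {p′} c c′ refl refl eq = x-y≡0⇒x≡y l r
    (trans eq (solve 4 (λ c p c′ p′ → c :* (p :- p) :+ c′ :* (p′ :- p′) := κ 0) refl c p c′ p′))

  lin₃ : ∀ {l r p q p′ q′ p″ q″} c c′ c″ → p ≡ q → p′ ≡ q′ → p″ ≡ q″ →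
         l - r ≡ c * (p - q) + c′ * (p′ - q′) + c″ * (p″ - q″) → l ≡ r
  lin₃ {l} {r} {p} {_} {p′} {_} {p″} c c′ c″ refl refl refl eq = x-y≡0⇒x≡y l r
    (trans eq (solve 6 (λ c p c′ p′ c″ p″ → c :* (p :- p) :+ c′ :* (p′ :- p′) :+ c″ :* (p″ :- p″) := κ 0) refl c p c′ p′ c″ p″))

module Classification (B : FiniteCommRing) (local : IsLocal B)
  (a a⁻¹ : FiniteCommRing.Carrier B)
  (aa⁻¹≡1 : FiniteCommRing._*_ B a a⁻¹ ≡ FiniteCommRing.1# B)
  (aa≢1 : FiniteCommRing._*_ B a a ≢ FiniteCommRing.1# B)
  (few-units : ∀ v → IsUnit B v → FiniteCommRing._*_ B v v ≡ FiniteCommRing.1# B ⊎ v ≡ a ⊎ v ≡ a⁻¹) where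
  open Arithmetic B
  open LinearCombination B
  open LocalRing B local
  open Models B local

  Listed : Set
  Listed = RingIso 𝔽₄ B ⊎ RingIso ℤ₅ B ⊎ RingIso ℤ₂[x]/x³ B ⊎ RingIso ℤ₄[x]/⟨2x,x²-2⟩ B

  private
    𝟚 : Carrier
    𝟚 = ι 2

    a-unit : IsUnit B a
    a-unit = a⁻¹ , aa⁻¹≡1

    abstract
      unit-* : ∀ {u v} → IsUnit B u → IsUnit B v → IsUnit B (u * v)
      unit-* {u} {v} (u′ , uu′≡1) (v′ , vv′≡1) = u′ * v′ ,
        lin₂ (v * v′) 1# uu′≡1 vv′≡1
          (solve 4 (λ u v u′ v′ → (u :* v) :* (u′ :* v′) :- κ 1 := (v :* v′) :* (u :* u′ :- κ 1) :+ κ 1 :* (v :* v′ :- κ 1)) refl u v u′ v′)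

      unit-cancel : ∀ {u x} → IsUnit B u → x * u ≡ 0# → x ≡ 0#
      unit-cancel {u} {x} (v , uv≡1) xu≡0 = lin₂ v (- x) xu≡0 uv≡1
        (solve 3 (λ u v x → x :- κ 0 := v :* (x :* u :- κ 0) :+ :- x :* (u :* v :- κ 1)) refl u v x)

      1+nonunit : ∀ {x} → NonUnit x → IsUnit B (1# + x)
      1+nonunit {x} ¬x with isUnit? B (1# + x)
      ... | yes unit = unit
      ... | no ¬1+x = contradiction 1-unit (subst NonUnit
        (solve 1 (λ x → (κ 1 :+ x) :+ :- x := κ 1) refl x) (nonunit-+ ¬1+x (nonunit-neg ¬x)))

      -1-unit : IsUnit B (- 1#)
      -1-unit = - 1# , solve 0 (:- κ 1 :* :- κ 1 := κ 1) refl

    a≢0 : a ≢ 0#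
    a≢0 refl = 0-nonunit a-unit

    1+a≢1 : 1# + a ≢ 1#
    1+a≢1 eq = a≢0 (lin₁ 1# eq (solve 1 (λ a → a :- κ 0 := κ 1 :* ((κ 1 :+ a) :- κ 1)) refl a))

    1+a≢a : 1# + a ≢ a
    1+a≢a eq = 1≢0 (lin₁ 1# eq (solve 1 (λ a → κ 1 :- κ 0 := κ 1 :* ((κ 1 :+ a) :- a)) refl a))

    -1≢a : - 1# ≢ a
    -1≢a eq = aa≢1 (lin₁ (1# - a) eq
      (solve 1 (λ a → a :* a :- κ 1 := (κ 1 :- a) :* (:- κ 1 :- a)) refl a))

    1+a[1+a]≢aa : 1# + a * (1# + a) ≢ a * a
    1+a[1+a]≢aa eq = aa≢1 (lin₁ (a - 1#) eq
      (solve 1 (λ a → a :* a :- κ 1 := (a :- κ 1) :* ((κ 1 :+ a :* (κ 1 :+ a)) :- a :* a)) refl a))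

    -1≡1⇒2≡0 : - 1# ≡ 1# → 𝟚 ≡ 0#
    -1≡1⇒2≡0 eq = lin₁ (- 1#) eq
      (solve 0 (κ 2 :- κ 0 := :- κ 1 :* (:- κ 1 :- κ 1)) refl)

    powers : (∀ v → IsUnit B v → v ≡ 1# ⊎ v ≡ a ⊎ v ≡ a * a ⊎ v ≡ a * (a * a)) → PowersOf a
    powers list v unit with list v unit
    ... | inj₁ refl = 0 , refl
    ... | inj₂ (inj₁ refl) = 1 , solve 1 (λ a → a := a :* κ 1) refl a
    ... | inj₂ (inj₂ (inj₁ refl)) = 2 , solve 1 (λ a → a :* a := a :* (a :* κ 1)) refl a
    ... | inj₂ (inj₂ (inj₂ refl)) = 3 , solve 1 (λ a → a :* (a :* a) := a :* (a :* (a :* κ 1))) refl a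

    -- Multiplying a unit `v` with v² = 1 by `a` gives an element of U″, hence `a` or a⁻¹. So `v` is
    -- 1 or a⁻², and the whole unit group is {1 , a , a⁻¹ , a⁻²}.
    va-squared : ∀ {v} → v * v ≡ 1# → (v * a) * (v * a) ≢ 1#
    va-squared {v} vv≡1 eq = aa≢1 (lin₂ 1# (- (a * a)) eq vv≡1
      (solve 2 (λ a v → a :* a :- κ 1 := κ 1 :* ((v :* a) :* (v :* a) :- κ 1) :+ :- (a :* a) :* (v :* v :- κ 1)) refl a v))

  module Cube (aaa≡1 : a * (a * a) ≡ 1#) where

    a⁻¹≡aa : a⁻¹ ≡ a * a
    a⁻¹≡aa = lin₂ (a * a) (- a⁻¹) aa⁻¹≡1 aaa≡1
      (solve 2 (λ a b → b :- a :* a := (a :* a) :* (a :* b :- κ 1) :+ :- b :* (a :* (a :* a) :- κ 1)) refl a a⁻¹)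

    abstract
      units : ∀ v → IsUnit B v → v ≡ 1# ⊎ v ≡ a ⊎ v ≡ a * a
      units v unit with few-units v unit
      ... | inj₂ (inj₁ v≡a) = inj₂ (inj₁ v≡a)
      ... | inj₂ (inj₂ v≡a⁻¹) = inj₂ (inj₂ (trans v≡a⁻¹ a⁻¹≡aa))
      ... | inj₁ vv≡1 with few-units (v * a) (unit-* unit a-unit)
      ...   | inj₁ eq = contradiction eq (va-squared vv≡1)
      ...   | inj₂ (inj₁ va≡a) = inj₁ (lin₂ (a * a) (1# - v) va≡a aaa≡1
        (solve 2 (λ a v → v :- κ 1 := (a :* a) :* (v :* a :- a) :+ (κ 1 :- v) :* (a :* (a :* a) :- κ 1)) refl a v))
      ...   | inj₂ (inj₂ va≡a⁻¹) = inj₂ (inj₁ (lin₂ (a * a) (a - v) (trans va≡a⁻¹ a⁻¹≡aa) aaa≡1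
        (solve 2 (λ a v → v :- a := (a :* a) :* (v :* a :- a :* a) :+ (a :- v) :* (a :* (a :* a) :- κ 1)) refl a v)))

    2≡0 : 𝟚 ≡ 0#
    2≡0 with units (- 1#) -1-unit
    ... | inj₁ -1≡1 = -1≡1⇒2≡0 -1≡1
    ... | inj₂ (inj₁ -1≡a) = contradiction -1≡a -1≢a
    ... | inj₂ (inj₂ -1≡aa) = ⊥-elim (aa≢1 (lin₂ ((1# - a) * a) (1# - a) -1≡aa aaa≡1
      (solve 1 (λ a → a :* a :- κ 1 := ((κ 1 :- a) :* a) :* (:- κ 1 :- a :* a) :+ (κ 1 :- a) :* (a :* (a :* a) :- κ 1)) refl a)))

    -- If `1# + a` were a non-unit, then 1 + a(1 + a) would be a unit, and each of its three
    -- possible values would force a² = 1.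
    1+a≡aa : 1# + a ≡ a * a
    1+a≡aa with isUnit? B (1# + a)
    ... | yes unit with units (1# + a) unit
    ...   | inj₁ eq = contradiction eq 1+a≢1
    ...   | inj₂ (inj₁ eq) = contradiction eq 1+a≢a
    ...   | inj₂ (inj₂ eq) = eq
    1+a≡aa | no ¬unit with units (1# + a * (1# + a)) (1+nonunit (nonunit-* a ¬unit))
    ...   | inj₁ eq = ⊥-elim (aa≢1 (lin₂ ((a * a) * (a - 1#)) (1# - a * a) eq aaa≡1
      (solve 1 (λ a → a :* a :- κ 1 := ((a :* a) :* (a :- κ 1)) :* ((κ 1 :+ a :* (κ 1 :+ a)) :- κ 1) :+ (κ 1 :- a :* a) :* (a :* (a :* a) :- κ 1)) refl a)))
    ...   | inj₂ (inj₁ eq) = ⊥-elim (aa≢1 (lin₂ 1# (- 1#) eq 2≡0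
      (solve 1 (λ a → a :* a :- κ 1 := κ 1 :* ((κ 1 :+ a :* (κ 1 :+ a)) :- a) :+ :- κ 1 :* (κ 2 :- κ 0)) refl a)))
    ...   | inj₂ (inj₂ eq) = contradiction eq 1+a[1+a]≢aa

    powers-a : PowersOf a
    powers-a = powers λ v unit → include (units v unit)
      where
      include : ∀ {v} → v ≡ 1# ⊎ v ≡ a ⊎ v ≡ a * a → v ≡ 1# ⊎ v ≡ a ⊎ v ≡ a * a ⊎ v ≡ a * (a * a)
      include (inj₁ eq) = inj₁ eq
      include (inj₂ (inj₁ eq)) = inj₂ (inj₁ eq)
      include (inj₂ (inj₂ eq)) = inj₂ (inj₂ (inj₁ eq))

    classify : RingIso 𝔽₄ B
    classify = 𝔽₄-iso a 2≡0 (trans (sym 1+a≡aa) (+-comm 1# a)) powers-a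

  module Fourth (aaaa≡1 : (a * a) * (a * a) ≡ 1#) where

    a⁻¹≡aaa : a⁻¹ ≡ a * (a * a)
    a⁻¹≡aaa = lin₂ (a * (a * a)) (- a⁻¹) aa⁻¹≡1 aaaa≡1
      (solve 2 (λ a b → b :- a :* (a :* a) := (a :* (a :* a)) :* (a :* b :- κ 1) :+ :- b :* ((a :* a) :* (a :* a) :- κ 1)) refl a a⁻¹)

    abstract
      units : ∀ v → IsUnit B v → v ≡ 1# ⊎ v ≡ a ⊎ v ≡ a * a ⊎ v ≡ a * (a * a)
      units v unit with few-units v unit
      ... | inj₂ (inj₁ v≡a) = inj₂ (inj₁ v≡a)
      ... | inj₂ (inj₂ v≡a⁻¹) = inj₂ (inj₂ (inj₂ (trans v≡a⁻¹ a⁻¹≡aaa)))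
      ... | inj₁ vv≡1 with few-units (v * a) (unit-* unit a-unit)
      ...   | inj₁ eq = contradiction eq (va-squared vv≡1)
      ...   | inj₂ (inj₁ va≡a) = inj₁ (lin₂ (a * (a * a)) (1# - v) va≡a aaaa≡1
        (solve 2 (λ a v → v :- κ 1 := (a :* (a :* a)) :* (v :* a :- a) :+ (κ 1 :- v) :* ((a :* a) :* (a :* a) :- κ 1)) refl a v))
      ...   | inj₂ (inj₂ va≡a⁻¹) = inj₂ (inj₂ (inj₁ (lin₂ (a * (a * a)) (a * a - v) (trans va≡a⁻¹ a⁻¹≡aaa) aaaa≡1
        (solve 2 (λ a v → v :- a :* a := (a :* (a :* a)) :* (v :* a :- a :* (a :* a)) :+ (a :* a :- v) :* ((a :* a) :* (a :* a) :- κ 1)) refl a v))))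

    powers-a : PowersOf a
    powers-a = powers units

    x : Carrier
    x = a - 1#

    powers-1+x : PowersOf (1# + x)
    powers-1+x = subst PowersOf (solve 1 (λ a → a := κ 1 :+ (a :- κ 1)) refl a) powers-a

    -1≢aaa : - 1# ≢ a * (a * a)
    -1≢aaa eq = aa≢1 (lin₂ ((1# - a) * a) (1# - a) eq aaaa≡1
      (solve 1 (λ a → a :* a :- κ 1 := ((κ 1 :- a) :* a) :* (:- κ 1 :- a :* (a :* a)) :+ (κ 1 :- a) :* ((a :* a) :* (a :* a) :- κ 1)) refl a))

    module Char2 (2≡0 : 𝟚 ≡ 0#) (¬x : NonUnit x) where

      xxxx≡0 : (x * x) * (x * x) ≡ 0#
      xxxx≡0 = lin₂ 1# (1# - 𝟚 * (a * (a * a)) + ι 3 * (a * a) - 𝟚 * a) aaaa≡1 2≡0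
        (solve 1 (λ a → let x = a :- κ 1 in (x :* x) :* (x :* x) :- κ 0 := κ 1 :* ((a :* a) :* (a :* a) :- κ 1)
          :+ (κ 1 :- κ 2 :* (a :* (a :* a)) :+ κ 3 :* (a :* a) :- κ 2 :* a) :* (κ 2 :- κ 0)) refl a)

      xx≢0 : x * x ≢ 0#
      xx≢0 xx≡0 = aa≢1 (lin₂ 1# (a - 1#) xx≡0 2≡0
        (solve 1 (λ a → let x = a :- κ 1 in a :* a :- κ 1 := κ 1 :* (x :* x :- κ 0) :+ (a :- κ 1) :* (κ 2 :- κ 0)) refl a))

      -- As `x` is a non-unit, 1 + x³ is a unit. In characteristic 2 the values a, a², a³ mean x³ =
      -- x, x³ = x² and x + x² = 0; with x⁴ = 0 each of them gives x² = 0. Only the value 1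
      -- survives.
      xxx≡0 : x * (x * x) ≡ 0#
      xxx≡0 with units (1# + x * (x * x)) (1+nonunit (nonunit-* x (nonunit-* x ¬x)))
      ... | inj₁ eq = lin₁ 1# eq
        (solve 1 (λ x → x :* (x :* x) :- κ 0 := κ 1 :* ((κ 1 :+ x :* (x :* x)) :- κ 1)) refl x)
      ... | inj₂ (inj₁ eq) = ⊥-elim (xx≢0 (lin₂ (- x) 1# eq xxxx≡0
        (solve 1 (λ a → let x = a :- κ 1 in x :* x :- κ 0 := :- x :* ((κ 1 :+ x :* (x :* x)) :- a) :+ κ 1 :* ((x :* x) :* (x :* x) :- κ 0)) refl a)))
      ... | inj₂ (inj₂ (inj₁ eq)) = ⊥-elim (xx≢0 (lin₃ (- (1# + x)) 1# (- (x * (1# + x))) eq xxxx≡0 2≡0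
        (solve 1 (λ a → let x = a :- κ 1 in x :* x :- κ 0 := :- (κ 1 :+ x) :* ((κ 1 :+ x :* (x :* x)) :- a :* a) :+ κ 1 :* ((x :* x) :* (x :* x) :- κ 0)
          :+ :- (x :* (κ 1 :+ x)) :* (κ 2 :- κ 0)) refl a)))
      ... | inj₂ (inj₂ (inj₂ eq)) = ⊥-elim (xx≢0 (lin₃ (- (x - x * x)) 1# (- ((x - x * x) * (x + x * x))) eq xxxx≡0 2≡0
        (solve 1 (λ a → let x = a :- κ 1 in x :* x :- κ 0 := :- (x :- x :* x) :* ((κ 1 :+ x :* (x :* x)) :- a :* (a :* a)) :+ κ 1 :* ((x :* x) :* (x :* x) :- κ 0)
          :+ :- ((x :- x :* x) :* (x :+ x :* x)) :* (κ 2 :- κ 0)) refl a)))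

      classify : RingIso ℤ₂[x]/x³ B
      classify = ℤ₂[x]/x³-iso x 2≡0 xxx≡0 xx≢0 powers-1+x

    module Char4 (-1≡aa : - 1# ≡ a * a) (¬x : NonUnit x) (¬2 : NonUnit 𝟚) where

      2≢0 : 𝟚 ≢ 0#
      2≢0 2≡0 = aa≢1 (lin₂ (- 1#) (- 1#) -1≡aa 2≡0
        (solve 1 (λ a → a :* a :- κ 1 := :- κ 1 :* (:- κ 1 :- a :* a) :+ :- κ 1 :* (κ 2 :- κ 0)) refl a))

      -- The unit 1 - x = 2 - a is located among the powers of `a`. The value 1 gives a = 1, a³ = -a
      -- gives 2 = 0, and a² = -1 gives a = 3, hence 10 = 2(1 + 4) = 0 with 1 + 4 a unit, so again 2
      -- = 0. The value `a` is the claim.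
      2x≡0 : 𝟚 * x ≡ 0#
      2x≡0 with units (1# + - x) (1+nonunit (nonunit-neg ¬x))
      ... | inj₁ eq = ⊥-elim (aa≢1 (lin₁ (- (a + 1#)) eq
        (solve 1 (λ a → let x = a :- κ 1 in a :* a :- κ 1 := :- (a :+ κ 1) :* ((κ 1 :+ :- x) :- κ 1)) refl a)))
      ... | inj₂ (inj₁ eq) = lin₁ (- 1#) eq
        (solve 1 (λ a → let x = a :- κ 1 in κ 2 :* x :- κ 0 := :- κ 1 :* ((κ 1 :+ :- x) :- a)) refl a)
      ... | inj₂ (inj₂ (inj₁ eq)) = contradiction (unit-cancel (1+nonunit (nonunit-* 𝟚 ¬2)) 10≡0) 2≢0
        where
        10≡0 : 𝟚 * (1# + 𝟚 * 𝟚) ≡ 0#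
        10≡0 = lin₂ (ι 3 + a) (- (ι 4 + a)) eq -1≡aa
          (solve 1 (λ a → let x = a :- κ 1 in κ 2 :* (κ 1 :+ κ 2 :* κ 2) :- κ 0
            := (κ 3 :+ a) :* ((κ 1 :+ :- x) :- a :* a) :+ :- (κ 4 :+ a) :* (:- κ 1 :- a :* a)) refl a)
      ... | inj₂ (inj₂ (inj₂ eq)) = ⊥-elim (2≢0 (lin₂ 1# (- a) eq -1≡aa
        (solve 1 (λ a → let x = a :- κ 1 in κ 2 :- κ 0 := κ 1 :* ((κ 1 :+ :- x) :- a :* (a :* a)) :+ :- a :* (:- κ 1 :- a :* a)) refl a)))

      4≡0 : ι 4 ≡ 0#
      4≡0 = lin₂ (- 𝟚) (- 𝟚 - x) -1≡aa 2x≡0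
        (solve 1 (λ a → let x = a :- κ 1 in κ 4 :- κ 0 := :- κ 2 :* (:- κ 1 :- a :* a) :+ (:- κ 2 :- x) :* (κ 2 :* x :- κ 0)) refl a)

      xx≡2 : x * x ≡ 𝟚
      xx≡2 = lin₂ 1# (1# + x) -1≡aa 2x≡0
        (solve 1 (λ a → let x = a :- κ 1 in x :* x :- κ 2 := κ 1 :* (:- κ 1 :- a :* a) :+ (κ 1 :+ x) :* (κ 2 :* x :- κ 0)) refl a)

      classify : RingIso ℤ₄[x]/⟨2x,x²-2⟩ B
      classify = ℤ₄[x]/⟨2x,x²-2⟩-iso x 4≡0 2≢0 2x≡0 xx≡2 powers-1+x

    module Field (t-unit : IsUnit B (a * a - 1#)) where

      aa+1≡0 : a * a + 1# ≡ 0#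
      aa+1≡0 = unit-cancel t-unit (lin₁ 1# aaaa≡1
        (solve 1 (λ a → (a :* a :+ κ 1) :* (a :* a :- κ 1) :- κ 0 := κ 1 :* ((a :* a) :* (a :* a) :- κ 1)) refl a))

      2-unit : IsUnit B 𝟚
      2-unit = let (s , ts≡1) = t-unit in - s , lin₂ 1# (- s) ts≡1 aa+1≡0
        (solve 2 (λ a s → κ 2 :* :- s :- κ 1 := κ 1 :* ((a :* a :- κ 1) :* s :- κ 1) :+ :- s :* ((a :* a :+ κ 1) :- κ 0)) refl a s)

      1+a-unit : IsUnit B (1# + a)
      1+a-unit = let (s , 2s≡1) = 2-unit in (1# - a) * s , lin₂ 1# (- s) 2s≡1 aa+1≡0
        (solve 2 (λ a s → (κ 1 :+ a) :* ((κ 1 :- a) :* s) :- κ 1 := κ 1 :* (κ 2 :* s :- κ 1) :+ :- s :* ((a :* a :+ κ 1) :- κ 0)) refl a s)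

      -- Otherwise the unit 1 + a, which is neither 1 nor a, would be a² = 2 or a³ = 2a, and both
      -- give a = 1.
      2≢aa : 𝟚 ≢ a * a
      2≢aa 2≡aa with units (1# + a) 1+a-unit
      ... | inj₁ eq = 1+a≢1 eq
      ... | inj₂ (inj₁ eq) = 1+a≢a eq
      ... | inj₂ (inj₂ (inj₁ eq)) = aa≢1 (lin₂ (a + 1#) (- (a + 1#)) eq 2≡aa
        (solve 1 (λ a → a :* a :- κ 1 := (a :+ κ 1) :* ((κ 1 :+ a) :- a :* a) :+ :- (a :+ κ 1) :* (κ 2 :- a :* a)) refl a))
      ... | inj₂ (inj₂ (inj₂ eq)) = aa≢1 (lin₂ (- (a + 1#)) ((a + 1#) * a) eq 2≡aa
        (solve 1 (λ a → a :* a :- κ 1 := :- (a :+ κ 1) :* ((κ 1 :+ a) :- a :* (a :* a)) :+ ((a :+ κ 1) :* a) :* (κ 2 :- a :* a)) refl a))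

      2-cases : 𝟚 ≡ a ⊎ 𝟚 ≡ a * (a * a)
      2-cases with units 𝟚 2-unit
      ... | inj₁ eq = ⊥-elim (1≢0 (lin₁ 1# eq
        (solve 0 (κ 1 :- κ 0 := κ 1 :* (κ 2 :- κ 1)) refl)))
      ... | inj₂ (inj₁ 2≡a) = inj₁ 2≡a
      ... | inj₂ (inj₂ (inj₁ 2≡aa)) = contradiction 2≡aa 2≢aa
      ... | inj₂ (inj₂ (inj₂ 2≡aaa)) = inj₂ 2≡aaa

      2≡a⇒ℤ₅ : 𝟚 ≡ a → RingIso ℤ₅ B
      2≡a⇒ℤ₅ 2≡a = ℤ₅-iso 5≡0 (F.# 2) (subst PowersOf (sym 2≡a) powers-a)
        where
        5≡0 : ι 5 ≡ 0#
        5≡0 = lin₂ (𝟚 + a) 1# 2≡a aa+1≡0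
          (solve 1 (λ a → κ 5 :- κ 0 := (κ 2 :+ a) :* (κ 2 :- a) :+ κ 1 :* ((a :* a :+ κ 1) :- κ 0)) refl a)

      2≡aaa⇒ℤ₅ : 𝟚 ≡ a * (a * a) → RingIso ℤ₅ B
      2≡aaa⇒ℤ₅ 2≡aaa = ℤ₅-iso 5≡0 (F.# 3) (subst PowersOf a≡3 powers-a)
        where
        5≡0 : ι 5 ≡ 0#
        5≡0 = lin₂ (𝟚 + a * (a * a)) ((a * a) * (a * a) - a * a + 1#) 2≡aaa aa+1≡0
          (solve 1 (λ a → κ 5 :- κ 0 := (κ 2 :+ a :* (a :* a)) :* (κ 2 :- a :* (a :* a))
            :+ ((a :* a) :* (a :* a) :- a :* a :+ κ 1) :* ((a :* a :+ κ 1) :- κ 0)) refl a)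
        a≡3 : a ≡ ι 3
        a≡3 = lin₃ 1# a (- 1#) 2≡aaa aa+1≡0 5≡0
          (solve 1 (λ a → a :- κ 3 := κ 1 :* (κ 2 :- a :* (a :* a)) :+ a :* ((a :* a :+ κ 1) :- κ 0) :+ :- κ 1 :* (κ 5 :- κ 0)) refl a)

      classify : RingIso ℤ₅ B
      classify = [ 2≡a⇒ℤ₅ , 2≡aaa⇒ℤ₅ ] 2-cases

    -- Since a² - 1 = (a + 1)x, it suffices that a + 1 is a unit. If neither it nor a² - 1 is one,
    -- the unit 1 + a(1 + a) is a power of `a`: the values 1 and a² give a² = 1, while a and a³
    -- exhibit `x` as a combination of these non-units.
    x-unit⇒t-unit : IsUnit B x → IsUnit B (a * a - 1#)
    x-unit⇒t-unit x-unit with isUnit? B (a * a - 1#) | isUnit? B (a + 1#)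
    ... | yes t-unit | _ = t-unit
    ... | no ¬t | yes a+1-unit = contradiction
      (subst (IsUnit B) (solve 1 (λ a → (a :+ κ 1) :* (a :- κ 1) := a :* a :- κ 1) refl a) (unit-* a+1-unit x-unit))
      ¬t
    ... | no ¬t | no ¬a+1 with units (1# + a * (1# + a)) (1+nonunit (nonunit-* a (subst NonUnit (+-comm a 1#) ¬a+1)))
    ...   | inj₁ eq = ⊥-elim (aa≢1 (lin₂ ((a * (a * a)) * (a - 1#)) (1# - a * a) eq aaaa≡1
      (solve 1 (λ a → a :* a :- κ 1 := ((a :* (a :* a)) :* (a :- κ 1)) :* ((κ 1 :+ a :* (κ 1 :+ a)) :- κ 1) :+ (κ 1 :- a :* a) :* ((a :* a) :* (a :* a) :- κ 1)) refl a)))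
    ...   | inj₂ (inj₁ eq) = contradiction x-unit (subst NonUnit (lin₁ 1# eq
      (solve 1 (λ a → ((a :+ κ 1) :+ (a :* a :- κ 1)) :- (a :- κ 1) := κ 1 :* ((κ 1 :+ a :* (κ 1 :+ a)) :- a)) refl a))
      (nonunit-+ ¬a+1 ¬t))
    ...   | inj₂ (inj₂ (inj₁ eq)) = contradiction eq 1+a[1+a]≢aa
    ...   | inj₂ (inj₂ (inj₂ eq)) = contradiction x-unit (subst NonUnit (lin₁ 1# eq
      (solve 1 (λ a → ((κ 2 :* a :- a :* a) :* (a :+ κ 1)) :- (a :- κ 1) := κ 1 :* ((κ 1 :+ a :* (κ 1 :+ a)) :- a :* (a :* a))) refl a))
      (nonunit-* (𝟚 * a - a * a) ¬a+1))

    -- If 2 were a power of `a`, then 1 = 2 - 1 would be a power of `a` minus 1, hence a multiple of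
    -- the non-unit `x`.
    x-nonunit⇒2-nonunit : NonUnit x → NonUnit 𝟚
    x-nonunit⇒2-nonunit ¬x 2-unit with units 𝟚 2-unit
    ... | inj₁ eq = 1≢0 (lin₁ 1# eq (solve 0 (κ 1 :- κ 0 := κ 1 :* (κ 2 :- κ 1)) refl))
    ... | inj₂ (inj₁ eq) = subst NonUnit (lin₁ (- 1#) eq
      (solve 1 (λ a → (a :- κ 1) :- κ 1 := :- κ 1 :* (κ 2 :- a)) refl a)) ¬x 1-unit
    ... | inj₂ (inj₂ (inj₁ eq)) = subst NonUnit (lin₁ (- 1#) eq
      (solve 1 (λ a → (a :+ κ 1) :* (a :- κ 1) :- κ 1 := :- κ 1 :* (κ 2 :- a :* a)) refl a))
      (nonunit-* (a + 1#) ¬x) 1-unit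
    ... | inj₂ (inj₂ (inj₂ eq)) = subst NonUnit (lin₁ (- 1#) eq
      (solve 1 (λ a → (a :* a :+ a :+ κ 1) :* (a :- κ 1) :- κ 1 := :- κ 1 :* (κ 2 :- a :* (a :* a))) refl a))
      (nonunit-* (a * a + a + 1#) ¬x) 1-unit

    cases : IsUnit B x ⊎ (NonUnit x × 𝟚 ≡ 0#) ⊎ (NonUnit x × - 1# ≡ a * a)
    cases with isUnit? B x
    ... | yes x-unit = inj₁ x-unit
    ... | no ¬x with units (- 1#) -1-unit
    ...   | inj₁ -1≡1 = inj₂ (inj₁ (¬x , -1≡1⇒2≡0 -1≡1))
    ...   | inj₂ (inj₁ -1≡a) = contradiction -1≡a -1≢a
    ...   | inj₂ (inj₂ (inj₁ -1≡aa)) = inj₂ (inj₂ (¬x , -1≡aa))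
    ...   | inj₂ (inj₂ (inj₂ -1≡aaa)) = contradiction -1≡aaa -1≢aaa

    classify : Listed
    classify = [ (λ x-unit → inj₂ (inj₁ (Field.classify (x-unit⇒t-unit x-unit))))
               , [ (λ (¬x , 2≡0) → inj₂ (inj₂ (inj₁ (Char2.classify 2≡0 ¬x))))
                 , (λ (¬x , -1≡aa) → inj₂ (inj₂ (inj₂ (Char4.classify -1≡aa ¬x (x-nonunit⇒2-nonunit ¬x))))) ] ] cases

  -- The unit a² is itself subject to `few-units`: a² = a is absurd, a² = a⁻¹ gives order 3, and
  -- otherwise a⁴ = 1.
  order : a * (a * a) ≡ 1# ⊎ (a * a) * (a * a) ≡ 1#
  order with few-units (a * a) (unit-* a-unit a-unit)
  ... | inj₁ aaaa≡1 = inj₂ aaaa≡1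
  ... | inj₂ (inj₁ aa≡a) = ⊥-elim (aa≢1 (lin₁ (a + 1#) a≡1
      (solve 1 (λ a → a :* a :- κ 1 := (a :+ κ 1) :* (a :- κ 1)) refl a)))
    where
    a≡1 : a ≡ 1#
    a≡1 = lin₂ a⁻¹ (1# - a) aa≡a aa⁻¹≡1
      (solve 2 (λ a b → a :- κ 1 := b :* (a :* a :- a) :+ (κ 1 :- a) :* (a :* b :- κ 1)) refl a a⁻¹)
  ... | inj₂ (inj₂ aa≡a⁻¹) = inj₁ (trans (cong (a *_) aa≡a⁻¹) aa⁻¹≡1)

  classify : Listed
  classify = [ (λ aaa≡1 → inj₁ (Cube.classify aaa≡1)) , Fourth.classify ] order

-- Replacing and exchanging the two factors of a decomposition

module Inverse {A B : FiniteCommRing} (iso : RingIso A B) where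
  open RingIso iso
  private
    module A = Arithmetic A
    module B = Arithmetic B

  ψ⁻¹ : B.Carrier → A.Carrier
  ψ⁻¹ y = proj₁ (ψ-surjective y)

  ψψ⁻¹ : ∀ y → ψ (ψ⁻¹ y) ≡ y
  ψψ⁻¹ y = proj₂ (ψ-surjective y)

  ψ⁻¹ψ : ∀ x → ψ⁻¹ (ψ x) ≡ x
  ψ⁻¹ψ x = ψ-injective (ψψ⁻¹ (ψ x))

  ψ⁻¹-injective : ∀ {x y} → ψ⁻¹ x ≡ ψ⁻¹ y → x ≡ y
  ψ⁻¹-injective eq = trans (sym (ψψ⁻¹ _)) (trans (cong ψ eq) (ψψ⁻¹ _))

  ψ⁻¹-+ : ∀ x y → ψ⁻¹ (x B.+ y) ≡ ψ⁻¹ x A.+ ψ⁻¹ y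
  ψ⁻¹-+ x y = ψ-injective (trans (ψψ⁻¹ _) (sym (trans (ψ-+ _ _) (cong₂ B._+_ (ψψ⁻¹ x) (ψψ⁻¹ y)))))

  ψ⁻¹-* : ∀ x y → ψ⁻¹ (x B.* y) ≡ ψ⁻¹ x A.* ψ⁻¹ y
  ψ⁻¹-* x y = ψ-injective (trans (ψψ⁻¹ _) (sym (trans (ψ-* _ _) (cong₂ B._*_ (ψψ⁻¹ x) (ψψ⁻¹ y)))))

  ψ⁻¹-1 : ψ⁻¹ B.1# ≡ A.1#
  ψ⁻¹-1 = ψ-injective (trans (ψψ⁻¹ _) (sym ψ-1))

module _ {R : FiniteCommRing} {Rs : Fin 2 → FiniteCommRing} (iso : IsoToProduct R 2 Rs) where
  open IsoToProduct iso

  replace-factors : ∀ {A C} → RingIso A (Rs F.zero) → RingIso C (Rs (F.suc F.zero)) → IsoToProduct R 2 (pair A C)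
  replace-factors {A} {C} isoA isoC = record
    { φ = φ′
    ; φ-+ = λ { x y F.zero → trans (cong IA.ψ⁻¹ (φ-+ x y _)) (IA.ψ⁻¹-+ _ _)
              ; x y (F.suc F.zero) → trans (cong IC.ψ⁻¹ (φ-+ x y _)) (IC.ψ⁻¹-+ _ _) }
    ; φ-* = λ { x y F.zero → trans (cong IA.ψ⁻¹ (φ-* x y _)) (IA.ψ⁻¹-* _ _)
              ; x y (F.suc F.zero) → trans (cong IC.ψ⁻¹ (φ-* x y _)) (IC.ψ⁻¹-* _ _) }
    ; φ-1 = λ { F.zero → trans (cong IA.ψ⁻¹ (φ-1 _)) IA.ψ⁻¹-1
              ; (F.suc F.zero) → trans (cong IC.ψ⁻¹ (φ-1 _)) IC.ψ⁻¹-1 }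
    ; injective = λ x y eq → injective x y λ
        { F.zero → IA.ψ⁻¹-injective (eq F.zero)
        ; (F.suc F.zero) → IC.ψ⁻¹-injective (eq (F.suc F.zero)) }
    ; surjective = λ g → let (x , φx≡g) = surjective (λ { F.zero → RingIso.ψ isoA (g F.zero) ; (F.suc F.zero) → RingIso.ψ isoC (g (F.suc F.zero)) }) in
        x , λ { F.zero → trans (cong IA.ψ⁻¹ (φx≡g F.zero)) (IA.ψ⁻¹ψ _)
              ; (F.suc F.zero) → trans (cong IC.ψ⁻¹ (φx≡g (F.suc F.zero))) (IC.ψ⁻¹ψ _) }
    }
    where
    module IA = Inverse isoA
    module IC = Inverse isoC
    φ′ : FiniteCommRing.Carrier R → (i : Fin 2) → FiniteCommRing.Carrier (pair A C i)
    φ′ x F.zero = IA.ψ⁻¹ (φ x F.zero)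
    φ′ x (F.suc F.zero) = IC.ψ⁻¹ (φ x (F.suc F.zero))

  swap-factors : IsoToProduct R 2 (pair (Rs (F.suc F.zero)) (Rs F.zero))
  swap-factors = record
    { φ = φ′
    ; φ-+ = λ { x y F.zero → φ-+ x y _ ; x y (F.suc F.zero) → φ-+ x y _ }
    ; φ-* = λ { x y F.zero → φ-* x y _ ; x y (F.suc F.zero) → φ-* x y _ }
    ; φ-1 = λ { F.zero → φ-1 _ ; (F.suc F.zero) → φ-1 _ }
    ; injective = λ x y eq → injective x y λ { F.zero → eq (F.suc F.zero) ; (F.suc F.zero) → eq F.zero }
    ; surjective = λ g → let (x , φx≡g) = surjective (λ { F.zero → g (F.suc F.zero) ; (F.suc F.zero) → g F.zero }) in
        x , λ { F.zero → φx≡g (F.suc F.zero) ; (F.suc F.zero) → φx≡g F.zero }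
    }
    where
    φ′ : FiniteCommRing.Carrier R → (i : Fin 2) → FiniteCommRing.Carrier (pair (Rs (F.suc F.zero)) (Rs F.zero) i)
    φ′ x F.zero = φ x (F.suc F.zero)
    φ′ x (F.suc F.zero) = φ x F.zero

-- |U″(R)| = 2, since U″(R) is nonempty and closed under u ↦ u⁻¹ ≠ u.
OnePair : FiniteCommRing → Set
OnePair R = ∀ u v → IsUnit R u → IsUnit R v → u * u ≡ 1# ⊎ v * v ≡ 1# ⊎ v ≡ u ⊎ u * v ≡ 1#
  where open Arithmetic R

onePair? : ∀ R → Dec (OnePair R)
onePair? R = all? λ u → all? λ v → isUnit? R u →-dec (isUnit? R v →-dec
    ((u * u F.≟ 1#) ⊎-dec ((v * v F.≟ 1#) ⊎-dec ((v F.≟ u) ⊎-dec (u * v F.≟ 1#)))))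
  where open Arithmetic R

module _ {R : FiniteCommRing} {Rs : Fin 2 → FiniteCommRing} (locals : ∀ i → IsLocal (Rs i)) (iso : IsoToProduct R 2 Rs) where
  open Arithmetic R
  open IsoToProduct iso
  private
    module A = Arithmetic (Rs F.zero)
    module B = Arithmetic (Rs (F.suc F.zero))

    first : Carrier → A.Carrier
    first x = φ x F.zero

    second : Carrier → B.Carrier
    second x = φ x (F.suc F.zero)

    ext : ∀ {x y} → first x ≡ first y → second x ≡ second y → x ≡ y
    ext p q = injective _ _ λ { F.zero → p ; (F.suc F.zero) → q }

    combine : ∀ a b → ∃ λ x → first x ≡ a × second x ≡ b
    combine a b = let (x , eq) = surjective (λ { F.zero → a ; (F.suc F.zero) → b }) in x , eq F.zero , eq (F.suc F.zero)

    product≡1 : ∀ {x y} → first x A.* first y ≡ A.1# → second x B.* second y ≡ B.1# → x * y ≡ 1#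
    product≡1 p q = ext (trans (φ-* _ _ _) (trans p (sym (φ-1 _)))) (trans (φ-* _ _ _) (trans q (sym (φ-1 _))))

    first-1 : ∀ {x y} → x * y ≡ 1# → first x A.* first y ≡ A.1#
    first-1 eq = trans (sym (φ-* _ _ _)) (trans (cong first eq) (φ-1 _))

    unit⁺ : ∀ {x} → IsUnit (Rs F.zero) (first x) → IsUnit (Rs (F.suc F.zero)) (second x) → IsUnit R x
    unit⁺ (a , p) (b , q) = let (y , y₁ , y₂) = combine a b in
      y , product≡1 (trans (cong (_ A.*_) y₁) p) (trans (cong (_ B.*_) y₂) q)

  onePair⇒listed₁ : OnePair R → ∀ w → IsUnit R w → first w A.* first w ≢ A.1# → IsListedRing R
  onePair⇒listed₁ onePair w w-unit@(w′ , ww′≡1) aa≢1 =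
    [ (λ i → inj₁ (replace i))
    , [ (λ i → inj₂ (inj₁ (replace i)))
      , [ (λ i → inj₂ (inj₂ (inj₁ (replace i))))
        , (λ i → inj₂ (inj₂ (inj₂ (replace i)))) ] ] ]
    (Classification.classify (Rs F.zero) (locals F.zero) (first w) (first w′) (first-1 ww′≡1) aa≢1 few-units)
    where
    ww≢1 : w * w ≢ 1#
    ww≢1 ww≡1 = aa≢1 (first-1 ww≡1)

    U″-elements : ∀ v → IsUnit R v → v * v ≡ 1# ⊎ v ≡ w ⊎ w * v ≡ 1#
    U″-elements v v-unit with onePair w v w-unit v-unit
    ... | inj₁ ww≡1 = contradiction ww≡1 ww≢1
    ... | inj₂ rest = rest

    -- The unit (w₁ , c) lies in U″ by its first coordinate, so it is `w` or w⁻¹. Since w₁² ≠ 1 it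
    -- is not w⁻¹, and `c` is the second coordinate of `w`.
    second-units : ∀ c → IsUnit (Rs (F.suc F.zero)) c → c ≡ second w
    second-units c c-unit with combine (first w) c
    ... | y , y₁ , refl with U″-elements y (unit⁺ (first w′ , trans (cong (A._* first w′) y₁) (first-1 ww′≡1)) c-unit)
    ...   | inj₁ yy≡1 = contradiction (trans (cong₂ A._*_ (sym y₁) (sym y₁)) (first-1 yy≡1)) aa≢1
    ...   | inj₂ (inj₁ refl) = refl
    ...   | inj₂ (inj₂ wy≡1) = contradiction (trans (cong (first w A.*_) (sym y₁)) (first-1 wy≡1)) aa≢1

    module L = LocalRing (Rs (F.suc F.zero)) (locals (F.suc F.zero))

    second-unit≡1 : ∀ c → IsUnit (Rs (F.suc F.zero)) c → c ≡ B.1#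
    second-unit≡1 c c-unit = trans (second-units c c-unit) (sym (second-units B.1# L.1-unit))

    few-units : ∀ v → IsUnit (Rs F.zero) v → v A.* v ≡ A.1# ⊎ v ≡ first w ⊎ v ≡ first w′
    few-units v v-unit with combine v B.1#
    ... | y , refl , y₂ with U″-elements y (unit⁺ v-unit (subst (IsUnit (Rs (F.suc F.zero))) (sym y₂) L.1-unit))
    ...   | inj₁ yy≡1 = inj₁ (first-1 yy≡1)
    ...   | inj₂ (inj₁ refl) = inj₂ (inj₁ refl)
    ...   | inj₂ (inj₂ wy≡1) = inj₂ (inj₂ (cong first (trans (sym (*-identityʳ y)) (trans (cong (y *_) (sym ww′≡1))
      (trans (solve 3 (λ y w w′ → y :* (w :* w′) := (w :* y) :* w′) refl y w w′) (trans (cong (_* w′) wy≡1) (*-identityˡ w′)))))))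

    2≡0 : B.ι 2 ≡ B.0#
    2≡0 = trans (cong (B.1# B.+_) (sym (second-unit≡1 (B.- B.1#) (B.- B.1# ,
      B.solve 0 (B.:- B.κ 1 B.:* B.:- B.κ 1 B.:= B.κ 1) refl)))) (B.-‿inverseʳ B.1#)

    replace : ∀ {A} → RingIso A (Rs F.zero) → IsoToProduct R 2 (pair A ℤ₂)
    replace i = replace-factors iso i (Models.ℤ₂-iso (Rs (F.suc F.zero)) (locals (F.suc F.zero)) 2≡0 (λ c c-unit → 0 , second-unit≡1 c c-unit))

-- From w² ≠ 1 it follows that some coordinate of `w` has a square other than 1; if it is the second
-- one, the factors are exchanged.
onePair⇒listed : ∀ {R Rs} → (∀ i → IsLocal (Rs i)) → IsoToProduct R 2 Rs → U''NonEmpty R → OnePair R → IsListedRing R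
onePair⇒listed {R} {Rs} locals iso (w , w-unit , ww≢1) onePair =
  [ onePair⇒listed₁ locals iso onePair w w-unit
  , onePair⇒listed₁ {Rs = pair (Rs (F.suc F.zero)) (Rs F.zero)} (λ { F.zero → locals _ ; (F.suc F.zero) → locals _ }) (swap-factors iso) onePair w w-unit ]
  cases
  where
  open IsoToProduct iso
  module A = FiniteCommRing (Rs F.zero)
  module B = FiniteCommRing (Rs (F.suc F.zero))
  cases : (φ w F.zero A.* φ w F.zero) ≢ A.1#
        ⊎ (φ w (F.suc F.zero) B.* φ w (F.suc F.zero)) ≢ B.1#
  cases with (φ w F.zero A.* φ w F.zero) F.≟ A.1#
  ... | no aa≢1 = inj₁ aa≢1
  ... | yes aa≡1 = inj₂ λ bb≡1 → ww≢1 (injective _ _ λ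
    { F.zero → trans (φ-* w w _) (trans aa≡1 (sym (φ-1 _)))
    ; (F.suc F.zero) → trans (φ-* w w _) (trans bb≡1 (sym (φ-1 _))) })

module _ {R A : FiniteCommRing} (iso : IsoToProduct R 2 (pair A ℤ₂)) where
  open Arithmetic R
  open IsoToProduct iso
  private
    module A = Arithmetic A

    ℤ₂-unit≡1 : ∀ x → IsUnit ℤ₂ x → x ≡ FiniteCommRing.1# ℤ₂
    ℤ₂-unit≡1 = from-yes (all? λ x → isUnit? ℤ₂ x →-dec (x F.≟ FiniteCommRing.1# ℤ₂))

    unit⁻ : ∀ {x} → IsUnit R x → ∀ i → IsUnit (pair A ℤ₂ i) (φ x i)
    unit⁻ (y , xy≡1) i = φ y i , trans (sym (φ-* _ _ i)) (trans (cong (λ z → φ z i) xy≡1) (φ-1 i))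

    second≡1 : ∀ {x} → IsUnit R x → φ x (F.suc F.zero) ≡ FiniteCommRing.1# ℤ₂
    second≡1 unit = ℤ₂-unit≡1 _ (unit⁻ unit (F.suc F.zero))

    product≡1 : ∀ {x y} → IsUnit R x → IsUnit R y → φ x F.zero A.* φ y F.zero ≡ A.1# → x * y ≡ 1#
    product≡1 x-unit y-unit eq = injective _ _ λ
      { F.zero → trans (φ-* _ _ _) (trans eq (sym (φ-1 _)))
      ; (F.suc F.zero) → trans (φ-* _ _ _) (trans (cong₂ (FiniteCommRing._*_ ℤ₂) (second≡1 x-unit) (second≡1 y-unit)) (sym (φ-1 _))) }

  onePair-× : OnePair A → OnePair R
  onePair-× onePair u v u-unit v-unit
    with onePair (φ u F.zero) (φ v F.zero) (unit⁻ u-unit F.zero) (unit⁻ v-unit F.zero)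
  ... | inj₁ uu≡1 = inj₁ (product≡1 u-unit u-unit uu≡1)
  ... | inj₂ (inj₁ vv≡1) = inj₂ (inj₁ (product≡1 v-unit v-unit vv≡1))
  ... | inj₂ (inj₂ (inj₁ v≡u)) = inj₂ (inj₂ (inj₁ (injective _ _ λ
    { F.zero → v≡u ; (F.suc F.zero) → trans (second≡1 v-unit) (sym (second≡1 u-unit)) })))
  ... | inj₂ (inj₂ (inj₂ uv≡1)) = inj₂ (inj₂ (inj₂ (product≡1 u-unit v-unit uv≡1)))

-- The first factors have at most eight elements, so the property is decided there by exhaustion; ℤ₂
-- has a single unit, so it passes to the product.
listed⇒onePair : ∀ R → IsListedRing R → OnePair R
listed⇒onePair R =
  [ (λ i → onePair-× i (from-yes (onePair? 𝔽₄)))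
  , [ (λ i → onePair-× i (from-yes (onePair? ℤ₅)))
    , [ (λ i → onePair-× i (from-yes (onePair? ℤ₂[x]/x³)))
      , (λ i → onePair-× i (from-yes (onePair? ℤ₄[x]/⟨2x,x²-2⟩))) ] ] ]

-- Independent sets of the strong resolving graph

length-cartesianProduct : ∀ {A B : Set} (xs : List A) (ys : List B) →
                          length (cartesianProduct xs ys) ≡ length xs ℕ.* length ys
length-cartesianProduct [] ys = refl
length-cartesianProduct (x ∷ xs) ys = trans (length-++ (map (x ,_) ys))
  (cong₂ ℕ._+_ (length-map (x ,_) ys) (length-cartesianProduct xs ys))

module _ {A : Set} {x y z : A} where

  ∈-singleton : z ∈ x ∷ [] → z ≡ x ⊎ z ≡ y
  ∈-singleton (here z≡x) = inj₁ z≡x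

  ∈-doubleton : z ∈ x ∷ y ∷ [] → z ≡ x ⊎ z ≡ y
  ∈-doubleton (here z≡x) = inj₁ z≡x
  ∈-doubleton (there (here z≡y)) = inj₂ z≡y

module IndependentSets (R : FiniteCommRing) (m : ℕ) (boolean : BooleanIdempotents R (2 ℕ.+ m)) (U″ : U''NonEmpty R) where
  open Arithmetic R
  open BooleanIdempotents boolean

  ε₀≢1 : ε F.zero ≢ 1#
  ε₀≢1 ε₀≡1 = ε≢0 (F.suc F.zero) (begin
    ε (F.suc F.zero)               ≡⟨ sym (*-identityˡ _) ⟩
    1# * ε (F.suc F.zero)          ≡⟨ cong (_* ε (F.suc F.zero)) (sym ε₀≡1) ⟩
    ε F.zero * ε (F.suc F.zero)    ≡⟨ ε-orthogonal (λ ()) ⟩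
    0#                             ∎)
    where open ≡-Reasoning

  open StrongResolvingGraph R (ε F.zero) (ε-idempotent F.zero) (ε≢0 F.zero) ε₀≢1 U″ public
  open Complement (F._≟_ {size})
  module P = Complement (≡-dec (F._≟_ {size}) (F._≟_ {size}))
  open DecMembership (≡-dec (F._≟_ {size}) (F._≟_ {size})) using (_∈?_)

  unitList : List Carrier
  unitList = filter (isUnit? R) (allFin size)

  nonzeroIdempotents properIdempotents : List Carrier
  nonzeroIdempotents = idempotents ∖ (0# ∷ [])
  properIdempotents = idempotents ∖ (0# ∷ 1# ∷ [])

  nonzeroIdempotents-unique : Unique nonzeroIdempotents
  nonzeroIdempotents-unique = ∖-unique (0# ∷ []) idempotents-unique

  properIdempotents-unique : Unique properIdempotents
  properIdempotents-unique = ∖-unique (0# ∷ 1# ∷ []) idempotents-unique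

  ∈-nonzero⁺ : ∀ {e} → e * e ≡ e → e ≢ 0# → e ∈ nonzeroIdempotents
  ∈-nonzero⁺ ee≡e e≢0 = ∈-∖⁺ idempotents (0# ∷ []) (idempotents-complete ee≡e) λ { (here e≡0) → e≢0 e≡0 }

  ∈-nonzero⁻ : ∀ {e} → e ∈ nonzeroIdempotents → e * e ≡ e × e ≢ 0#
  ∈-nonzero⁻ e∈ = let (e∈I , e∉) = ∈-∖⁻ idempotents (0# ∷ []) e∈ in
    idempotents-sound e∈I , λ e≡0 → e∉ (here e≡0)

  ∈-proper⁺ : ∀ {e} → e * e ≡ e → e ≢ 0# → e ≢ 1# → e ∈ properIdempotents
  ∈-proper⁺ ee≡e e≢0 e≢1 = ∈-∖⁺ idempotents (0# ∷ 1# ∷ []) (idempotents-complete ee≡e)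
    λ { (here e≡0) → e≢0 e≡0 ; (there (here e≡1)) → e≢1 e≡1 }

  ∈-proper⁻ : ∀ {e} → e ∈ properIdempotents → e * e ≡ e × e ≢ 0# × e ≢ 1#
  ∈-proper⁻ e∈ = let (e∈I , e∉) = ∈-∖⁻ idempotents (0# ∷ 1# ∷ []) e∈ in
    idempotents-sound e∈I , (λ e≡0 → e∉ (here e≡0)) , λ e≡1 → e∉ (there (here e≡1))

  1+length-nonzero : 1 ℕ.+ length nonzeroIdempotents ≡ 2 ^ (2 ℕ.+ m)
  1+length-nonzero = trans
    (length-∖ idempotents-unique ([] ∷ []) (λ { (here refl) → idempotents-complete (zeroˡ 0#) }))
    idempotents-length

  2+length-proper : 2 ℕ.+ length properIdempotents ≡ 2 ^ (2 ℕ.+ m)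
  2+length-proper = trans
    (length-∖ idempotents-unique ((≢-sym 1≢0 ∷ []) ∷ [] ∷ [])
      (λ { (here refl) → idempotents-complete (zeroˡ 0#) ; (there (here refl)) → idempotents-complete 1-idempotent }))
    idempotents-length

  vertices : List (Pair R)
  vertices = cartesianProduct nonzeroIdempotents unitList

  vertices-unique : Unique vertices
  vertices-unique = Uniq.cartesianProduct⁺ nonzeroIdempotents-unique (Uniq.filter⁺ (isUnit? R) (Uniq.allFin⁺ size))

  ∈-vertices⁺ : ∀ {x} → V x → x ∈ vertices
  ∈-vertices⁺ (ee≡e , e≢0 , unit) = ∈-cartesianProduct⁺ (∈-nonzero⁺ ee≡e e≢0) (∈-filter⁺ (isUnit? R) (∈-allFin _) unit)

  ∈-vertices⁻ : ∀ {x} → x ∈ vertices → V x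
  ∈-vertices⁻ x∈ with ∈-cartesianProduct⁻ nonzeroIdempotents unitList x∈
  ... | e∈ , u∈ with ∈-nonzero⁻ e∈
  ...   | ee≡e , e≢0 = ee≡e , e≢0 , proj₂ (∈-filter⁻ (isUnit? R) {xs = allFin size} u∈)

  length-vertices : length vertices ≡ (2 ^ (2 ℕ.+ m) ∸ 1) ℕ.* numUnits R
  length-vertices = trans (length-cartesianProduct nonzeroIdempotents unitList)
    (cong (ℕ._* numUnits R) (cong (_∸ 1) 1+length-nonzero))

  Independent : List (Pair R) → Set
  Independent I = ∀ {x y} → x ∈ I → y ∈ I → ¬ Edge x y

  sdim-complement : ∀ {α} I₀ → Unique I₀ → (∀ {x} → x ∈ I₀ → V x) → Independent I₀ → length I₀ ≡ α →
    (∀ I → Unique I → (∀ {x} → x ∈ I → V x) → Independent I → length I ≤ α) →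
    SdimCl₂ R ((2 ^ (2 ℕ.+ m) ∸ 1) ℕ.* numUnits R ∸ α)
  sdim-complement {α} I₀ I₀-unique I₀-vertices I₀-independent refl maximal =
      (S , P.∖-unique I₀ vertices-unique , covers⇒resolving (All.tabulate S-vertices) covers , S-length)
    , minimal
    where
    S : List (Pair R)
    S = vertices P.∖ I₀

    S-vertices : ∀ {x} → x ∈ S → V x
    S-vertices x∈ = ∈-vertices⁻ (proj₁ (P.∈-∖⁻ vertices I₀ x∈))

    covers : Covers S
    covers {x} {y} vx vy xy with x ∈? I₀ | y ∈? I₀
    ... | no x∉  | _      = inj₁ (P.∈-∖⁺ vertices I₀ (∈-vertices⁺ vx) x∉)
    ... | yes _  | no y∉  = inj₂ (P.∈-∖⁺ vertices I₀ (∈-vertices⁺ vy) y∉)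
    ... | yes x∈ | yes y∈ = contradiction xy (I₀-independent x∈ y∈)

    S-length : length S ≡ (2 ^ (2 ℕ.+ m) ∸ 1) ℕ.* numUnits R ∸ length I₀
    -- The lengths of `I₀` and `S` add up to the number of vertices, so `∸` does not truncate here.
    S-length = trans (sym (ℕₚ.m+n∸m≡n (length I₀) (length S)))
      (cong (_∸ length I₀) (trans (P.length-∖ vertices-unique I₀-unique (∈-vertices⁺ ∘ I₀-vertices)) length-vertices))

    minimal : ∀ T → Unique T → IsStrongResolvingSet R T → (2 ^ (2 ℕ.+ m) ∸ 1) ℕ.* numUnits R ∸ length I₀ ≤ length T
    minimal T T-unique resolving@(T-vertices , _) = ℕₚ.m≤n+o⇒m∸n≤o _ (length I₀) (begin
      (2 ^ (2 ℕ.+ m) ∸ 1) ℕ.* numUnits R       ≡⟨ sym length-vertices ⟩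
      length vertices                          ≡⟨ sym (P.length-∖ vertices-unique T-unique (∈-vertices⁺ ∘ All.lookup T-vertices)) ⟩
      length T ℕ.+ length (vertices P.∖ T)     ≡⟨ ℕₚ.+-comm (length T) _ ⟩
      length (vertices P.∖ T) ℕ.+ length T     ≤⟨ ℕₚ.+-monoˡ-≤ (length T) (maximal _ (P.∖-unique T vertices-unique)
                                                    (λ x∈ → ∈-vertices⁻ (proj₁ (P.∈-∖⁻ vertices T x∈))) independent) ⟩
      length I₀ ℕ.+ length T                   ∎)
      where
      open ℕₚ.≤-Reasoning
      independent : Independent (vertices P.∖ T)
      independent x∈ y∈ xy with P.∈-∖⁻ vertices T x∈ | P.∈-∖⁻ vertices T y∈
      ... | x∈V , x∉T | y∈V , y∉T =
        [ x∉T , y∉T ] (resolving⇒covers resolving (∈-vertices⁻ x∈V) (∈-vertices⁻ y∈V) xy)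


  1-squared : ∀ {s} → s ≡ 1# ⊎ s ≡ 1# → s * s ≡ 1#
  1-squared (inj₁ refl) = *-identityˡ 1#
  1-squared (inj₂ refl) = *-identityˡ 1#

  -- The vertices over proper idempotents carry p and p⁻¹, those over `1#` carry t and t⁻¹. The
  -- condition `disjoint` rules out `top-low`, and `spread` rules out `low-low` between different
  -- idempotents with the same unit. It is applied with p = 1, t ∈ U″ for n ≥ 3 (size 2ⁿ - 2 + 2),
  -- and for n = 2 with p ∈ U″ and t = 1 (size 5) or t in another pair of U″ (size 6).
  module Construction {p p′ t t′ : Carrier} (pp′≡1 : p * p′ ≡ 1#) (tt′≡1 : t * t′ ≡ 1#)
    (disjoint : ∀ s → s ≡ p ⊎ s ≡ p′ → s ≡ t ⊎ s ≡ t′ → s * s ≡ 1#)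
    (spread : p ≡ p′ ⊎ (∀ {e f} → e * e ≡ e → f * f ≡ f → e ≢ 1# → f ≢ 1# → e ≢ f → e * f ≡ 0#))
    (ps ts : List Carrier) (ps-unique : Unique ps) (ts-unique : Unique ts)
    (ps⊆ : ∀ {s} → s ∈ ps → s ≡ p ⊎ s ≡ p′) (ts⊆ : ∀ {s} → s ∈ ts → s ≡ t ⊎ s ≡ t′) where

    set : List (Pair R)
    set = cartesianProduct properIdempotents ps ++ map (1# ,_) ts

    Member : Pair R → Set
    Member (e , s) = (e * e ≡ e × e ≢ 0# × e ≢ 1# × (s ≡ p ⊎ s ≡ p′)) ⊎ (e ≡ 1# × (s ≡ t ⊎ s ≡ t′))

    member : ∀ {x} → x ∈ set → Member x
    member x∈ with ∈-++⁻ (cartesianProduct properIdempotents ps) x∈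
    ... | inj₁ x∈low with ∈-cartesianProduct⁻ properIdempotents ps x∈low
    ...   | e∈ , s∈ with ∈-proper⁻ e∈
    ...     | ee≡e , e≢0 , e≢1 = inj₁ (ee≡e , e≢0 , e≢1 , ps⊆ s∈)
    member x∈ | inj₂ x∈top with ∈-map⁻ (1# ,_) x∈top
    ...   | s , s∈ , refl = inj₂ (refl , ts⊆ s∈)

    set-unique : Unique set
    set-unique = Uniq.++⁺ (Uniq.cartesianProduct⁺ properIdempotents-unique ps-unique)
      (Uniq.map⁺ ,-injectiveʳ ts-unique) disjoint-parts
      where
      disjoint-parts : ∀ {x} → x ∈ cartesianProduct properIdempotents ps × x ∈ map (1# ,_) ts → ⊥
      disjoint-parts (x∈low , x∈top) with ∈-cartesianProduct⁻ properIdempotents ps x∈low | ∈-map⁻ (1# ,_) x∈top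
      ... | e∈ , _ | _ , _ , refl = proj₂ (proj₂ (∈-proper⁻ e∈)) refl

    set-length : length set ≡ length properIdempotents ℕ.* length ps ℕ.+ length ts
    set-length = trans (length-++ (cartesianProduct properIdempotents ps))
      (cong₂ ℕ._+_ (length-cartesianProduct properIdempotents ps) (length-map (1# ,_) ts))

    either-unit : ∀ {q q′ s} → q * q′ ≡ 1# → s ≡ q ⊎ s ≡ q′ → IsUnit R s
    either-unit qq′≡1 (inj₁ refl) = _ , qq′≡1
    either-unit qq′≡1 (inj₂ refl) = inverse-unit qq′≡1

    set-vertices : ∀ {x} → x ∈ set → V x
    set-vertices x∈ with member x∈
    ... | inj₁ (ee≡e , e≢0 , _ , s) = ee≡e , e≢0 , either-unit pp′≡1 s
    ... | inj₂ (refl , s) = 1-vertex (either-unit tt′≡1 s)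

    distinct-inverse : ∀ {q q′ s s′} → q * q′ ≡ 1# → s ≡ q ⊎ s ≡ q′ → s′ ≡ q ⊎ s′ ≡ q′ → s ≢ s′ → s * s′ ≡ 1#
    distinct-inverse qq′≡1 (inj₁ refl) (inj₁ refl) s≢s′ = contradiction refl s≢s′
    distinct-inverse qq′≡1 (inj₁ refl) (inj₂ refl) s≢s′ = qq′≡1
    distinct-inverse qq′≡1 (inj₂ refl) (inj₁ refl) s≢s′ = comm₁ qq′≡1
    distinct-inverse qq′≡1 (inj₂ refl) (inj₂ refl) s≢s′ = contradiction refl s≢s′

    no-edge : ∀ {x y} → Member x → Member y → ¬ Edge x y
    no-edge mx my (flip xy) = no-edge my mx xy
    no-edge (inj₁ (_ , _ , e≢1 , _)) _ (top-top _ _) = e≢1 refl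
    no-edge (inj₂ _) (inj₁ (_ , _ , f≢1 , _)) (top-top _ _) = f≢1 refl
    no-edge (inj₂ (_ , s)) (inj₂ (_ , s′)) (top-top u≢v uv≢1) = uv≢1 (distinct-inverse tt′≡1 s s′ u≢v)
    no-edge (inj₁ (_ , _ , e≢1 , _)) _ (top-low _ _) = e≢1 refl
    no-edge (inj₂ _) (inj₂ (f≡1 , _)) (top-low f≢1 _) = f≢1 f≡1
    no-edge (inj₂ (_ , s)) (inj₁ (_ , _ , _ , s′)) (top-low _ uu≢1) = uu≢1 (disjoint _ s′ s)
    no-edge (inj₂ (e≡1 , _)) _ (low-low e≢1 _ _ _ _) = e≢1 e≡1
    no-edge (inj₁ _) (inj₂ (f≡1 , _)) (low-low _ f≢1 _ _ _) = f≢1 f≡1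
    no-edge {e , u} {f , v} (inj₁ (ee≡e , _ , _ , s)) (inj₁ (ff≡f , _ , _ , s′)) (low-low e≢1 f≢1 x≢y ef≢0 uv≢1)
      with e F.≟ f | u F.≟ v
    ... | _        | no u≢v   = uv≢1 (distinct-inverse pp′≡1 s s′ u≢v)
    ... | yes refl | yes refl = x≢y refl
    ... | no e≢f   | yes refl = [ (λ p≡p′ → uv≢1 (square p≡p′ s)) , (λ orthogonal → ef≢0 (orthogonal ee≡e ff≡f e≢1 f≢1 e≢f)) ] spread
      where
      square : p ≡ p′ → u ≡ p ⊎ u ≡ p′ → u * u ≡ 1#
      square refl (inj₁ refl) = pp′≡1
      square refl (inj₂ refl) = pp′≡1

    set-independent : Independent set
    set-independent x∈ y∈ = no-edge (member x∈) (member y∈)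

  module Bound (I : List (Pair R)) (I-vertices : ∀ {x} → x ∈ I → V x) (independent : Independent I) where

    same-level : ∀ {e u v} → (e , u) ∈ I → (e , v) ∈ I → u ≢ v → u * v ≡ 1#
    same-level {e} {u} {v} x∈ y∈ u≢v = decidable-stable (u * v F.≟ 1#) edge⇒⊥
      where
      edge⇒⊥ : ¬ (u * v ≢ 1#)
      edge⇒⊥ uv≢1 with e F.≟ 1#
      ... | yes refl = independent x∈ y∈ (top-top u≢v uv≢1)
      ... | no e≢1 with I-vertices x∈
      ...   | ee≡e , e≢0 , _ = independent x∈ y∈ (low-low e≢1 e≢1 (≢-right u≢v) (λ ee≡0 → e≢0 (trans (sym ee≡e) ee≡0)) uv≢1)

    low-levels : ∀ {e f u v} → (e , u) ∈ I → (f , v) ∈ I → e ≢ 1# → f ≢ 1# → e ≢ f → e * f ≢ 0# → u * v ≡ 1#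
    low-levels {e} {f} {u} {v} x∈ y∈ e≢1 f≢1 e≢f ef≢0 = decidable-stable (u * v F.≟ 1#)
      λ uv≢1 → independent x∈ y∈ (low-low e≢1 f≢1 (≢-left e≢f) ef≢0 uv≢1)

    top-level : ∀ {f u} → (1# , u) ∈ I → (f , u) ∈ I → f ≢ 1# → u * u ≡ 1#
    top-level {f} {u} x∈ y∈ f≢1 = decidable-stable (u * u F.≟ 1#) λ uu≢1 → independent x∈ y∈ (top-low f≢1 uu≢1)

    -- I contains at most two pairs over each idempotent; Second marks the larger one of two.
    Second : Pair R → Set
    Second (e , u) = ∃ λ v → (e , v) ∈ I × v F.< u

    second? : ∀ x → Dec (Second x)
    second? (e , u) = any? λ v → ((e , v) ∈? I) ×-dec (v F.<? u)

    -- Units over one idempotent are pairwise inverse. With s < u < v over `e`, both `s` and `v`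
    -- would be the inverse of `u`.
    seconds-unique : ∀ {e u v} → (e , u) ∈ I → (e , v) ∈ I → Second (e , u) → Second (e , v) → u ≡ v
    seconds-unique {e} {u} {v} x∈ y∈ (s , s∈ , s<u) (t , t∈ , t<v) with <-cmp u v
    ... | tri≈ _ u≡v _ = u≡v
    ... | tri< u<v _ _ = contradiction
      (inverse-unique (comm₁ (same-level s∈ x∈ (<⇒≢ s<u))) (same-level x∈ y∈ (<⇒≢ u<v)))
      (<⇒≢ (ℕₚ.<-trans s<u u<v))
    ... | tri> _ _ v<u = contradiction
      (inverse-unique (comm₁ (same-level t∈ y∈ (<⇒≢ t<v))) (same-level y∈ x∈ (<⇒≢ v<u)))
      (<⇒≢ (ℕₚ.<-trans t<v v<u))

    firsts-unique : ∀ {e u v} → (e , u) ∈ I → (e , v) ∈ I → ¬ Second (e , u) → ¬ Second (e , v) → u ≡ v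
    firsts-unique {e} {u} {v} x∈ y∈ ¬x ¬y with <-cmp u v
    ... | tri≈ _ u≡v _ = u≡v
    ... | tri< u<v _ _ = contradiction (u , x∈ , u<v) ¬y
    ... | tri> _ _ v<u = contradiction (v , y∈ , v<u) ¬x

    -- A unit over `f` would be inverse to both units over `e`, which are different.
    second-excludes : ∀ {e f u w} → (e , u) ∈ I → Second (e , u) → e ≢ 1# → f ≢ 1# → e ≢ f → e * f ≢ 0# → (f , w) ∉ I
    second-excludes x∈ (v , y∈ , v<u) e≢1 f≢1 e≢f ef≢0 z∈ = <⇒≢ v<u
      (inverse-unique (comm₁ (low-levels y∈ z∈ e≢1 f≢1 e≢f ef≢0)) (comm₁ (low-levels x∈ z∈ e≢1 f≢1 e≢f ef≢0)))

-- The independence number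

-- Subtraction of 1 modulo n, serving as an injection of the atoms without fixed points.
cyclicPred : ∀ {m} → Fin (2 ℕ.+ m) → Fin (2 ℕ.+ m)
cyclicPred {m} F.zero = F.fromℕ (suc m)
cyclicPred (F.suc i) = F.inject₁ i

cyclicPred-injective : ∀ {m} {i j : Fin (2 ℕ.+ m)} → cyclicPred i ≡ cyclicPred j → i ≡ j
cyclicPred-injective {i = F.zero} {F.zero} _ = refl
cyclicPred-injective {i = F.zero} {F.suc j} eq = contradiction eq fromℕ≢inject₁
cyclicPred-injective {i = F.suc i} {F.zero} eq = contradiction (sym eq) fromℕ≢inject₁
cyclicPred-injective {i = F.suc i} {F.suc j} eq = cong F.suc (inject₁-injective eq)

cyclicPred-≢ : ∀ {m} (i : Fin (2 ℕ.+ m)) → cyclicPred i ≢ i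
cyclicPred-≢ (F.suc (F.suc i)) eq = cyclicPred-≢′ i (suc-injective eq)
  where
  cyclicPred-≢′ : ∀ {m} (i : Fin m) → F.inject₁ i ≢ F.suc i
  cyclicPred-≢′ (F.suc i) eq = cyclicPred-≢′ i (suc-injective eq)

-- This is where n ≥ 3 enters: with only two atoms, `1# - ε (cyclicPred i)` would be `ε i` itself
-- and `moves` would fail.
third : ∀ {m} (i j : Fin (3 ℕ.+ m)) → ∃ λ k → k ≢ i × k ≢ j
third F.zero F.zero = F.suc F.zero , (λ ()) , λ ()
third F.zero (F.suc F.zero) = F.suc (F.suc F.zero) , (λ ()) , λ ()
third F.zero (F.suc (F.suc _)) = F.suc F.zero , (λ ()) , λ ()
third (F.suc F.zero) F.zero = F.suc (F.suc F.zero) , (λ ()) , λ ()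
third (F.suc (F.suc _)) F.zero = F.suc F.zero , (λ ()) , λ ()
third (F.suc _) (F.suc _) = F.zero , (λ ()) , λ ()

module Displacement (R : FiniteCommRing) (m : ℕ) (boolean : BooleanIdempotents R (3 ℕ.+ m)) where
  open Arithmetic R
  open BooleanIdempotents boolean

  -- In terms of subsets of Fin n: a singleton {i} goes to the complement of {i - 1}, a larger set loses a point.
  -- The value is a proper idempotent other than e meeting e, and disjoint arguments have different values.
  shift : Carrier → Carrier
  shift e with any? (λ i → (e * ε i) F.≟ ε i)
  ... | no _ = 0#
  ... | yes (i , _) with e F.≟ ε i
  ...   | yes _ = 1# - ε (cyclicPred i)
  ...   | no _  = e * (1# - ε i)

  data Shift (e : Carrier) : Carrier → Set where
    atom    : ∀ i → e ≡ ε i → Shift e (1# - ε (cyclicPred i))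
    nonatom : ∀ i → e ≢ ε i → e * ε i ≡ ε i → Shift e (e * (1# - ε i))

  -- By `ε-below` a nonzero idempotent lies above an atom, so the default value `0#` of `shift` does
  -- not occur.
  shift-view : ∀ {e} → e * e ≡ e → e ≢ 0# → Shift e (shift e)
  shift-view {e} ee≡e e≢0 with any? (λ i → (e * ε i) F.≟ ε i)
  ... | no none = contradiction (ε-below ee≡e e≢0) none
  ... | yes (i , eεᵢ≡εᵢ) with e F.≟ ε i
  ...   | yes e≡εᵢ = atom i e≡εᵢ
  ...   | no e≢εᵢ  = nonatom i e≢εᵢ eεᵢ≡εᵢ

  [1-ε]*ε : ∀ {i j} → i ≢ j → (1# - ε j) * ε i ≡ ε i
  [1-ε]*ε {i} {j} i≢j = trans (solve 2 (λ x y → (κ 1 :- y) :* x := x :- x :* y) refl (ε i) (ε j))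
    (trans (cong (λ z → ε i - z) (ε-orthogonal i≢j)) (solve 1 (λ x → x :- κ 0 := x) refl (ε i)))

  meets : ∀ {e h} → e * e ≡ e → e ≢ 0# → Shift e h → e * h ≢ 0#
  meets _ e≢0 (atom i refl) eq = e≢0 (trans (sym ([1-ε]*ε (≢-sym (cyclicPred-≢ i)))) (trans (*-comm _ _) eq))
  meets {e} ee≡e _ (nonatom i e≢εᵢ eεᵢ≡εᵢ) eq = e≢εᵢ (trans (e[1-f]≡0⇒e≡ef e (ε i)
    (trans (cong (_* (1# - ε i)) (sym ee≡e)) (trans (*-assoc e e _) eq))) eεᵢ≡εᵢ)

  below : ∀ {e} i → e * e ≡ e → e * (e * (1# - ε i)) ≡ e * (1# - ε i)
  below i ee≡e = trans (sym (*-assoc _ _ _)) (cong (_* (1# - ε i)) ee≡e)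

  proper : ∀ {e h} → e * e ≡ e → e ≢ 1# → Shift e h → h ≢ 1#
  proper _ _ (atom i _) eq = ε≢0 (cyclicPred i) (trans
    (solve 1 (λ x → x := κ 1 :- (κ 1 :- x)) refl (ε (cyclicPred i)))
    (trans (cong (λ z → 1# - z) eq) (-‿inverseʳ 1#)))
  proper {e} ee≡e e≢1 (nonatom i _ _) eq = e≢1 (begin
    e                        ≡⟨ sym (*-identityʳ e) ⟩
    e * 1#                   ≡⟨ cong (e *_) (sym eq) ⟩
    e * (e * (1# - ε i))     ≡⟨ below i ee≡e ⟩
    e * (1# - ε i)           ≡⟨ eq ⟩
    1#                       ∎)
    where open ≡-Reasoning

  moves : ∀ {e h} → Shift e h → h ≢ e
  moves (atom i refl) eq = let (k , k≢i , k≢j) = third i (cyclicPred i) in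
    ε≢0 k (trans (sym ([1-ε]*ε k≢j)) (trans (cong (_* ε k) eq) (ε-orthogonal (≢-sym k≢i))))
  moves {e} (nonatom i _ eεᵢ≡εᵢ) eq = ε≢0 i (begin
    ε i                          ≡⟨ sym eεᵢ≡εᵢ ⟩
    e * ε i                      ≡⟨ cong (_* ε i) (sym eq) ⟩
    e * (1# - ε i) * ε i         ≡⟨ solve 2 (λ e x → e :* (κ 1 :- x) :* x := e :* (x :- x :* x)) refl e (ε i) ⟩
    e * (ε i - ε i * ε i)        ≡⟨ cong (λ z → e * (ε i - z)) (ε-idempotent i) ⟩
    e * (ε i - ε i)              ≡⟨ solve 2 (λ e x → e :* (x :- x) := κ 0) refl e (ε i) ⟩
    0#                           ∎)
    where open ≡-Reasoning

  private
    nonatom-separates : ∀ {e f h} i → f * f ≡ f → e * f ≡ 0# → e * h ≢ 0# → h ≢ f * (1# - ε i)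
    nonatom-separates {e} {f} i ff≡f ef≡0 eh≢0 refl = eh≢0
      (trans (sym (*-assoc e f _)) (trans (cong (_* (1# - ε i)) ef≡0) (zeroˡ _)))

  -- A displaced non-atom stays below its origin, hence is orthogonal to the other idempotent, which
  -- its own displacement meets. Two atoms are told apart by injectivity of `cyclicPred`.
  separates : ∀ {e f h k} → e * e ≡ e → f * f ≡ f → e ≢ 0# → f ≢ 0# → e * f ≡ 0# → Shift e h → Shift f k → h ≢ k
  separates ee≡e ff≡f e≢0 f≢0 ef≡0 s (nonatom i _ _) = nonatom-separates i ff≡f ef≡0 (meets ee≡e e≢0 s)
  separates ee≡e ff≡f e≢0 f≢0 ef≡0 (nonatom i _ _) t =
    ≢-sym (nonatom-separates i ee≡e (trans (*-comm _ _) ef≡0) (meets ff≡f f≢0 t))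
  separates {e} {f} ee≡e ff≡f e≢0 f≢0 ef≡0 (atom i refl) (atom j refl) eq =
    e≢0 (trans (sym ee≡e) (subst (λ k → ε i * ε k ≡ 0#) (sym i≡j) ef≡0))
    where
    complement-injective : ∀ {x y} → 1# - x ≡ 1# - y → x ≡ y
    complement-injective {x} {y} eq = trans (solve 1 (λ x → x := κ 1 :- (κ 1 :- x)) refl x)
      (trans (cong (λ z → 1# - z) eq) (solve 1 (λ y → κ 1 :- (κ 1 :- y) := y) refl y))
    ε-injective : ∀ {i j} → ε i ≡ ε j → i ≡ j
    ε-injective {i} {j} eq = decidable-stable (i F.≟ j) λ i≢j →
      ε≢0 i (trans (sym (ε-idempotent i)) (trans (cong (ε i *_) eq) (ε-orthogonal i≢j)))
    i≡j : i ≡ j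
    i≡j = cyclicPred-injective (ε-injective (complement-injective eq))

-- At least three local factors

module AtLeastThree (R : FiniteCommRing) (m : ℕ) (boolean : BooleanIdempotents R (3 ℕ.+ m)) (U″ : U''NonEmpty R) where
  open Arithmetic R
  open BooleanIdempotents boolean
  open IndependentSets R (suc m) boolean U″
  open Displacement R m boolean

  bound : ∀ I → Unique I → (∀ {x} → x ∈ I → V x) → Independent I → length I ≤ 2 ^ (3 ℕ.+ m)
  bound I I-unique I-vertices independent =
    ℕₚ.≤-trans (length-≤ code I-unique (λ x∈ → code-idempotent x∈ (position _)) (λ x∈ y∈ → code-injective x∈ y∈ (position _) (position _)))
      (ℕₚ.≤-reflexive idempotents-length)
    where
    open Bound I I-vertices independent

    code : Pair R → Carrier
    code x@(e , _) with second? x | e F.≟ 1#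
    ... | no _  | _     = e
    ... | yes _ | yes _ = 0#
    ... | yes _ | no _  = shift e

    data Position : Pair R → Carrier → Set where
      first      : ∀ {x} → ¬ Second x → Position x (proj₁ x)
      top-second : ∀ {u} → Second (1# , u) → Position (1# , u) 0#
      low-second : ∀ {e u} → Second (e , u) → e ≢ 1# → Position (e , u) (shift e)

    position : ∀ x → Position x (code x)
    position x@(e , _) with second? x | e F.≟ 1#
    ... | no ¬second | _        = first ¬second
    ... | yes second | yes refl = top-second second
    ... | yes second | no e≢1   = low-second second e≢1

    shift-idempotent : ∀ {e h} → e * e ≡ e → Shift e h → h * h ≡ h
    shift-idempotent _ (atom i _) = complement-idempotent (ε-idempotent (cyclicPred i))
    shift-idempotent {e} ee≡e (nonatom i _ _) = trans
      (solve 2 (λ e c → (e :* c) :* (e :* c) := (e :* e) :* (c :* c)) refl e (1# - ε i))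
      (cong₂ _*_ ee≡e (complement-idempotent (ε-idempotent i)))

    code-idempotent : ∀ {x c} → x ∈ I → Position x c → c ∈ idempotents
    code-idempotent x∈ (first _) = idempotents-complete (proj₁ (I-vertices x∈))
    code-idempotent x∈ (top-second _) = idempotents-complete (zeroˡ 0#)
    code-idempotent x∈ (low-second _ _) with I-vertices x∈
    ... | ee≡e , e≢0 , _ = idempotents-complete (shift-idempotent ee≡e (shift-view ee≡e e≢0))

    shift≢0 : ∀ {e u} → (e , u) ∈ I → shift e ≢ 0#
    shift≢0 {e} x∈ eq with I-vertices x∈
    ... | ee≡e , e≢0 , _ = meets ee≡e e≢0 (shift-view ee≡e e≢0) (trans (cong (e *_) eq) (zeroʳ e))

    shift∉ : ∀ {e u v} → (e , u) ∈ I → Second (e , u) → e ≢ 1# → (shift e , v) ∉ I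
    shift∉ x∈ second e≢1 with I-vertices x∈
    ... | ee≡e , e≢0 , _ = second-excludes x∈ second e≢1 (proper ee≡e e≢1 view) (≢-sym (moves view)) (meets ee≡e e≢0 view)
      where view = shift-view ee≡e e≢0

    -- A first vertex never has the code of a second one: no vertex lies over `0#`, and `I` has none
    -- over `shift e` once `e` carries two. Second vertices over different proper idempotents exist
    -- only when these are orthogonal, and then `separates` applies.
    code-injective : ∀ {x y c d} → x ∈ I → y ∈ I → Position x c → Position y d → c ≡ d → x ≡ y
    code-injective x∈ y∈ (first ¬x) (first ¬y) refl = cong (_ ,_) (firsts-unique x∈ y∈ ¬x ¬y)
    code-injective x∈ y∈ (first _) (top-second _) refl = contradiction refl (proj₁ (proj₂ (I-vertices x∈)))
    code-injective x∈ y∈ (first _) (low-second y f≢1) refl = contradiction x∈ (shift∉ y∈ y f≢1)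
    code-injective x∈ y∈ (top-second _) (first _) refl = contradiction refl (proj₁ (proj₂ (I-vertices y∈)))
    code-injective x∈ y∈ (low-second x e≢1) (first _) refl = contradiction y∈ (shift∉ x∈ x e≢1)
    code-injective x∈ y∈ (top-second x) (top-second y) refl = cong (_ ,_) (seconds-unique x∈ y∈ x y)
    code-injective x∈ y∈ (top-second _) (low-second _ _) eq = contradiction (sym eq) (shift≢0 y∈)
    code-injective x∈ y∈ (low-second _ _) (top-second _) eq = contradiction eq (shift≢0 x∈)
    code-injective {e , u} {f , v} x∈ y∈ (low-second x e≢1) (low-second y f≢1) eq
      with e F.≟ f | (e * f) F.≟ 0# | I-vertices x∈ | I-vertices y∈
    ... | yes refl | _ | _ | _ = cong (_ ,_) (seconds-unique x∈ y∈ x y)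
    ... | no e≢f | no ef≢0 | _ | _ = contradiction y∈ (second-excludes x∈ x e≢1 f≢1 e≢f ef≢0)
    ... | no _ | yes ef≡0 | ee≡e , e≢0 , _ | ff≡f , f≢0 , _ = contradiction eq
      (separates ee≡e ff≡f e≢0 f≢0 ef≡0 (shift-view ee≡e e≢0) (shift-view ff≡f f≢0))

  sdim : SdimCl₂ R ((2 ^ (3 ℕ.+ m) ∸ 1) ℕ.* numUnits R ∸ 2 ^ (3 ℕ.+ m))
  sdim = let (w , (w′ , ww′≡1) , ww≢1) = U″ in sdim′ w w′ ww′≡1 ww≢1
    where
    sdim′ : ∀ w w′ → w * w′ ≡ 1# → w * w ≢ 1# → SdimCl₂ R ((2 ^ (3 ℕ.+ m) ∸ 1) ℕ.* numUnits R ∸ 2 ^ (3 ℕ.+ m))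
    sdim′ w w′ ww′≡1 ww≢1 = sdim-complement set set-unique set-vertices set-independent
      (trans set-length (trans (cong (ℕ._+ 2) (ℕₚ.*-identityʳ (length properIdempotents))) (trans (ℕₚ.+-comm _ 2) 2+length-proper)))
      bound
      where
      w≢w′ : w ≢ w′
      w≢w′ refl = ww≢1 ww′≡1
      open Construction {1#} {1#} {w} {w′} (*-identityˡ 1#) ww′≡1
        (λ _ s≡1 _ → 1-squared s≡1)
        (inj₁ refl) (1# ∷ []) (w ∷ w′ ∷ []) ([] ∷ []) ((w≢w′ ∷ []) ∷ [] ∷ [])
        ∈-singleton ∈-doubleton

-- Two local factors

module Two (R : FiniteCommRing) (boolean : BooleanIdempotents R 2) (U″ : U''NonEmpty R) where
  open Arithmetic R
  open BooleanIdempotents boolean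
  open IndependentSets R 0 boolean U″
  open DecMembership (≡-dec (F._≟_ {size}) (F._≟_ {size})) using (_∈?_)

  other : ∀ {i j k : Fin 2} → i ≢ j → k ≡ i ⊎ k ≡ j
  other {F.zero} {F.zero} i≢j = contradiction refl i≢j
  other {F.zero} {F.suc F.zero} {F.zero} _ = inj₁ refl
  other {F.zero} {F.suc F.zero} {F.suc F.zero} _ = inj₂ refl
  other {F.suc F.zero} {F.zero} {F.zero} _ = inj₂ refl
  other {F.suc F.zero} {F.zero} {F.suc F.zero} _ = inj₁ refl
  other {F.suc F.zero} {F.suc F.zero} i≢j = contradiction refl i≢j

  all-atoms⇒1 : ∀ {e} → e * e ≡ e → (∀ k → e * ε k ≡ ε k) → e ≡ 1#
  all-atoms⇒1 {e} ee≡e above = decidable-stable (e F.≟ 1#) λ e≢1 →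
    let (k , eq) = ε-below (complement-idempotent ee≡e) (complement≢0 e≢1) in
    ε≢0 k (trans (sym eq) (trans (solve 2 (λ e x → (κ 1 :- e) :* x := x :- e :* x) refl e (ε k))
      (trans (cong (λ z → ε k - z) (above k)) (-‿inverseʳ (ε k)))))

  -- If `e` were strictly above `ε i`, then `e * (1# - ε i)` would be nonzero and lie above the
  -- other atom; being above both atoms, `e` would be `1#`.
  proper⇒atom : ∀ {e i} → e * e ≡ e → e ≢ 1# → e * ε i ≡ ε i → e ≡ ε i
  proper⇒atom {e} {i} ee≡e e≢1 eεᵢ≡εᵢ = decidable-stable (e F.≟ ε i) λ e≢εᵢ →
    e≢1 (all-atoms⇒1 ee≡e (above e≢εᵢ))
    where
    c = 1# - ε i
    ec-idempotent : (e * c) * (e * c) ≡ e * c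
    ec-idempotent = trans (solve 2 (λ e c → (e :* c) :* (e :* c) := (e :* e) :* (c :* c)) refl e c)
      (cong₂ _*_ ee≡e (complement-idempotent (ε-idempotent i)))
    above : e ≢ ε i → ∀ k → e * ε k ≡ ε k
    above e≢εᵢ k with ε-below ec-idempotent (λ ec≡0 → e≢εᵢ (trans (e[1-f]≡0⇒e≡ef e (ε i) ec≡0) eεᵢ≡εᵢ))
    ... | j , ecεⱼ≡εⱼ = [ (λ { refl → eεᵢ≡εᵢ }) , (λ { refl → eεⱼ≡εⱼ }) ] (other {i} {j} {k} i≢j)
      where
      i≢j : i ≢ j
      i≢j refl = ε≢0 i (begin
        ε i                       ≡⟨ sym ecεⱼ≡εⱼ ⟩
        e * c * ε i               ≡⟨ solve 2 (λ e x → e :* (κ 1 :- x) :* x := e :* (x :- x :* x)) refl e (ε i) ⟩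
        e * (ε i - ε i * ε i)     ≡⟨ cong (λ z → e * (ε i - z)) (ε-idempotent i) ⟩
        e * (ε i - ε i)           ≡⟨ solve 2 (λ e x → e :* (x :- x) := κ 0) refl e (ε i) ⟩
        0#                        ∎)
        where open ≡-Reasoning
      eεⱼ≡εⱼ : e * ε j ≡ ε j
      eεⱼ≡εⱼ = begin
        e * ε j                ≡⟨ cong (e *_) (sym ecεⱼ≡εⱼ) ⟩
        e * (e * c * ε j)      ≡⟨ solve 3 (λ e c x → e :* (e :* c :* x) := (e :* e) :* c :* x) refl e c (ε j) ⟩
        (e * e) * c * ε j      ≡⟨ cong (λ z → z * c * ε j) ee≡e ⟩
        e * c * ε j            ≡⟨ ecεⱼ≡εⱼ ⟩
        ε j                    ∎
        where open ≡-Reasoning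

  -- A nonzero product lies above some atom, and then `e` and `f` are both equal to that atom.
  orthogonal : ∀ {e f} → e * e ≡ e → f * f ≡ f → e ≢ 1# → f ≢ 1# → e ≢ f → e * f ≡ 0#
  orthogonal {e} {f} ee≡e ff≡f e≢1 f≢1 e≢f = decidable-stable (e * f F.≟ 0#) λ ef≢0 →
    let (i , efεᵢ≡εᵢ) = ε-below (trans (solve 2 (λ e f → (e :* f) :* (e :* f) := (e :* e) :* (f :* f)) refl e f) (cong₂ _*_ ee≡e ff≡f)) ef≢0 in
    e≢f (trans (proper⇒atom ee≡e e≢1 (absorb e f i ee≡e efεᵢ≡εᵢ))
      (sym (proper⇒atom ff≡f f≢1 (absorb f e i ff≡f (trans (cong (_* ε i) (*-comm f e)) efεᵢ≡εᵢ)))))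
    where
    absorb : ∀ e f i → e * e ≡ e → e * f * ε i ≡ ε i → e * ε i ≡ ε i
    absorb e f i ee≡e eq = begin
      e * ε i                ≡⟨ cong (e *_) (sym eq) ⟩
      e * (e * f * ε i)      ≡⟨ solve 3 (λ e f x → e :* (e :* f :* x) := (e :* e) :* f :* x) refl e f (ε i) ⟩
      (e * e) * f * ε i      ≡⟨ cong (λ z → z * f * ε i) ee≡e ⟩
      e * f * ε i            ≡⟨ eq ⟩
      ε i                    ∎
      where open ≡-Reasoning

  length-nonzero : length nonzeroIdempotents ≡ 3
  length-nonzero = ℕₚ.suc-injective 1+length-nonzero

  length-proper : length properIdempotents ≡ 2
  length-proper = ℕₚ.suc-injective (ℕₚ.suc-injective 2+length-proper)

  module Bounds (I : List (Pair R)) (I-unique : Unique I) (I-vertices : ∀ {x} → x ∈ I → V x) (independent : Independent I) where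
    open Bound I I-vertices independent

    tag : Pair R → Carrier × Bool
    tag x = proj₁ x , does (second? x)

    tag-injective : ∀ {x y} → x ∈ I → y ∈ I → tag x ≡ tag y → x ≡ y
    tag-injective {e , u} {f , v} x∈ y∈ eq with second? (e , u) | second? (f , v)
    tag-injective x∈ y∈ refl | yes x | yes y = cong (_ ,_) (seconds-unique x∈ y∈ x y)
    tag-injective x∈ y∈ refl | no ¬x | no ¬y = cong (_ ,_) (firsts-unique x∈ y∈ ¬x ¬y)

    bound-by : ∀ xs → (∀ {x} → x ∈ I → tag x ∈ xs) → length I ≤ length xs
    bound-by xs into = length-≤ tag I-unique into tag-injective

    nonzero : ∀ {x} → x ∈ I → proj₁ x ∈ nonzeroIdempotents
    nonzero x∈ = let (ee≡e , e≢0 , _) = I-vertices x∈ in ∈-nonzero⁺ ee≡e e≢0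

    bound-6 : length I ≤ 6
    bound-6 = ℕₚ.≤-trans (bound-by _ (λ {x} x∈ → ∈-cartesianProduct⁺ (nonzero x∈) (booleans (does (second? x)))))
      (ℕₚ.≤-reflexive (trans (length-cartesianProduct nonzeroIdempotents (false ∷ true ∷ [])) (cong (ℕ._* 2) length-nonzero)))
      where
      booleans : ∀ b → b ∈ false ∷ true ∷ []
      booleans false = here refl
      booleans true = there (here refl)

    firsts : List (Carrier × Bool)
    firsts = map (_, false) nonzeroIdempotents

    into : ∀ {x} ys → x ∈ I → (Second x → (proj₁ x , true) ∈ ys) → tag x ∈ firsts ++ ys
    into {x} ys x∈ second∈ with second? x
    ... | no _ = ∈-++⁺ˡ (∈-map⁺ (_, false) (nonzero x∈))
    ... | yes second = ∈-++⁺ʳ firsts (second∈ second)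

    bound-++ : ∀ ys → (∀ {x} → x ∈ I → Second x → (proj₁ x , true) ∈ ys) → length I ≤ 3 ℕ.+ length ys
    bound-++ ys second∈ = ℕₚ.≤-trans (bound-by _ (λ x∈ → into ys x∈ (second∈ x∈)))
      (ℕₚ.≤-reflexive (trans (length-++ firsts) (cong (ℕ._+ length ys) (trans (length-map (_, false) nonzeroIdempotents) length-nonzero))))

    -- If U″ = {u , u⁻¹}, two vertices over 1 and two over some e ≠ 1 would share a unit of U″.
    bound-5 : OnePair R → length I ≤ 5
    bound-5 onePair with any? (λ u → ((1# , u) ∈? I) ×-dec second? (1# , u))
    ... | no none = ℕₚ.≤-trans (bound-++ (map (_, true) properIdempotents) proper-seconds)
        (ℕₚ.≤-reflexive (cong (3 ℕ.+_) (trans (length-map (_, true) properIdempotents) length-proper)))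
      where
      proper-seconds : ∀ {x} → x ∈ I → Second x → (proj₁ x , true) ∈ map (_, true) properIdempotents
      proper-seconds {e , u} x∈ second = let (ee≡e , e≢0 , _) = I-vertices x∈ in
        ∈-map⁺ (_, true) (∈-proper⁺ ee≡e e≢0 λ { refl → none (u , x∈ , second) })
    -- Here no proper idempotent carries a second vertex, so the count is 3 + 1, one below the
    -- bound.
    ... | yes (u , x∈ , v , y∈ , v<u) = ℕₚ.≤-trans (bound-++ ((1# , true) ∷ []) top-seconds) (ℕₚ.n≤1+n 4)
      where
      vu≡1 : v * u ≡ 1#
      vu≡1 = same-level y∈ x∈ (<⇒≢ v<u)

      not-involution : ∀ {x y} → x ≢ y → x * y ≡ 1# → x * x ≢ 1#
      not-involution x≢y xy≡1 xx≡1 = x≢y (inverse-unique xx≡1 xy≡1)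

      uu≢1 : u * u ≢ 1#
      uu≢1 = not-involution (≢-sym (<⇒≢ v<u)) (comm₁ vu≡1)

      vv≢1 : v * v ≢ 1#
      vv≢1 = not-involution (<⇒≢ v<u) vu≡1

      no-low-second : ∀ {e s} → (e , s) ∈ I → Second (e , s) → e ≢ 1# → 1# ≡ 0#
      no-low-second {e} {s} z∈ (t , w∈ , t<s) e≢1
        with onePair u s (proj₂ (proj₂ (I-vertices x∈))) (proj₂ (proj₂ (I-vertices z∈)))
      ... | inj₁ uu≡1 = contradiction uu≡1 uu≢1
      ... | inj₂ (inj₁ ss≡1) = contradiction ss≡1
        (not-involution (≢-sym (<⇒≢ t<s)) (comm₁ (same-level w∈ z∈ (<⇒≢ t<s))))
      ... | inj₂ (inj₂ (inj₁ refl)) = contradiction (top-level x∈ z∈ e≢1) uu≢1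
      ... | inj₂ (inj₂ (inj₂ us≡1)) with inverse-unique us≡1 (comm₁ vu≡1)
      ...   | refl = contradiction (top-level y∈ z∈ e≢1) vv≢1

      top-seconds : ∀ {x} → x ∈ I → Second x → (proj₁ x , true) ∈ (1# , true) ∷ []
      top-seconds {e , s} z∈ second with e F.≟ 1#
      ... | yes refl = here refl
      ... | no e≢1 = contradiction (no-low-second z∈ second e≢1) 1≢0

  sdim-onePair : OnePair R → SdimCl₂ R (3 ℕ.* numUnits R ∸ 5)
  sdim-onePair onePair = let (w , (w′ , ww′≡1) , ww≢1) = U″ in sdim′ w w′ ww′≡1 ww≢1
    where
    sdim′ : ∀ w w′ → w * w′ ≡ 1# → w * w ≢ 1# → SdimCl₂ R (3 ℕ.* numUnits R ∸ 5)
    sdim′ w w′ ww′≡1 ww≢1 = sdim-complement set set-unique set-vertices set-independent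
      (trans set-length (cong (λ l → l ℕ.* 2 ℕ.+ 1) length-proper))
      (λ I I-unique I-vertices independent → Bounds.bound-5 I I-unique I-vertices independent onePair)
      where
      w≢w′ : w ≢ w′
      w≢w′ refl = ww≢1 ww′≡1
      open Construction {w} {w′} {1#} {1#} ww′≡1 (*-identityˡ 1#)
        (λ _ _ s≡1 → 1-squared s≡1)
        (inj₂ orthogonal) (w ∷ w′ ∷ []) (1# ∷ []) ((w≢w′ ∷ []) ∷ [] ∷ []) ([] ∷ [])
        ∈-doubleton ∈-singleton

  TwoPairs : Set
  TwoPairs = ∃ λ u → ∃ λ v → IsUnit R u × IsUnit R v × u * u ≢ 1# × v * v ≢ 1# × v ≢ u × u * v ≢ 1#

  onePair⊎twoPairs : OnePair R ⊎ TwoPairs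
  onePair⊎twoPairs
    with any? (λ u → any? (λ v → isUnit? R u ×-dec isUnit? R v ×-dec ¬? (u * u F.≟ 1#) ×-dec ¬? (v * v F.≟ 1#) ×-dec ¬? (v F.≟ u) ×-dec ¬? (u * v F.≟ 1#)))
  ... | yes pairs = inj₂ pairs
  ... | no none = inj₁ one
    where
    one : OnePair R
    one u v u-unit v-unit with u * u F.≟ 1# | v * v F.≟ 1# | v F.≟ u | u * v F.≟ 1#
    ... | yes uu≡1 | _ | _ | _ = inj₁ uu≡1
    ... | no _ | yes vv≡1 | _ | _ = inj₂ (inj₁ vv≡1)
    ... | no _ | no _ | yes v≡u | _ = inj₂ (inj₂ (inj₁ v≡u))
    ... | no _ | no _ | no _ | yes uv≡1 = inj₂ (inj₂ (inj₂ uv≡1))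
    ... | no uu≢1 | no vv≢1 | no v≢u | no uv≢1 = contradiction (u , v , u-unit , v-unit , uu≢1 , vv≢1 , v≢u , uv≢1) none

  sdim-twoPairs : TwoPairs → SdimCl₂ R (3 ℕ.* numUnits R ∸ 6)
  sdim-twoPairs (w , t , (w′ , ww′≡1) , (t′ , tt′≡1) , ww≢1 , tt≢1 , t≢w , wt≢1) =
    sdim-complement set set-unique set-vertices set-independent
      (trans set-length (cong (λ l → l ℕ.* 2 ℕ.+ 2) length-proper)) Bounds.bound-6
    where
    w≢w′ : w ≢ w′
    w≢w′ refl = ww≢1 ww′≡1
    t≢t′ : t ≢ t′
    t≢t′ refl = tt≢1 tt′≡1
    w′≢t : w′ ≢ t
    w′≢t refl = wt≢1 ww′≡1
    w≢t′ : w ≢ t′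
    w≢t′ refl = wt≢1 (comm₁ tt′≡1)
    w′≢t′ : w′ ≢ t′
    w′≢t′ refl = t≢w (inverse-unique (comm₁ tt′≡1) (comm₁ ww′≡1))
    disjoint : ∀ s → s ≡ w ⊎ s ≡ w′ → s ≡ t ⊎ s ≡ t′ → s * s ≡ 1#
    disjoint s (inj₁ refl) (inj₁ w≡t) = contradiction (sym w≡t) t≢w
    disjoint s (inj₁ refl) (inj₂ w≡t′) = contradiction w≡t′ w≢t′
    disjoint s (inj₂ refl) (inj₁ w′≡t) = contradiction w′≡t w′≢t
    disjoint s (inj₂ refl) (inj₂ w′≡t′) = contradiction w′≡t′ w′≢t′
    open Construction ww′≡1 tt′≡1 disjoint (inj₂ orthogonal) (w ∷ w′ ∷ []) (t ∷ t′ ∷ [])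
      ((w≢w′ ∷ []) ∷ [] ∷ []) ((t≢t′ ∷ []) ∷ [] ∷ [])
      ∈-doubleton
      ∈-doubleton

open import Data.Nat using (_*_)

theorem4p11 : (R : FiniteCommRing) (n : ℕ) (Rs : Fin n → FiniteCommRing) →
    2 ≤ n →
    ¬ IsLocal R →
    (∀ i → IsLocal (Rs i)) →
    IsoToProduct R n Rs →
    U''NonEmpty R →
    (3 ≤ n → SdimCl₂ R ((2 ^ n ∸ 1) * numUnits R ∸ 2 ^ n))
    × (n ≡ 2 → IsListedRing R → SdimCl₂ R (3 * numUnits R ∸ 5))
    × (n ≡ 2 → ¬ IsListedRing R → SdimCl₂ R (3 * numUnits R ∸ 6))
theorem4p11 R n Rs 2≤n _ locals iso U″ = case-i , case-ii , case-iii
  where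
  boolean : BooleanIdempotents R n
  boolean = Decomposition.booleanIdempotents locals iso

  case-i : 3 ≤ n → SdimCl₂ R ((2 ^ n ∸ 1) * numUnits R ∸ 2 ^ n)
  case-i (s≤s (s≤s (s≤s {n = m} _))) = AtLeastThree.sdim R m boolean U″

  case-ii : n ≡ 2 → IsListedRing R → SdimCl₂ R (3 * numUnits R ∸ 5)
  case-ii refl listed = Two.sdim-onePair R boolean U″ (listed⇒onePair R listed)

  case-iii : n ≡ 2 → ¬ IsListedRing R → SdimCl₂ R (3 * numUnits R ∸ 6)
  case-iii refl unlisted =
    [ (λ onePair → contradiction (onePair⇒listed locals iso U″ onePair) unlisted)
    , Two.sdim-twoPairs R boolean U″ ] (Two.onePair⊎twoPairs R boolean U″)
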